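{- Let $T$ be a tournament on $n$ vertices and let $k,m,t\in \mathbb{N}$ with $m\geq t\geq 2$. If $T$ is strongly $10^7k^6t^2m\log (ktm)$-connected, then $V(T)$ contains $t$ pairwise disjoint vertex sets $V_1,\dots, V_t$ such that for every $j\in \{1,\dots, t\}$: (i) $|V_j|\leq n/m$, and (ii) for any set $R\subseteq V(T)\setminus \bigcup_{i=1}^t V_i$ the subtournament $T[V_j\cup R]$ is strongly $k$-connected.
   Context: A tournament is an orientation of a complete graph. A tournament is strongly connected if for every ordered pair of vertices $u,v$ there is a directed path from $u$ to $v$. For $k\in\mathbb{N}$, a tournament $T$ is strongly $k$-connected if $|V(T)|>k$ and the removal of any set of fewer than $k$ vertices results in a strongly connected tournament. $T[U]$ denotes the subtournament induced by $U\subseteq V(T)$. Here $\log$ denotes $\log_2$. -}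

module Defs where

open import Data.Fin using (Fin)
open import Data.Fin.Subset using (Subset; _∈_; _⊆_; _─_; ∣_∣)
open import Data.Nat using (ℕ; _<_; _*_; _^_)
open import Data.Nat.Logarithm using (⌈log₂_⌉)
open import Data.Product using (_×_)
open import Level using (0ℓ)
open import Relation.Binary.Construct.Closure.ReflexiveTransitive using (Star)
open import Relation.Binary.Core using (Rel)
open import Relation.Binary.Definitions using (Trichotomous)
open import Relation.Binary.PropositionalEquality using (_≡_)

-- Trichotomy says that there are no loops and that any two distinct vertices
-- are joined by an arc in exactly one of the two directions.

record Tournament (n : ℕ) : Set₁ where
  field
    _⟶_     : Rel (Fin n) 0ℓ
    compare : Trichotomous _≡_ _⟶_

module _ {n : ℕ} (T : Tournament n) where

  open Tournament T

  -- Subtournaments are represented by their vertex set U inside T, so the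
  -- notions below are about T[U]; the tournament T itself is T[⊤].

  InducedArc : Subset n → Rel (Fin n) 0ℓ
  InducedArc U u v = u ∈ U × v ∈ U × u ⟶ v

  StronglyConnected : Subset n → Set
  StronglyConnected U = ∀ {u v} → u ∈ U → v ∈ U → Star (InducedArc U) u v

  Strongly_-Connected : ℕ → Subset n → Set
  Strongly_-Connected k U =
    k < ∣ U ∣ ×
    (∀ (S : Subset n) → S ⊆ U → ∣ S ∣ < k → StronglyConnected (U ─ S))

-- ⌈ 10⁷ k⁶ t² m log₂ (k t m) ⌉, computed as ⌈ log₂ ((k t m) ^ (10⁷ k⁶ t² m)) ⌉:
-- the coefficient moves inside the logarithm, so the only rounding is that of
-- the whole real number up to an integer.  A set has fewer than x vertices
-- exactly when it has fewer than ⌈ x ⌉ vertices, for every real x.  The numeral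
-- 10⁷ is the last factor so that normalisation does not unfold a product by it.

connectivityBound : ℕ → ℕ → ℕ → ℕ
connectivityBound k t m =
  ⌈log₂ (k * t * m) ^ (k ^ 6 * t ^ 2 * m * 10 ^ 7) ⌉

-- Call a small set A with a vertex a dominating the rest of A a block; greedy halving
-- starting from a vertex of low in-degree yields A such that only an exceptional set Ex⁻
-- of vertices, tiny compared with in-degrees, receives no arc from A.  Dually for B, b, Ex⁺.
-- If a set contains k disjoint units, each made of blocks A, B and a path from b to a, then
-- after deleting fewer than k vertices some unit survives, and every non-exceptional vertex
-- v gets v → B → b → a → A → u.  Exceptional vertices are handled by reserving for each of
-- them k in- and out-neighbours ("service") in its own class that are not exceptional.
--
-- The blocks and their reserved neighbours (pods) are set aside first.  Menger's theorem
-- then gives many disjoint paths between the b's and the a's off the pods, short on average,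
-- with a surplus of unused a's and b's.  When these paths cannot be shortened, an exceptional
-- vertex v off the pods and away from the last two vertices of each path is either dominated
-- by all surplus a's, which serve it, or sends an arc to one of them; in the latter case no
-- path contains in-neighbours of v except near its ends, and v can be served by fresh vertices.
-- The few vertices at the ends of paths may have almost all their neighbours on some other
-- path.  Choosing tk paths from a much larger system avoids these conflicts: such a
-- vertex is either still free or can join the class of the one selected path that hogs it.

module Submission where

open import Defs
open import Data.Bool using (true; false)
open import Data.Empty using (⊥-elim)
open import Data.Fin using (Fin; zero; suc; combine; remQuot)
open import Data.Fin.Properties using (any?; all?; _≟_; suc-injective; combine-injectiveʳ; remQuot-combine; combine-remQuot)
open import Data.Fin.Subset
  using (Subset; ⊤; ⋃; ∁; Empty; Nonempty; ⁅_⁆; _∈_; _∉_; _⊆_; _∩_; _∪_; _─_; _-_; ∣_∣)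
  renaming (⊥ to ∅)
open import Data.Fin.Subset.Properties
open import Data.Nat using (ℕ; zero; suc; _+_; _*_; _∸_; _^_; _≤_; _<_; _≥_; z≤n; s≤s; NonZero; >-nonZero; _<?_; _≤?_)
open import Data.Nat.Properties hiding (_≟_; suc-injective)
open import Data.Nat.Logarithm using (⌈log₂_⌉; ⌈log₂⌉-mono-≤; ⌈log₂2^n⌉≡n)
open import Data.Nat.Tactic.RingSolver using (solve-∀)
open import Data.Nat.Induction using (<-wellFounded)
open import Data.Product using (∃; Σ-syntax; ∃-syntax; _×_; _,_; proj₁; proj₂)
open import Data.Sum using (_⊎_; inj₁; inj₂; [_,_]′)
open import Data.Unit using (tt) renaming (⊤ to ⊤ₜ)
open import Data.List using (tabulate)
open import Data.Vec using ([]; _∷_; here; there) renaming (tabulate to tabulateᵛ)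
open import Data.Vec.Properties using (lookup∘tabulate; []=⇒lookup; lookup⇒[]=)
open import Algebra.Properties.CommutativeMonoid.Sum +-0-commutativeMonoid
  using (sum; ∑-comm; sum-cong-≗)
open import Function using (_∘_; id; flip; case_of_)
open import Level using (0ℓ)
open import Relation.Binary.Core using (Rel)
import Relation.Binary.Construct.Closure.ReflexiveTransitive as Star
open Star using (Star; ε; _◅_; _◅◅_)
open import Induction.WellFounded using (Acc; acc)
open import Relation.Binary.Definitions using (tri<; tri≈; tri>)
open import Relation.Binary.PropositionalEquality
open import Relation.Nullary using (Dec; yes; no; ¬_; does; contradiction; ¬?; _×-dec_; _⊎-dec_; _→-dec_)
open import Relation.Nullary.Decidable using (dec-true)

-- The set `R` of the statement is unknown when the classes are built, so a vertex left outside all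
-- of them must be served by each of the `t` classes, while a coloured vertex has to be served by
-- its own class only. Room for this service is the obstacle: the exceptional sets are not bounded
-- in terms of the connectivity and cannot be set aside. They are small only compared with the
-- degree of every vertex outside the blocks, which is enough as long as the paths do not eat up
-- that degree; tightness sees to this. Blocks of at most `c + 1` vertices make the ratio of degree
-- to exceptional set at least `2 ^ c / N`. It has to beat a multiple of `k * t * m`, and `N` is
-- itself a multiple of `t * k`; hence `c` is of order `log₂ (k * t * m)`, the origin of the
-- logarithm in the connectivity. The bound `n / m` on a class is met in quarters: one for all sets
-- of bounded size, one for its `k` paths, each with at most twice the average number of vertices of
-- `N * m` disjoint walks, and one for fresh neighbours, at most `2 * (k * t)` times the larger
-- exceptional set.

private variable
  a n : ℕ

-- Finite sets and counting

does⇒ : {A : Set} (d : Dec A) → does d ≡ true → A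
does⇒ (yes a) _ = a
does⇒ (no _) ()

𝟙 : {A : Set} → Dec A → ℕ
𝟙 (yes _) = 1
𝟙 (no _) = 0

abstract
  set : {P : Fin n → Set} → (∀ x → Dec (P x)) → Subset n
  set P? = tabulateᵛ (does ∘ P?)

  ∈set⁺ : {P : Fin n → Set} (P? : ∀ x → Dec (P x)) → ∀ {x} → P x → x ∈ set P?
  ∈set⁺ P? {x} px = lookup⇒[]= x _ (trans (lookup∘tabulate _ x) (dec-true (P? x) px))

  ∈set⁻ : {P : Fin n → Set} (P? : ∀ x → Dec (P x)) → ∀ {x} → x ∈ set P? → P x
  ∈set⁻ P? {x} x∈ = does⇒ (P? x) (trans (sym (lookup∘tabulate (does ∘ P?) x)) ([]=⇒lookup x∈))

  card-sum : {P : Fin n → Set} (P? : ∀ x → Dec (P x)) → ∣ set P? ∣ ≡ sum (λ x → 𝟙 (P? x))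
  card-sum {zero} P? = refl
  card-sum {suc n} P? with P? zero
  ... | yes _ = cong suc (card-sum (P? ∘ suc))
  ... | no _ = card-sum (P? ∘ suc)

∣p∪q∣≤∣p∣+∣q∣ : (p q : Subset n) → ∣ p ∪ q ∣ ≤ ∣ p ∣ + ∣ q ∣
∣p∪q∣≤∣p∣+∣q∣ [] [] = z≤n
∣p∪q∣≤∣p∣+∣q∣ (true ∷ p) (true ∷ q) =
  s≤s (≤-trans (∣p∪q∣≤∣p∣+∣q∣ p q) (+-monoʳ-≤ ∣ p ∣ (n≤1+n _)))
∣p∪q∣≤∣p∣+∣q∣ (true ∷ p) (false ∷ q) = s≤s (∣p∪q∣≤∣p∣+∣q∣ p q)
∣p∪q∣≤∣p∣+∣q∣ (false ∷ p) (true ∷ q) =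
  ≤-trans (s≤s (∣p∪q∣≤∣p∣+∣q∣ p q)) (≤-reflexive (sym (+-suc _ _)))
∣p∪q∣≤∣p∣+∣q∣ (false ∷ p) (false ∷ q) = ∣p∪q∣≤∣p∣+∣q∣ p q

x∈p─q⁻ : (p q : Subset n) {x : Fin n} → x ∈ p ─ q → x ∈ p × x ∉ q
x∈p─q⁻ p q x∈ = p─q⊆p p q x∈ , λ x∈q → go p q x∈ x∈q
  where
  go : ∀ {m} (p q : Subset m) {x} → x ∈ p ─ q → ¬ (x ∈ q)
  go (_ ∷ p) (_ ∷ q) (there x∈) (there y∈) = go p q x∈ y∈

card-cover : {p q r : Subset n} → (∀ {x} → x ∈ p → x ∈ q ⊎ x ∈ r) → ∣ p ∣ ≤ ∣ q ∣ + ∣ r ∣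
card-cover {q = q} {r} p⊆ =
  ≤-trans (p⊆q⇒∣p∣≤∣q∣ (x∈p∪q⁺ ∘ p⊆)) (∣p∪q∣≤∣p∣+∣q∣ q r)

∣p∣≤∣p─q∣+∣q∣ : (p q : Subset n) → ∣ p ∣ ≤ ∣ p ─ q ∣ + ∣ q ∣
∣p∣≤∣p─q∣+∣q∣ p q = card-cover {q = p ─ q} {q} split
  where
  split : ∀ {x} → x ∈ p → x ∈ p ─ q ⊎ x ∈ q
  split {x} x∈p with x ∈? q
  ... | yes x∈q = inj₂ x∈q
  ... | no x∉q = inj₁ (x∈p∧x∉q⇒x∈p─q x∈p x∉q)

Disjoint : Subset n → Subset n → Set
Disjoint p q = ∀ {x} → x ∈ p → x ∉ q

∣p∣+∣q∣≤∣p∪q∣ : (p q : Subset n) → Disjoint p q → ∣ p ∣ + ∣ q ∣ ≤ ∣ p ∪ q ∣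
∣p∣+∣q∣≤∣p∪q∣ [] [] _ = z≤n
∣p∣+∣q∣≤∣p∪q∣ (b ∷ p) (c ∷ q) dis with ∣p∣+∣q∣≤∣p∪q∣ p q (λ x∈p x∈q → dis (there x∈p) (there x∈q))
∣p∣+∣q∣≤∣p∪q∣ (true ∷ p) (true ∷ q) dis | _ = ⊥-elim (dis here here)
∣p∣+∣q∣≤∣p∪q∣ (true ∷ p) (false ∷ q) dis | ih = s≤s ih
∣p∣+∣q∣≤∣p∪q∣ (false ∷ p) (true ∷ q) dis | ih = ≤-trans (≤-reflexive (+-suc _ _)) (s≤s ih)
∣p∣+∣q∣≤∣p∪q∣ (false ∷ p) (false ∷ q) dis | ih = ih

card-disjoint : {p q r : Subset n} → Disjoint p q → p ⊆ r → q ⊆ r → ∣ p ∣ + ∣ q ∣ ≤ ∣ r ∣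
card-disjoint {p = p} {q} {r} dis p⊆r q⊆r =
  ≤-trans (∣p∣+∣q∣≤∣p∪q∣ p q dis) (p⊆q⇒∣p∣≤∣q∣ ([ p⊆r , q⊆r ]′ ∘ x∈p∪q⁻ p q))

card-injection : (p : Subset a) (q : Subset n) (f : Fin a → Fin n) →
  (∀ {x} → x ∈ p → f x ∈ q) →
  (∀ {x y} → x ∈ p → y ∈ p → f x ≡ f y → x ≡ y) → ∣ p ∣ ≤ ∣ q ∣
card-injection [] q f maps inj = z≤n
card-injection (false ∷ p) q f maps inj =
  card-injection p q (f ∘ suc) (maps ∘ there) λ x∈ y∈ eq → suc-injective (inj (there x∈) (there y∈) eq)
card-injection (true ∷ p) q f maps inj = ≤-trans
  (s≤s (card-injection p (q - f zero) (f ∘ suc)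
    (λ x∈ → x∈p∧x≢y⇒x∈p-y (maps (there x∈)) λ eq → case0 (inj (there x∈) here eq))
    λ x∈ y∈ eq → suc-injective (inj (there x∈) (there y∈) eq)))
  (x∈p⇒∣p-x∣<∣p∣ (maps here))
  where
  case0 : ∀ {x : Fin a} → ¬ (suc x ≡ zero)
  case0 ()

∃∈∉ : (p q : Subset n) → ∣ q ∣ < ∣ p ∣ → ∃[ x ] x ∈ p × x ∉ q
∃∈∉ p q q<p with nonempty? (p ─ q)
... | yes (x , x∈) = x , x∈p─q⁻ p q x∈
... | no e = contradiction
  (p⊆q⇒∣p∣≤∣q∣ λ {x} x∈p → [ (λ x∈ → contradiction (x , x∈) e) , id ]′ (split x∈p)) (<⇒≱ q<p)
  where
  split : ∀ {x} → x ∈ p → x ∈ p ─ q ⊎ x ∈ q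
  split {x} x∈p with x ∈? q
  ... | yes x∈q = inj₂ x∈q
  ... | no x∉q = inj₁ (x∈p∧x∉q⇒x∈p─q x∈p x∉q)

subset-of-size : (p : Subset n) (r : ℕ) → r ≤ ∣ p ∣ → ∃[ q ] q ⊆ p × ∣ q ∣ ≡ r
subset-of-size {n} p zero _ = ∅ , (λ x∈ → contradiction x∈ ∉⊥) , ∣⊥∣≡0 n
subset-of-size (true ∷ p) (suc r) (s≤s r≤) with subset-of-size p r r≤
... | q , q⊆p , eq = true ∷ q , s⊆s q⊆p , cong suc eq
subset-of-size (false ∷ p) (suc r) r≤ with subset-of-size p (suc r) r≤
... | q , q⊆p , eq = false ∷ q , s⊆s q⊆p , eq

union : (Fin a → Subset n) → Subset n
union f = set λ x → any? λ i → x ∈? f i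

∈union⁺ : (f : Fin a → Subset n) {x : Fin n} (i : Fin a) → x ∈ f i → x ∈ union f
∈union⁺ f i x∈ = ∈set⁺ (λ x → any? λ i → x ∈? f i) (i , x∈)

∈union⁻ : (f : Fin a → Subset n) {x : Fin n} → x ∈ union f → ∃[ i ] x ∈ f i
∈union⁻ f = ∈set⁻ (λ x → any? λ i → x ∈? f i)

-- The weight `w` replaces a division: it will be `2 ^ c` for exceptional sets, bounded by a degree,
-- and the number of walks for path sets, bounded by `2 * n`.
union-bound : (f : Fin a → Subset n) (w b : ℕ) → (∀ i → w * ∣ f i ∣ ≤ b) → w * ∣ union f ∣ ≤ a * b
union-bound {zero} {n} f w b _ = ≤-trans (*-monoʳ-≤ w (p⊆q⇒∣p∣≤∣q∣ {q = ∅} λ x∈ → none (∈union⁻ f x∈)))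
  (≤-reflexive (trans (cong (w *_) (∣⊥∣≡0 n)) (*-zeroʳ w)))
  where
  none : ∀ {x} → (∃[ i ] x ∈ f i) → x ∈ ∅
  none (() , _)
union-bound {suc a} f w b bd = begin
  w * ∣ union f ∣  ≤⟨ *-monoʳ-≤ w (card-cover (cover ∘ ∈union⁻ f)) ⟩
  w * (∣ f zero ∣ + ∣ union (f ∘ suc) ∣)     ≡⟨ *-distribˡ-+ w ∣ f zero ∣ _ ⟩
  w * ∣ f zero ∣ + w * ∣ union (f ∘ suc) ∣  ≤⟨ +-mono-≤ (bd zero) (union-bound (f ∘ suc) w b (bd ∘ suc)) ⟩
  b + a * b  ∎
  where
  open ≤-Reasoning
  cover : ∀ {x} → (∃[ i ] x ∈ f i) → x ∈ f zero ⊎ x ∈ union (f ∘ suc)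
  cover (zero , x∈) = inj₁ x∈
  cover (suc i , x∈) = inj₂ (∈union⁺ (f ∘ suc) i x∈)

sum-mono : (f g : Fin a → ℕ) → (∀ i → f i ≤ g i) → sum f ≤ sum g
sum-mono {zero} f g le = z≤n
sum-mono {suc a} f g le = +-mono-≤ (le zero) (sum-mono (f ∘ suc) (g ∘ suc) (le ∘ suc))

sum-mono-< : (f g : Fin a → ℕ) → (∀ i → f i ≤ g i) → ∀ i → f i < g i → sum f < sum g
sum-mono-< f g le zero lt = +-mono-<-≤ lt (sum-mono (f ∘ suc) (g ∘ suc) (le ∘ suc))
sum-mono-< f g le (suc i) lt = +-mono-≤-< (le zero) (sum-mono-< (f ∘ suc) (g ∘ suc) (le ∘ suc) i lt)

sum-bound : (f : Fin a → ℕ) (b : ℕ) → (∀ i → f i ≤ b) → sum f ≤ a * b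
sum-bound {zero} f b le = z≤n
sum-bound {suc a} f b le = +-mono-≤ (le zero) (sum-bound (f ∘ suc) b (le ∘ suc))

double-counting : {R : Fin a → Fin n → Set} (R? : ∀ x y → Dec (R x y)) →
  sum (λ x → ∣ set (R? x) ∣) ≡ sum (λ y → ∣ set (λ x → R? x y) ∣)
double-counting R? = begin
  sum (λ x → ∣ set (R? x) ∣)  ≡⟨ sum-cong-≗ (λ x → card-sum (R? x)) ⟩
  sum (λ x → sum (λ y → 𝟙 (R? x y)))       ≡⟨ ∑-comm (λ x y → 𝟙 (R? x y)) ⟩
  sum (λ y → sum (λ x → 𝟙 (R? x y)))       ≡⟨ sum-cong-≗ (λ y → sym (card-sum (λ x → R? x y))) ⟩
  sum (λ y → ∣ set (λ x → R? x y) ∣)       ∎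
  where open ≡-Reasoning

markov : (f : Fin a → ℕ) (w : ℕ) → suc w * ∣ set (λ i → w <? f i) ∣ ≤ sum f
markov f w = ≤-trans (≤-reflexive (cong (suc w *_) (card-sum (λ i → w <? f i)))) (go f)
  where
  open ≤-Reasoning
  go : ∀ {a} (f : Fin a → ℕ) → suc w * sum (λ i → 𝟙 (w <? f i)) ≤ sum f
  go {zero} f = ≤-reflexive (*-zeroʳ w)
  go {suc a} f with w <? f zero
  ... | yes lt = begin
    suc w * suc s      ≡⟨ *-suc (suc w) s ⟩
    suc w + suc w * s  ≤⟨ +-mono-≤ lt (go (f ∘ suc)) ⟩
    sum f  ∎
    where s = sum (λ i → 𝟙 (w <? f (suc i)))
  ... | no _ = ≤-trans (go (f ∘ suc)) (m≤n+m _ (f zero))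

argmin : (f : Fin n → ℕ) (p : Subset n) → Nonempty p → ∃[ x ] x ∈ p × (∀ {y} → y ∈ p → f x ≤ f y)
argmin f p (x , x∈p) = go x x∈p (<-wellFounded (f x))
  where
  go : ∀ x → x ∈ p → Acc _<_ (f x) → ∃[ x ] x ∈ p × (∀ {y} → y ∈ p → f x ≤ f y)
  go x x∈p (acc rs) with any? (λ y → y ∈? p ×-dec f y <? f x)
  ... | yes (y , y∈p , lt) = go y y∈p (rs lt)
  ... | no none = x , x∈p , λ y∈p → ≮⇒≥ λ lt → none (_ , y∈p , lt)

abstract
  -- `sum f` serves as a common upper bound of the values, so that truncated subtraction from it
  -- reverses their order.
  argmax : (f : Fin n → ℕ) → Fin n → ∃[ x ] ∀ y → f y ≤ f x
  argmax f x with argmin (λ y → sum f ∸ f y) ⊤ (x , ∈⊤)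
  ... | x , _ , min = x , λ y → ∸-cancelʳ-≤′ (le x) (le y) (min {y} ∈⊤)
    where
    le : ∀ {n} {f : Fin n → ℕ} y → f y ≤ sum f
    le zero = m≤m+n _ _
    le (suc y) = ≤-trans (le y) (m≤n+m _ _)
    ∸-cancelʳ-≤′ : ∀ {s u v} → u ≤ s → v ≤ s → s ∸ u ≤ s ∸ v → v ≤ u
    ∸-cancelʳ-≤′ {s} {u} {v} u≤ v≤ h = ≮⇒≥ λ u<v → <⇒≱ (∸-monoʳ-< u<v v≤) h

-- The common form of all reservations: the clients `Q` get disjoint parts of their candidate sets
-- off a forbidden set `H`. Indices outside `Q` get the empty part, so `total` charges the clients
-- only.
record Choice (Q : Subset a) (C : Fin a → Subset n) (H : Subset n) (r : ℕ) : Set where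
  field
    part     : Fin a → Subset n
    size     : ∀ {i} → i ∈ Q → ∣ part i ∣ ≡ r
    ⊆C       : ∀ i → part i ⊆ C i
    avoids   : ∀ i → Disjoint (part i) H
    disjoint : ∀ {i j x} → x ∈ part i → x ∈ part j → i ≡ j
    support  : ∀ {i x} → x ∈ part i → i ∈ Q
    total    : ∣ union part ∣ ≤ r * ∣ Q ∣

open Choice

-- A greedy choice works because every single candidate set has room for the parts of all clients:
-- whatever the others took, `r` elements remain.
disjoint-choice : (Q : Subset a) (C : Fin a → Subset n) (H : Subset n) (r : ℕ) →
  (∀ {i} → i ∈ Q → r * ∣ Q ∣ ≤ ∣ C i ─ H ∣) → Choice Q C H r
disjoint-choice {n = n} [] C H r _ = record
  { part = none ; size = λ () ; ⊆C = λ () ; avoids = λ () ; disjoint = λ { {()} } ; support = λ { {()} }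
  ; total = ≤-trans (≤-reflexive (sym (*-identityˡ _))) (≤-trans (union-bound none 1 0 λ ()) z≤n) }
  where
  none : Fin 0 → Subset n
  none ()
disjoint-choice {suc a} {n} (false ∷ Q) C H r enough = record
  { part = part′
  ; size = λ { (there i∈) → size ch i∈ }
  ; ⊆C = λ { zero x∈ → contradiction x∈ ∉⊥ ; (suc i) → ⊆C ch i }
  ; avoids = λ { zero x∈ → contradiction x∈ ∉⊥ ; (suc i) → avoids ch i }
  ; disjoint = disjoint′
  ; support = λ { {zero} x∈ → contradiction x∈ ∉⊥ ; {suc i} x∈ → there (support ch x∈) }
  ; total = ≤-trans (p⊆q⇒∣p∣≤∣q∣ (λ x∈ → un (∈union⁻ part′ x∈))) (total ch)
  }
  where
  ch = disjoint-choice Q (C ∘ suc) H r (enough ∘ there)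
  part′ : Fin (suc a) → Subset n
  part′ zero = ∅
  part′ (suc i) = part ch i
  disjoint′ : ∀ {i j x} → x ∈ part′ i → x ∈ part′ j → i ≡ j
  disjoint′ {zero} x∈ _ = contradiction x∈ ∉⊥
  disjoint′ {suc _} {zero} _ x∈ = contradiction x∈ ∉⊥
  disjoint′ {suc _} {suc _} x∈i x∈j = cong suc (disjoint ch x∈i x∈j)
  un : ∀ {x} → (∃[ i ] x ∈ part′ i) → x ∈ union (part ch)
  un (zero , x∈) = contradiction x∈ ∉⊥
  un (suc i , x∈) = ∈union⁺ (part ch) i x∈
disjoint-choice {suc a} {n} (true ∷ Q) C H r enough = record
  { part = part′
  ; size = λ { here → proj₂ (proj₂ new) ; (there i∈) → size ch i∈ }
  ; ⊆C = λ { zero x∈ → proj₁ (new⊆ x∈) ; (suc i) → ⊆C ch i }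
  ; avoids = λ { zero x∈ → proj₁ (proj₂ (new⊆ x∈)) ; (suc i) → avoids ch i }
  ; disjoint = disjoint′
  ; support = λ { {zero} x∈ → here ; {suc i} x∈ → there (support ch x∈) }
  ; total = total′
  }
  where
  open ≤-Reasoning
  ch = disjoint-choice Q (C ∘ suc) H r λ i∈ → ≤-trans (*-monoʳ-≤ r (n≤1+n _)) (enough (there i∈))
  old = union (part ch)
  room : r ≤ ∣ (C zero ─ H) ─ old ∣
  room = +-cancelʳ-≤ ∣ old ∣ _ _ (begin
    r + ∣ old ∣  ≤⟨ +-monoʳ-≤ r (total ch) ⟩
    r + r * ∣ Q ∣  ≡⟨ sym (*-suc r ∣ Q ∣) ⟩
    r * suc ∣ Q ∣  ≤⟨ enough here ⟩
    ∣ C zero ─ H ∣  ≤⟨ ∣p∣≤∣p─q∣+∣q∣ (C zero ─ H) old ⟩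
    ∣ (C zero ─ H) ─ old ∣ + ∣ old ∣      ∎)
  new = subset-of-size ((C zero ─ H) ─ old) r room
  new⊆ : ∀ {x} → x ∈ proj₁ new → x ∈ C zero × x ∉ H × x ∉ old
  new⊆ x∈ with x∈p─q⁻ _ old (proj₁ (proj₂ new) x∈)
  ... | x∈′ , x∉ with x∈p─q⁻ (C zero) H x∈′
  ... | x∈C , x∉H = x∈C , x∉H , x∉
  part′ : Fin (suc a) → Subset n
  part′ zero = proj₁ new
  part′ (suc i) = part ch i
  disjoint′ : ∀ {i j x} → x ∈ part′ i → x ∈ part′ j → i ≡ j
  disjoint′ {zero} {zero} _ _ = refl
  disjoint′ {zero} {suc j} x∈ x∈j = contradiction (∈union⁺ (part ch) j x∈j) (proj₂ (proj₂ (new⊆ x∈)))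
  disjoint′ {suc i} {zero} x∈i x∈ = contradiction (∈union⁺ (part ch) i x∈i) (proj₂ (proj₂ (new⊆ x∈)))
  disjoint′ {suc _} {suc _} x∈i x∈j = cong suc (disjoint ch x∈i x∈j)
  un : ∀ {x} → (∃[ i ] x ∈ part′ i) → x ∈ proj₁ new ⊎ x ∈ old
  un (zero , x∈) = inj₁ x∈
  un (suc i , x∈) = inj₂ (∈union⁺ (part ch) i x∈)
  total′ : ∣ union part′ ∣ ≤ r * suc ∣ Q ∣
  total′ = begin
    ∣ union part′ ∣             ≤⟨ card-cover (λ x∈ → un (∈union⁻ part′ x∈)) ⟩
    ∣ proj₁ new ∣ + ∣ old ∣     ≤⟨ +-mono-≤ (≤-reflexive (proj₂ (proj₂ new))) (total ch) ⟩
    r + r * ∣ Q ∣  ≡⟨ sym (*-suc r ∣ Q ∣) ⟩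
    r * suc ∣ Q ∣  ∎

-- Walks and Menger's theorem

module Walks {n : ℕ} (E : Rel (Fin n) 0ℓ) where

  infix 4 _∈ʷ_ _∈ⁱ_ _∈ᵗ_ _∈ʷ?_

  -- Positions on a walk: any, any but the last, any but the first.

  data _∈ʷ_ (x : Fin n) : ∀ {s e} → Star E s e → Set where
    here  : ∀ {e} {p : Star E x e} → x ∈ʷ p
    there : ∀ {s z e} {a : E s z} {p : Star E z e} → x ∈ʷ p → x ∈ʷ a ◅ p

  data _∈ⁱ_ (x : Fin n) : ∀ {s e} → Star E s e → Set where
    here  : ∀ {z e} {a : E x z} {p : Star E z e} → x ∈ⁱ a ◅ p
    there : ∀ {s z e} {a : E s z} {p : Star E z e} → x ∈ⁱ p → x ∈ⁱ a ◅ p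

  data _∈ᵗ_ (x : Fin n) : ∀ {s e} → Star E s e → Set where
    there : ∀ {s z e} {a : E s z} {p : Star E z e} → x ∈ʷ p → x ∈ᵗ a ◅ p

  private variable
    x y z s e : Fin n

  _∈ʷ?_ : ∀ x (p : Star E s e) → Dec (x ∈ʷ p)
  _∈ʷ?_ {s} x p with x ≟ s
  x ∈ʷ? p | yes refl = yes here
  x ∈ʷ? ε | no x≢s = no λ { here → x≢s refl }
  x ∈ʷ? (a ◅ p) | no x≢s with x ∈ʷ? p
  ... | yes x∈ = yes (there x∈)
  ... | no x∉ = no λ { here → x≢s refl ; (there x∈) → x∉ x∈ }

  vset : Star E s e → Subset n
  vset p = set (_∈ʷ? p)

  end∈ : (p : Star E s e) → e ∈ʷ p
  end∈ ε = here
  end∈ (a ◅ p) = there (end∈ p)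

  ⁱ⇒ʷ : {p : Star E s e} → x ∈ⁱ p → x ∈ʷ p
  ⁱ⇒ʷ here = here
  ⁱ⇒ʷ (there x∈) = there (ⁱ⇒ʷ x∈)

  ᵗ⇒ʷ : {p : Star E s e} → x ∈ᵗ p → x ∈ʷ p
  ᵗ⇒ʷ (there x∈) = there x∈

  ʷ⇒ⁱ : {p : Star E s e} → x ∈ʷ p → x ∈ⁱ p ⊎ x ≡ e
  ʷ⇒ⁱ {p = ε} here = inj₂ refl
  ʷ⇒ⁱ {p = a ◅ p} here = inj₁ here
  ʷ⇒ⁱ {p = a ◅ p} (there x∈) = [ inj₁ ∘ there , inj₂ ]′ (ʷ⇒ⁱ x∈)

  ʷ⇒ᵗ : {p : Star E s e} → x ∈ʷ p → x ≢ s → x ∈ᵗ p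
  ʷ⇒ᵗ here x≢s = contradiction refl x≢s
  ʷ⇒ᵗ (there x∈) _ = there x∈

  ◅◅⁻ⁱ : (p : Star E s y) {q : Star E y e} → x ∈ⁱ p ◅◅ q → x ∈ⁱ p ⊎ x ∈ⁱ q
  ◅◅⁻ⁱ ε x∈ = inj₂ x∈
  ◅◅⁻ⁱ (a ◅ p) here = inj₁ here
  ◅◅⁻ⁱ (a ◅ p) (there x∈) = [ inj₁ ∘ there , inj₂ ]′ (◅◅⁻ⁱ p x∈)

  ◅◅⁻ʷ : (p : Star E s y) {q : Star E y e} → x ∈ʷ p ◅◅ q → x ∈ⁱ p ⊎ x ∈ʷ q
  ◅◅⁻ʷ ε x∈ = inj₂ x∈
  ◅◅⁻ʷ (a ◅ p) here = inj₁ here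
  ◅◅⁻ʷ (a ◅ p) (there x∈) = [ inj₁ ∘ there , inj₂ ]′ (◅◅⁻ʷ p x∈)

  Simple : Star E s e → Set
  Simple ε = ⊤ₜ
  Simple {s} (a ◅ p) = ¬ (s ∈ʷ p) × Simple p

  record Split (p : Star E s e) (x : Fin n) : Set where
    field
      pre   : Star E s x
      suf   : Star E x e
      pre⊆  : ∀ {y} → y ∈ⁱ pre → y ∈ⁱ p
      suf⊆  : ∀ {y} → y ∈ʷ suf → y ∈ʷ p
      suf⊆ⁱ : ∀ {y} → y ∈ⁱ suf → y ∈ⁱ p
      once  : Simple p → ∀ {y} → y ∈ⁱ pre → ¬ (y ∈ʷ suf)
      keep  : Simple p → Simple suf

  open Split

  split : {p : Star E s e} → x ∈ʷ p → Split p x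
  split {p = p} here = record
    { pre = ε ; suf = p ; pre⊆ = λ () ; suf⊆ = id ; suf⊆ⁱ = id ; once = λ _ () ; keep = id }
  split {p = a ◅ p} (there x∈) = record
    { pre = a ◅ pre sp ; suf = suf sp
    ; pre⊆ = λ { here → here ; (there y∈) → there (pre⊆ sp y∈) }
    ; suf⊆ = there ∘ suf⊆ sp ; suf⊆ⁱ = there ∘ suf⊆ⁱ sp
    ; once = λ { (s∉ , simple) here y∈ → s∉ (suf⊆ sp y∈) ; (_ , simple) (there y∈) → once sp simple y∈ }
    ; keep = λ { (_ , simple) → keep sp simple } }
    where sp = split x∈

  -- Starting strictly after the first vertex keeps the suffix of a simple walk apart from another
  -- walk that leaves from that first vertex.
  suffix-from-tail : {p : Star E s e} → x ∈ᵗ p →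
    Σ[ q ∈ Star E x e ] (∀ {y} → y ∈ʷ q → y ∈ᵗ p) × (∀ {y} → y ∈ⁱ q → y ∈ⁱ p)
  suffix-from-tail (there x∈) = suf sp , there ∘ suf⊆ sp , there ∘ suf⊆ⁱ sp
    where sp = split x∈

  record Simplified (p : Star E s e) : Set where
    field
      walk   : Star E s e
      simple : Simple walk
      sub    : ∀ {x} → x ∈ʷ walk → x ∈ʷ p
      subⁱ   : ∀ {x} → x ∈ⁱ walk → x ∈ⁱ p

  open Simplified

  simplify : (p : Star E s e) → Simplified p
  simplify ε = record { walk = ε ; simple = tt ; sub = id ; subⁱ = id }
  simplify {s} (a ◅ p) with simplify p
  ... | record { walk = q ; simple = sq ; sub = q⊆ ; subⁱ = q⊆ⁱ } with s ∈ʷ? q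
  ... | yes s∈ = record
    { walk = suf sp ; simple = keep sp sq ; sub = there ∘ q⊆ ∘ suf⊆ sp ; subⁱ = there ∘ q⊆ⁱ ∘ suf⊆ⁱ sp }
    where sp = split s∈
  ... | no s∉ = record
    { walk = a ◅ q ; simple = s∉ , sq
    ; sub = λ { here → here ; (there x∈) → there (q⊆ x∈) }
    ; subⁱ = λ { here → here ; (there x∈) → there (q⊆ⁱ x∈) } }

  module _ {Q : Fin n → Set} (Q? : ∀ x → Dec (Q x)) where

    first-hit : (p : Star E s e) → Q e →
      ∃[ y ] Σ[ q ∈ Star E s y ] Q y × (∀ {x} → x ∈ⁱ q → ¬ Q x) × (∀ {x} → x ∈ʷ q → x ∈ʷ p)
    first-hit {s} p Qe with Q? s
    first-hit {s} p Qe | yes Qs = s , ε , Qs , (λ ()) , λ { here → here }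
    first-hit ε Qe | no ¬Qs = contradiction Qe ¬Qs
    first-hit (a ◅ p) Qe | no ¬Qs with first-hit p Qe
    ... | y , q , Qy , nf , sub = y , a ◅ q , Qy ,
      (λ { here → ¬Qs ; (there x∈) → nf x∈ }) , λ { here → here ; (there x∈) → there (sub x∈) }

    last-hit : (p : Star E s e) →
      (∀ {x} → x ∈ʷ p → ¬ Q x) ⊎
      (∃[ y ] Σ[ q ∈ Star E y e ] Q y × (∀ {x} → x ∈ᵗ q → ¬ Q x) ×
        (∀ {x} → x ∈ʷ q → x ∈ʷ p) × (∀ {x} → x ∈ⁱ q → x ∈ⁱ p))
    last-hit {s} ε with Q? s
    ... | yes Qs = inj₂ (s , ε , Qs , (λ ()) , id , id)
    ... | no ¬Qs = inj₁ λ { here → ¬Qs }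
    last-hit {s} (a ◅ p) with last-hit p
    ... | inj₂ (y , q , Qy , tl , sub , subⁱ) = inj₂ (y , q , Qy , tl , there ∘ sub , there ∘ subⁱ)
    ... | inj₁ none with Q? s
    ... | yes Qs = inj₂ (s , a ◅ p , Qs , (λ { (there x∈) → none x∈ }) , id , id)
    ... | no ¬Qs = inj₁ λ { here → ¬Qs ; (there x∈) → none x∈ }

  record Path : Set where
    constructor path
    field
      {src tgt} : Fin n
      trail     : Star E src tgt

  open Path

  -- Walks meet `B` at their ends only, because the induction prolongs them by pieces that lie
  -- inside an enlarged `B`.
  record Linkage (A B : Subset n) (r : ℕ) : Set where
    field
      P   : Fin r → Path
      s∈A : ∀ i → src (P i) ∈ A
      e∈B : ∀ i → tgt (P i) ∈ B
      ⁱ∉B : ∀ i {x} → x ∈ⁱ trail (P i) → x ∉ B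
      dis : ∀ {i j x} → x ∈ʷ trail (P i) → x ∈ʷ trail (P j) → i ≡ j

  open Linkage

  LinkedOutside : Subset n → Subset n → Subset n → Set
  LinkedOutside A B S =
    ∃[ s ] ∃[ e ] s ∈ A × e ∈ B × Σ[ p ∈ Star E s e ] (∀ {x} → x ∈ʷ p → x ∉ S)

  -- The induction of Böhme, Göring and Harant: a linkage grows by one path while
  -- all its end vertices are kept, and B is enlarged by the tails xP and xR of a
  -- path P and of a new walk R, where x is the last vertex of R on the linkage.

  module Augment (A : Subset n) {r : ℕ} where

    Augmented : ∀ {B} → Linkage A B r → Set
    Augmented {B} 𝒫 = Σ[ 𝒬 ∈ Linkage A B (suc r) ] (∀ i → tgt (P 𝒬 (suc i)) ≡ tgt (P 𝒫 i))

    -- The gluing step. `𝒬` ends in the enlarged set `B′`; its walk `ix` is prolonged by `α` to the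
    -- old end of `i₀`, its walk `iy` by `β` to the additional end, and the others already end
    -- correctly. Disjointness is inherited since `α` and `β` stay inside `B′`, which `𝒬` meets at
    -- its ends only.
    module Extend {B : Subset n} (𝒫 : Linkage A B r) (i₀ : Fin r) {B′ : Subset n} (B⊆B′ : B ⊆ B′)
      (𝒬 : Linkage A B′ (suc r))
      (ends : ∀ i → i ≢ i₀ → tgt (P 𝒬 (suc i)) ≡ tgt (P 𝒫 i))
      (ix iy : Fin (suc r)) (ix≢iy : ix ≢ iy)
      (≢ix : ∀ i → i ≢ i₀ → suc i ≢ ix) (≢iy : ∀ i → i ≢ i₀ → suc i ≢ iy)
      (α : Star E (tgt (P 𝒬 ix)) (tgt (P 𝒫 i₀))) {e : Fin n} (β : Star E (tgt (P 𝒬 iy)) e) (e∈ : e ∈ B)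
      (α⊆ : ∀ {x} → x ∈ʷ α → x ∈ B′) (β⊆ : ∀ {x} → x ∈ʷ β → x ∈ B′)
      (αⁱ : ∀ {x} → x ∈ⁱ α → x ∉ B) (βⁱ : ∀ {x} → x ∈ⁱ β → x ∉ B)
      (α#β : ∀ {x} → x ∈ʷ α → ¬ (x ∈ʷ β))
      (α# : ∀ i → i ≢ i₀ → ¬ (tgt (P 𝒫 i) ∈ʷ α)) (β# : ∀ i → i ≢ i₀ → ¬ (tgt (P 𝒫 i) ∈ʷ β))
      where

      X = trail (P 𝒬 ix)
      Y = trail (P 𝒬 iy)

      new : Fin (suc r) → Path
      new zero = path (Y ◅◅ β)
      new (suc i) with i ≟ i₀
      ... | yes _ = path (X ◅◅ α)
      ... | no _ = P 𝒬 (suc i)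

      -- A common vertex on the added piece `γ` lies in `B′`, hence is the end of its walk in `𝒬`;
      -- that end is an old end of `𝒫`, and `γ` avoids it.
      #ext : ∀ {i j e} {γ : Star E (tgt (P 𝒬 j)) e} → i ≢ i₀ → suc i ≢ j →
        (∀ {x} → x ∈ʷ γ → x ∈ B′) → ¬ (tgt (P 𝒫 i) ∈ʷ γ) →
        ∀ {x} → x ∈ʷ trail (P 𝒬 (suc i)) → ¬ (x ∈ʷ trail (P 𝒬 j) ◅◅ γ)
      #ext {i} {j} i≢ si≢j γ⊆ γ# x∈ x∈ext with ◅◅⁻ʷ (trail (P 𝒬 j)) x∈ext
      ... | inj₁ x∈j = si≢j (dis 𝒬 x∈ (ⁱ⇒ʷ x∈j))
      ... | inj₂ x∈γ with ʷ⇒ⁱ x∈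
      ... | inj₁ x∈ⁱ = ⁱ∉B 𝒬 (suc i) x∈ⁱ (γ⊆ x∈γ)
      ... | inj₂ refl = γ# (subst (_∈ʷ _) (ends i i≢) x∈γ)

      X#Y : ∀ {x} → x ∈ʷ X ◅◅ α → ¬ (x ∈ʷ Y ◅◅ β)
      X#Y x∈ x∈′ with ◅◅⁻ʷ X x∈ | ◅◅⁻ʷ Y x∈′
      ... | inj₁ x∈X | inj₁ x∈Y = ix≢iy (dis 𝒬 (ⁱ⇒ʷ x∈X) (ⁱ⇒ʷ x∈Y))
      ... | inj₁ x∈X | inj₂ x∈β = ⁱ∉B 𝒬 ix x∈X (β⊆ x∈β)
      ... | inj₂ x∈α | inj₁ x∈Y = ⁱ∉B 𝒬 iy x∈Y (α⊆ x∈α)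
      ... | inj₂ x∈α | inj₂ x∈β = α#β x∈α x∈β

      new-s : ∀ i → src (new i) ∈ A
      new-s zero = s∈A 𝒬 iy
      new-s (suc i) with i ≟ i₀
      ... | yes _ = s∈A 𝒬 ix
      ... | no _ = s∈A 𝒬 (suc i)

      new-end : ∀ i → tgt (new (suc i)) ≡ tgt (P 𝒫 i)
      new-end i with i ≟ i₀
      ... | yes refl = refl
      ... | no i≢ = ends i i≢

      new-e : ∀ i → tgt (new i) ∈ B
      new-e zero = e∈
      new-e (suc i) = subst (_∈ B) (sym (new-end i)) (e∈B 𝒫 i)

      new-ⁱ : ∀ i {x} → x ∈ⁱ trail (new i) → x ∉ B
      new-ⁱ zero x∈ = [ (λ x∈Y → ⁱ∉B 𝒬 iy x∈Y ∘ B⊆B′) , βⁱ ]′ (◅◅⁻ⁱ Y x∈)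
      new-ⁱ (suc i) x∈ with i ≟ i₀
      ... | yes _ = [ (λ x∈X → ⁱ∉B 𝒬 ix x∈X ∘ B⊆B′) , αⁱ ]′ (◅◅⁻ⁱ X x∈)
      ... | no _ = ⁱ∉B 𝒬 (suc i) x∈ ∘ B⊆B′

      new-dis : ∀ i j {x} → x ∈ʷ trail (new i) → x ∈ʷ trail (new j) → i ≡ j
      new-dis zero zero _ _ = refl
      new-dis zero (suc j) x∈ x∈′ with j ≟ i₀
      ... | yes _ = contradiction x∈ (X#Y x∈′)
      ... | no j≢ = contradiction x∈ (#ext j≢ (≢iy j j≢) β⊆ (β# j j≢) x∈′)
      new-dis (suc i) zero x∈ x∈′ with i ≟ i₀
      ... | yes _ = contradiction x∈′ (X#Y x∈)
      ... | no i≢ = contradiction x∈′ (#ext i≢ (≢iy i i≢) β⊆ (β# i i≢) x∈)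
      new-dis (suc i) (suc j) x∈ x∈′ with i ≟ i₀ | j ≟ i₀
      ... | yes refl | yes refl = refl
      ... | yes _ | no j≢ = contradiction x∈ (#ext j≢ (≢ix j j≢) α⊆ (α# j j≢) x∈′)
      ... | no i≢ | yes _ = contradiction x∈′ (#ext i≢ (≢ix i i≢) α⊆ (α# i i≢) x∈)
      ... | no _ | no _ = dis 𝒬 x∈ x∈′

      extended : Augmented 𝒫
      extended = record
        { P = new ; s∈A = new-s ; e∈B = new-e ; ⁱ∉B = new-ⁱ ; dis = λ {i} {j} → new-dis i j } , new-end

module Menger {n : ℕ} (E : Rel (Fin n) 0ℓ) (A : Subset n) where
  open Walks E
  open Path
  open Linkage
  open Split
  open Simplified
  open Augment A

  module Detour {r} {B : Subset n} (𝒫 : Linkage A B r) (simple : ∀ i → Simple (trail (P 𝒫 i)))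
    {x e : Fin n} (i₀ : Fin r) (x∈P₀ : x ∈ʷ trail (P 𝒫 i₀)) (e∈ : e ∈ B) (xR : Star E x e)
    (xRⁱ : ∀ {y} → y ∈ⁱ xR → y ∉ B) (xRᵗ : ∀ {y} → y ∈ᵗ xR → ∀ i → ¬ (y ∈ʷ trail (P 𝒫 i)))
    (S∌ : ∀ i → ¬ (tgt (P 𝒫 i) ∈ʷ xR)) where

    sp = split x∈P₀
    xP = suf sp

    B′? : ∀ y → Dec (y ∈ B ⊎ y ∈ʷ xP ⊎ y ∈ʷ xR)
    B′? y = y ∈? B ⊎-dec (y ∈ʷ? xP ⊎-dec y ∈ʷ? xR)

    B′ : Subset n
    B′ = set B′?

    B⊆B′ : B ⊆ B′
    B⊆B′ y∈ = ∈set⁺ B′? (inj₁ y∈)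

    xP⊆B′ : ∀ {y} → y ∈ʷ xP → y ∈ B′
    xP⊆B′ y∈ = ∈set⁺ B′? (inj₂ (inj₁ y∈))

    xR⊆B′ : ∀ {y} → y ∈ʷ xR → y ∈ B′
    xR⊆B′ y∈ = ∈set⁺ B′? (inj₂ (inj₂ y∈))

    x≢end : ∀ i → x ≢ tgt (P 𝒫 i)
    x≢end i refl = S∌ i here

    x∉B : x ∉ B
    x∉B = [ ⁱ∉B 𝒫 i₀ , (λ eq → contradiction eq (x≢end i₀)) ]′ (ʷ⇒ⁱ x∈P₀)

    -- The measure of the induction. The vertex `x` is new in `B′`: it is no end of `𝒫`, as `xR`
    -- avoids these, and the other vertices of a walk lie off `B`.
    B⊂B′ : ∣ ∁ B′ ∣ < ∣ ∁ B ∣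
    B⊂B′ = p⊂q⇒∣p∣<∣q∣ (p⊂q⇒∁p⊃∁q (B⊆B′ , x , xP⊆B′ here , x∉B))

    xR∩𝒫 : ∀ {y} i → y ∈ʷ xR → y ∈ʷ trail (P 𝒫 i) → y ≡ x
    xR∩𝒫 {y} i y∈R y∈P with y ≟ x
    ... | yes y≡x = y≡x
    ... | no y≢x = contradiction y∈P (xRᵗ (ʷ⇒ᵗ y∈R y≢x) i)

    xP#end : ∀ i → i ≢ i₀ → ¬ (tgt (P 𝒫 i) ∈ʷ xP)
    xP#end i i≢ t∈ = i≢ (dis 𝒫 (end∈ (trail (P 𝒫 i))) (suf⊆ sp t∈))

    P′ : Fin r → Path
    P′ i with i ≟ i₀
    ... | yes _ = path (pre sp)
    ... | no _ = P 𝒫 i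

    𝒫′ : Linkage A B′ r
    𝒫′ = record { P = P′ ; s∈A = s∈A′ ; e∈B = e∈B′ ; ⁱ∉B = ⁱ∉B′ ; dis = λ {i} {j} → dis′ i j }
      where
      s∈A′ : ∀ i → src (P′ i) ∈ A
      s∈A′ i with i ≟ i₀
      ... | yes refl = s∈A 𝒫 i
      ... | no _ = s∈A 𝒫 i
      e∈B′ : ∀ i → tgt (P′ i) ∈ B′
      e∈B′ i with i ≟ i₀
      ... | yes _ = xP⊆B′ here
      ... | no _ = B⊆B′ (e∈B 𝒫 i)
      ⁱ∉B′ : ∀ i {y} → y ∈ⁱ trail (P′ i) → y ∉ B′
      ⁱ∉B′ i y∈ y∈B′ with i ≟ i₀ | ∈set⁻ B′? y∈B′
      ... | yes _ | inj₁ y∈B = ⁱ∉B 𝒫 i₀ (pre⊆ sp y∈) y∈B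
      ... | yes _ | inj₂ (inj₁ y∈xP) = once sp (simple i₀) y∈ y∈xP
      ... | yes _ | inj₂ (inj₂ y∈xR) with refl ← xR∩𝒫 i₀ y∈xR (ⁱ⇒ʷ (pre⊆ sp y∈)) =
        once sp (simple i₀) y∈ here
      ... | no _ | inj₁ y∈B = ⁱ∉B 𝒫 i y∈ y∈B
      ... | no i≢ | inj₂ (inj₁ y∈xP) = i≢ (dis 𝒫 (ⁱ⇒ʷ y∈) (suf⊆ sp y∈xP))
      ... | no i≢ | inj₂ (inj₂ y∈xR) with refl ← xR∩𝒫 i y∈xR (ⁱ⇒ʷ y∈) = i≢ (dis 𝒫 (ⁱ⇒ʷ y∈) x∈P₀)
      sub′ : ∀ i {y} → y ∈ʷ trail (P′ i) → y ∈ʷ trail (P 𝒫 i)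
      sub′ i y∈ with i ≟ i₀
      ... | no _ = y∈
      ... | yes refl with ʷ⇒ⁱ y∈
      ... | inj₁ y∈ⁱ = ⁱ⇒ʷ (pre⊆ sp y∈ⁱ)
      ... | inj₂ refl = x∈P₀
      dis′ : ∀ i j {y} → y ∈ʷ trail (P′ i) → y ∈ʷ trail (P′ j) → i ≡ j
      dis′ i j y∈ y∈′ = dis 𝒫 (sub′ i y∈) (sub′ j y∈′)

    end₀ : tgt (P′ i₀) ≡ x
    end₀ with i₀ ≟ i₀
    ... | yes _ = refl
    ... | no i≢ = contradiction refl i≢

    end′ : ∀ i → i ≢ i₀ → tgt (P′ i) ≡ tgt (P 𝒫 i)
    end′ i i≢ with i ≟ i₀
    ... | yes i≡ = contradiction i≡ i≢
    ... | no _ = refl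

    xP-tail∌x : ∀ {z} {q : Star E x z} → Simple q → ¬ (x ∈ᵗ q)
    xP-tail∌x (x∉ , _) (there x∈) = x∉ x∈

    moved : ∀ {y z w} → y ≡ z → (p : Star E z w) →
      Σ[ q ∈ Star E y w ] (∀ {u} → u ∈ʷ q → u ∈ʷ p) × (∀ {u} → u ∈ⁱ q → u ∈ⁱ p)
    moved refl p = p , id , id

    xPⁱ : ∀ {y} → y ∈ⁱ xP → y ∉ B
    xPⁱ y∈ = ⁱ∉B 𝒫 i₀ (suf⊆ⁱ sp y∈)

    -- `𝒬` ends at `x`, at the other old ends and at one more vertex `y` of `B′`. If `y` is on `xP`,
    -- the extra walk runs on along `xP` and the walk ending at `x` continues along `xR`; if `y` is
    -- on `xR`, these roles are exchanged; otherwise `y` lies in `B` and is the additional end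
    -- itself.
    reroute : Augmented 𝒫′ → Augmented 𝒫
    reroute (𝒬 , 𝒬-end) = cases (y ∈ʷ? xP) (y ∈ʷ? xR)
      where
      y = tgt (P 𝒬 zero)

      ends : ∀ i → i ≢ i₀ → tgt (P 𝒬 (suc i)) ≡ tgt (P 𝒫 i)
      ends i i≢ = trans (𝒬-end i) (end′ i i≢)

      end-x : tgt (P 𝒬 (suc i₀)) ≡ x
      end-x = trans (𝒬-end i₀) end₀

      tgt-inj : ∀ {i j} → tgt (P 𝒬 i) ≡ tgt (P 𝒬 j) → i ≡ j
      tgt-inj {i} {j} eq =
        dis 𝒬 (end∈ (trail (P 𝒬 i))) (subst (_∈ʷ trail (P 𝒬 j)) (sym eq) (end∈ (trail (P 𝒬 j))))

      y≢x : y ≢ x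
      y≢x eq = case tgt-inj (trans eq (sym end-x)) of λ ()

      y≢end : ∀ i → i ≢ i₀ → tgt (P 𝒫 i) ≢ y
      y≢end i i≢ eq = case tgt-inj (trans (ends i i≢) eq) of λ ()

      suc≢suc : ∀ i → i ≢ i₀ → suc i ≢ suc i₀
      suc≢suc i i≢ refl = i≢ refl

      cases : Dec (y ∈ʷ xP) → Dec (y ∈ʷ xR) → Augmented 𝒫
      cases (yes y∈) _ with moved end-x xR | suffix-from-tail (ʷ⇒ᵗ y∈ y≢x)
      ... | β , β⊆ , β⊆ⁱ | α , α⊆ , α⊆ⁱ = Extend.extended 𝒫 i₀ B⊆B′ 𝒬 ends zero (suc i₀) (λ ())
        (λ _ _ ()) suc≢suc α β e∈
        (xP⊆B′ ∘ ᵗ⇒ʷ ∘ α⊆) (xR⊆B′ ∘ β⊆) (xPⁱ ∘ α⊆ⁱ) (xRⁱ ∘ β⊆ⁱ)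
        (λ u∈α u∈β → case xR∩𝒫 i₀ (β⊆ u∈β) (suf⊆ sp (ᵗ⇒ʷ (α⊆ u∈α))) of
          λ { refl → xP-tail∌x (keep sp (simple i₀)) (α⊆ u∈α) })
        (λ i i≢ → xP#end i i≢ ∘ ᵗ⇒ʷ ∘ α⊆) (λ i i≢ → S∌ i ∘ β⊆)
      cases (no _) (yes y∈) with moved end-x xP | suffix-from-tail (ʷ⇒ᵗ y∈ y≢x)
      ... | α , α⊆ , α⊆ⁱ | β , β⊆ , β⊆ⁱ = Extend.extended 𝒫 i₀ B⊆B′ 𝒬 ends (suc i₀) zero (λ ())
        suc≢suc (λ _ _ ()) α β e∈
        (xP⊆B′ ∘ α⊆) (xR⊆B′ ∘ ᵗ⇒ʷ ∘ β⊆) (xPⁱ ∘ α⊆ⁱ) (xRⁱ ∘ β⊆ⁱ)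
        (λ u∈α u∈β → xRᵗ (β⊆ u∈β) i₀ (suf⊆ sp (α⊆ u∈α)))
        (λ i i≢ → xP#end i i≢ ∘ α⊆) (λ i i≢ → S∌ i ∘ ᵗ⇒ʷ ∘ β⊆)
      cases (no y∉P) (no y∉R) with moved end-x xP
      ... | α , α⊆ , α⊆ⁱ = Extend.extended 𝒫 i₀ B⊆B′ 𝒬 ends (suc i₀) zero (λ ())
        suc≢suc (λ _ _ ()) α ε y∈B
        (xP⊆B′ ∘ α⊆) (λ { here → e∈B 𝒬 zero }) (xPⁱ ∘ α⊆ⁱ) (λ ())
        (λ { u∈α here → y∉P (α⊆ u∈α) })
        (λ i i≢ → xP#end i i≢ ∘ α⊆) (λ i i≢ → at-y (y≢end i i≢))
        where
        y∈B : y ∈ B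
        y∈B = [ id , (λ { (inj₁ y∈) → contradiction y∈ y∉P ; (inj₂ y∈) → contradiction y∈ y∉R }) ]′
                (∈set⁻ B′? (e∈B 𝒬 zero))
        at-y : ∀ {u} → u ≢ y → ¬ (u ∈ʷ ε {x = y})
        at-y u≢ here = u≢ refl

  -- The deleted set `S` consists of the ends of `𝒫` alone. A walk that avoids it either misses the
  -- linkage and is added, or leaves it for the last time at a vertex that is no end. The walks are
  -- made simple beforehand so that cutting one at `x` gives disjoint halves.
  augment : ∀ {r} {B : Subset n} → Acc _<_ ∣ ∁ B ∣ → (𝒫 : Linkage A B r) →
    (∀ S → ∣ S ∣ ≤ r → LinkedOutside A B S) → Augmented 𝒫
  augment {r} {B} (acc rs) 𝒫 linked = extend-along (linked S ∣S∣≤r)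
    where
    simplified : ∀ i → Simplified (trail (P 𝒫 i))
    simplified i = simplify (trail (P 𝒫 i))

    𝒫ₛ : Linkage A B r
    𝒫ₛ = record
      { P = λ i → path (walk (simplified i)) ; s∈A = s∈A 𝒫 ; e∈B = e∈B 𝒫
      ; ⁱ∉B = λ i → ⁱ∉B 𝒫 i ∘ subⁱ (simplified i)
      ; dis = λ {i} {j} x∈ x∈′ → dis 𝒫 (sub (simplified i) x∈) (sub (simplified j) x∈′) }

    ends : Fin r → Subset n
    ends i = ⁅ tgt (P 𝒫 i) ⁆

    S = union ends

    ∣S∣≤r : ∣ S ∣ ≤ r
    ∣S∣≤r = begin
      ∣ S ∣      ≡⟨ sym (*-identityˡ _) ⟩
      1 * ∣ S ∣  ≤⟨ union-bound ends 1 1 (λ i → ≤-reflexive (trans (*-identityˡ _) (∣⁅x⁆∣≡1 (tgt (P 𝒫 i))))) ⟩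
      r * 1      ≡⟨ *-identityʳ r ⟩
      r          ∎
      where open ≤-Reasoning

    extend-along : LinkedOutside A B S → Augmented 𝒫
    extend-along (s , e₀ , s∈ , e₀∈ , p , p∉S) with first-hit (_∈? B) p e₀∈
    ... | e , R , e∈ , Rⁱ , R⊆ with last-hit (λ x → any? λ i → x ∈ʷ? trail (P 𝒫ₛ i)) R
    ... | inj₁ none = record
      { P = λ { zero → path R ; (suc i) → P 𝒫ₛ i }
      ; s∈A = λ { zero → s∈ ; (suc i) → s∈A 𝒫 i }
      ; e∈B = λ { zero → e∈ ; (suc i) → e∈B 𝒫 i }
      ; ⁱ∉B = λ { zero → Rⁱ ; (suc i) → ⁱ∉B 𝒫ₛ i }
      ; dis = λ { {zero} {zero} _ _ → refl
                ; {zero} {suc j} x∈ x∈′ → contradiction (j , x∈′) (none x∈)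
                ; {suc i} {zero} x∈ x∈′ → contradiction (i , x∈) (none x∈′)
                ; {suc i} {suc j} x∈ x∈′ → cong suc (dis 𝒫ₛ x∈ x∈′) }
      } , λ i → refl
    ... | inj₂ (x , xR , (i₀ , x∈P₀) , xRᵗ , xR⊆ , xR⊆ⁱ) =
      reroute (augment (rs B⊂B′) 𝒫′ λ S′ ∣S′∣≤r → enlarge (linked S′ ∣S′∣≤r))
      where
      open Detour 𝒫ₛ (simple ∘ simplified) i₀ x∈P₀ e∈ xR (Rⁱ ∘ xR⊆ⁱ) (λ y∈ i y∈P → xRᵗ y∈ (i , y∈P))
        (λ i t∈ → p∉S (R⊆ (xR⊆ t∈)) (∈union⁺ ends i (x∈⁅x⁆ _)))
      enlarge : ∀ {S′} → LinkedOutside A B S′ → LinkedOutside A B′ S′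
      enlarge (s , e , s∈ , e∈ , rest) = s , e , s∈ , B⊆B′ e∈ , rest

  menger : ∀ {B} r → (∀ S → ∣ S ∣ < r → LinkedOutside A B S) → Linkage A B r
  menger zero _ = record { P = λ () ; s∈A = λ () ; e∈B = λ () ; ⁱ∉B = λ () ; dis = λ { {()} } }
  menger (suc r) linked =
    proj₁ (augment (<-wellFounded _) (menger r λ S lt → linked S (m<n⇒m<1+n lt)) λ S le → linked S (s≤s le))

-- Dominating blocks

Within : Rel (Fin n) 0ℓ → Subset n → Rel (Fin n) 0ℓ
Within E U u v = u ∈ U × v ∈ U × E u v

record Arcs (n : ℕ) : Set₁ where
  infix 4 _⟶_ _⟶?_
  field
    _⟶_    : Rel (Fin n) 0ℓ
    _⟶?_   : ∀ u v → Dec (u ⟶ v)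
    connex : ∀ {u v} → u ≢ v → u ⟶ v ⊎ v ⟶ u
    asym   : ∀ {u v} → u ⟶ v → ¬ (v ⟶ u)

  irrefl : ∀ {u v} → u ⟶ v → u ≢ v
  irrefl u⟶u refl = asym u⟶u u⟶u

  Inside : Subset n → Rel (Fin n) 0ℓ
  Inside = Within _⟶_

  N⁻ : Fin n → Subset n
  N⁻ v = set (_⟶? v)

  Connected : ℕ → Set
  Connected K = ∀ S → ∣ S ∣ < K → ∀ {u v} → u ∈ ∁ S → v ∈ ∁ S → Star (Inside (∁ S)) u v

  dominates? : ∀ A v → Dec (∀ u → u ∈ A → v ⟶ u)
  dominates? A v = all? λ u → u ∈? A →-dec v ⟶? u

  -- By `connex` and `asym` these are precisely the vertices off `A` that receive no arc from `A`.
  ComIn : Subset n → Subset n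
  ComIn A = set (dominates? A)

-- With the decision procedures carried along, reversal is an involution definitionally.

op : Arcs n → Arcs n
op G = record
  { _⟶_ = flip _⟶_ ; _⟶?_ = flip _⟶?_ ; connex = connex ∘ (_∘ sym) ; asym = asym }
  where open Arcs G

reverse-inside : (G : Arcs n) {U : Subset n} {u v : Fin n} →
  Star (Arcs.Inside G U) u v → Star (Arcs.Inside (op G) U) v u
reverse-inside G = Star.reverse λ (u∈ , v∈ , arc) → v∈ , u∈ , arc

op-connected : (G : Arcs n) {K : ℕ} → Arcs.Connected G K → Arcs.Connected (op G) K
op-connected G conn S lt u∈ v∈ = reverse-inside G (conn S lt v∈ u∈)

module Degrees (G : Arcs n) where
  open Arcs G

  last-arc : ∀ {R : Rel (Fin n) 0ℓ} {u v} → Star R u v → u ≢ v → ∃[ w ] R w v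
  last-arc ε u≢v = contradiction refl u≢v
  last-arc {u = u} {v} (_◅_ {j = w} a p) u≢v with w ≟ v
  ... | yes refl = u , a
  ... | no w≢v = last-arc p w≢v

  -- Deleting an in-neighbourhood of fewer than `K` vertices would make `v` unreachable from a
  -- remaining vertex, which exists because `K < n`.
  min-degree : ∀ {K} → Connected K → K < n → ∀ v → K ≤ ∣ N⁻ v ∣
  min-degree {K} conn K<n v = ≮⇒≥ λ lt → far lt (∃∈∉ ⊤ (N⁻ v ∪ ⁅ v ⁆) (begin-strict
    ∣ N⁻ v ∪ ⁅ v ⁆ ∣          ≤⟨ ∣p∪q∣≤∣p∣+∣q∣ (N⁻ v) ⁅ v ⁆ ⟩
    ∣ N⁻ v ∣ + ∣ ⁅ v ⁆ ∣      ≡⟨ cong (∣ N⁻ v ∣ +_) (∣⁅x⁆∣≡1 v) ⟩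
    ∣ N⁻ v ∣ + 1  ≡⟨ +-comm _ 1 ⟩
    suc ∣ N⁻ v ∣  ≤⟨ lt ⟩
    K  <⟨ K<n ⟩
    n  ≡⟨ sym (∣⊤∣≡n n) ⟩
    ∣ ⊤ {n} ∣  ∎))
    where
    open ≤-Reasoning
    far : ∣ N⁻ v ∣ < K → ¬ (∃[ u ] u ∈ ⊤ × u ∉ N⁻ v ∪ ⁅ v ⁆)
    far lt (u , _ , u∉) with last-arc (conn (N⁻ v) lt
        (x∉p⇒x∈∁p (u∉ ∘ x∈p∪q⁺ ∘ inj₁)) (x∉p⇒x∈∁p λ v∈ → irrefl (∈set⁻ (_⟶? v) v∈) refl))
        (λ { refl → u∉ (x∈p∪q⁺ (inj₂ (x∈⁅x⁆ u))) })
    ... | w , w∈ , _ , w⟶v = x∈∁p⇒x∉p w∈ (∈set⁺ (_⟶? v) w⟶v)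

  -- Otherwise every vertex of U had more in- than out-neighbours in U.

  balanced-vertex : (U : Subset n) → Nonempty U → ∃[ u ] u ∈ U × 2 * ∣ N⁻ u ∩ U ∣ ≤ ∣ U ∣
  balanced-vertex U (u₀ , u₀∈) with any? (λ u → u ∈? U ×-dec 2 * ∣ N⁻ u ∩ U ∣ ≤? ∣ U ∣)
  ... | yes found = found
  ... | no none = contradiction (double-counting R?)
    (<⇒≢ (sum-mono-< out in′ out≤in u₀ (out<in u₀∈)))
    where
    open ≤-Reasoning
    R? : ∀ v u → Dec (v ∈ U × u ∈ U × v ⟶ u)
    R? v u = v ∈? U ×-dec (u ∈? U ×-dec v ⟶? u)
    in′ out : Fin n → ℕ
    in′ u = ∣ set (λ v → R? v u) ∣
    out v = ∣ set (R? v) ∣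
    in+out : ∀ u → in′ u + out u ≤ ∣ U ∣
    in+out u = card-disjoint {r = U}
      (λ x∈ x∈′ → asym (proj₂ (proj₂ (∈set⁻ (λ v → R? v u) x∈))) (proj₂ (proj₂ (∈set⁻ (R? u) x∈′))))
      (λ x∈ → proj₁ (∈set⁻ (λ v → R? v u) x∈)) (λ x∈ → proj₁ (proj₂ (∈set⁻ (R? u) x∈)))
    out<in : ∀ {u} → u ∈ U → out u < in′ u
    out<in {u} u∈ = +-cancelˡ-< (in′ u) _ _ (begin-strict
      in′ u + out u         ≤⟨ in+out u ⟩
      ∣ U ∣  <⟨ ≰⇒> (λ le → none (u , u∈ , le)) ⟩
      2 * ∣ N⁻ u ∩ U ∣      ≤⟨ *-monoʳ-≤ 2 (p⊆q⇒∣p∣≤∣q∣ λ {x} x∈ → ∈set⁺ (λ v → R? v u)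
                                 (proj₂ (x∈p∩q⁻ _ U x∈) , u∈ , ∈set⁻ (_⟶? u) (proj₁ (x∈p∩q⁻ _ U x∈)))) ⟩
      2 * in′ u             ≡⟨ cong (in′ u +_) (+-identityʳ _) ⟩
      in′ u + in′ u         ∎)
    out≤in : ∀ u → out u ≤ in′ u
    out≤in u = case u ∈? U of λ
      { (yes u∈) → <⇒≤ (out<in u∈)
      ; (no u∉) → p⊆q⇒∣p∣≤∣q∣ {p = set (R? u)} {q = set (λ v → R? v u)} λ x∈ → contradiction (proj₁ (∈set⁻ (R? u) x∈)) u∉ }

module Units (G : Arcs n) (c : ℕ) where
  open Arcs G
  open Degrees G

  -- `F` is what has been used up already, `i` the number of halvings and `d` the in-degree of the
  -- starting vertex.
  record Pyramid (F : Subset n) (i d : ℕ) : Set where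
    field
      base    : Subset n
      top     : Fin n
      top∈    : top ∈ base
      top⟶    : ∀ {u} → u ∈ base → u ≢ top → top ⟶ u
      ∣base∣  : ∣ base ∣ ≤ suc i
      beyond : Disjoint base F
      small   : 2 ^ i * ∣ ComIn base ─ F ∣ ≤ d

  open Pyramid

  singleton : ∀ {F} y → y ∉ F → Pyramid F 0 ∣ N⁻ y ∣
  singleton {F} y y∉ = record
    { base = ⁅ y ⁆ ; top = y ; top∈ = x∈⁅x⁆ y
    ; top⟶ = λ u∈ u≢ → contradiction (x∈⁅y⁆⇒x≡y y u∈) u≢
    ; ∣base∣ = ≤-reflexive (∣⁅x⁆∣≡1 y)
    ; beyond = λ x∈ x∈F → y∉ (subst (_∈ F) (x∈⁅y⁆⇒x≡y y x∈) x∈F)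
    ; small = ≤-trans (≤-reflexive (+-identityʳ _)) (p⊆q⇒∣p∣≤∣q∣ λ x∈ →
        ∈set⁺ (_⟶? y) (∈set⁻ (dominates? ⁅ y ⁆) (proj₁ (x∈p─q⁻ _ F x∈)) y (x∈⁅x⁆ y))) }
  -- The new top dominates at least half of the vertices that dominate the base.

  raise : ∀ {F i d} → Pyramid F i d → Pyramid F (suc i) d
  raise {F} {i} {d} p with nonempty? (ComIn (base p) ─ F)
  -- Nothing is left to halve, so the base stays the same; hence `∣base∣` is an inequality.
  ... | no empty = record
    { base = base p ; top = top p ; top∈ = top∈ p ; top⟶ = top⟶ p
    ; ∣base∣ = m≤n⇒m≤1+n (∣base∣ p) ; beyond = beyond p
    ; small = ≤-trans (≤-reflexive (trans (cong (2 ^ suc i *_) (trans (cong ∣_∣ (Empty-unique empty)) (∣⊥∣≡0 n)))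
        (*-zeroʳ (2 ^ suc i)))) z≤n }
  ... | yes nonempty with balanced-vertex _ nonempty
  ... | u , u∈ , half = record
    { base = base p ∪ ⁅ u ⁆ ; top = u ; top∈ = x∈p∪q⁺ (inj₂ (x∈⁅x⁆ u))
    ; top⟶ = λ v∈ v≢ → [ u⟶ _ , (λ v∈ → contradiction (x∈⁅y⁆⇒x≡y u v∈) v≢) ]′ (x∈p∪q⁻ (base p) ⁅ u ⁆ v∈)
    ; ∣base∣ = begin
        ∣ base p ∪ ⁅ u ⁆ ∣          ≤⟨ ∣p∪q∣≤∣p∣+∣q∣ (base p) ⁅ u ⁆ ⟩
        ∣ base p ∣ + ∣ ⁅ u ⁆ ∣      ≤⟨ +-mono-≤ (∣base∣ p) (≤-reflexive (∣⁅x⁆∣≡1 u)) ⟩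
        suc i + 1  ≡⟨ +-comm _ 1 ⟩
        suc (suc i)  ∎
    ; beyond = λ x∈ x∈F → [ (λ x∈p → beyond p x∈p x∈F)
        , (λ x∈u → proj₂ u∈U (subst (_∈ F) (x∈⁅y⁆⇒x≡y u x∈u) x∈F)) ]′ (x∈p∪q⁻ (base p) ⁅ u ⁆ x∈)
    ; small = begin
        2 * 2 ^ i * ∣ ComIn (base p ∪ ⁅ u ⁆) ─ F ∣  ≤⟨ *-monoʳ-≤ (2 * 2 ^ i) (p⊆q⇒∣p∣≤∣q∣ inherit) ⟩
        2 * 2 ^ i * ∣ N⁻ u ∩ U ∣  ≡⟨ trans (cong (_* ∣ N⁻ u ∩ U ∣) (*-comm 2 (2 ^ i)))
                                                          (*-assoc (2 ^ i) 2 _) ⟩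
        2 ^ i * (2 * ∣ N⁻ u ∩ U ∣)  ≤⟨ *-monoʳ-≤ (2 ^ i) half ⟩
        2 ^ i * ∣ U ∣  ≤⟨ small p ⟩
        d  ∎ }
    where
    open ≤-Reasoning
    U = ComIn (base p) ─ F
    u∈U = x∈p─q⁻ (ComIn (base p)) F u∈
    u⟶ = ∈set⁻ (dominates? (base p)) (proj₁ u∈U)
    inherit : ComIn (base p ∪ ⁅ u ⁆) ─ F ⊆ N⁻ u ∩ U
    inherit {x} x∈ with x∈p─q⁻ _ F x∈
    ... | x∈com , x∉F with ∈set⁻ (dominates? (base p ∪ ⁅ u ⁆)) x∈com
    ... | x⟶ = x∈p∩q⁺ (∈set⁺ (_⟶? u) (x⟶ u (x∈p∪q⁺ (inj₂ (x∈⁅x⁆ u)))) ,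
      x∈p∧x∉q⇒x∈p─q (∈set⁺ (dominates? (base p)) λ v v∈ → x⟶ v (x∈p∪q⁺ (inj₁ v∈))) x∉F)

  pyramid : ∀ {F} y → y ∉ F → ∀ i → Pyramid F i ∣ N⁻ y ∣
  pyramid y y∉ zero = singleton y y∉
  pyramid y y∉ (suc i) = raise (pyramid y y∉ i)

  -- `small` quantifies over all larger sets `F′`, so that it survives the addition of further
  -- blocks, the dual ones included.
  record Family (F : Subset n) (r : ℕ) : Set where
    field
      A       : Fin r → Subset n
      top     : Fin r → Fin n
      top∈    : ∀ i → top i ∈ A i
      top⟶    : ∀ i {u} → u ∈ A i → u ≢ top i → top i ⟶ u
      beyond : ∀ i → Disjoint (A i) F
      apart   : ∀ {i j x} → x ∈ A i → x ∈ A j → i ≡ j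
      size    : ∣ union A ∣ ≤ r * suc c
      small  : ∀ i {F′} → F ∪ union A ⊆ F′ → ∀ {v} → v ∉ F′ → 2 ^ c * ∣ ComIn (A i) ─ F′ ∣ ≤ ∣ N⁻ v ∣

  no-family : ∀ F → Family F 0
  no-family F = record
    { A = none ; top = λ () ; top∈ = λ () ; top⟶ = λ () ; beyond = λ () ; apart = λ { {()} }
    ; size = ≤-trans (≤-reflexive (sym (*-identityˡ _))) (≤-trans (union-bound none 1 0 λ ()) z≤n)
    ; small = λ () }
    where
    none : Fin 0 → Subset n
    none ()
  -- The minimality of `y` turns the bound by its own in-degree into a bound by the in-degree of any
  -- vertex not yet used.
  cons-family : ∀ {F r y} → (∀ {v} → v ∉ F → ∣ N⁻ y ∣ ≤ ∣ N⁻ v ∣) →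
    (p : Pyramid F c ∣ N⁻ y ∣) → Family (F ∪ base p) r → Family F (suc r)
  cons-family {F} {r} {y} y-min p fam = record
    { A = A′ ; top = λ { zero → top p ; (suc i) → Family.top fam i }
    ; top∈ = λ { zero → top∈ p ; (suc i) → Family.top∈ fam i }
    ; top⟶ = λ { zero → top⟶ p ; (suc i) → Family.top⟶ fam i }
    ; beyond = λ { zero → beyond p
                  ; (suc i) x∈ x∈F → Family.beyond fam i x∈ (x∈p∪q⁺ (inj₁ x∈F)) }
    ; apart = apart′
    ; size = ≤-trans (card-cover (un ∘ ∈union⁻ A′)) (+-mono-≤ (∣base∣ p) (Family.size fam))
    ; small = small′ }
    where
    open ≤-Reasoning
    A′ : Fin (suc r) → Subset n
    A′ zero = base p
    A′ (suc i) = Family.A fam i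
    apart′ : ∀ {i j x} → x ∈ A′ i → x ∈ A′ j → i ≡ j
    apart′ {zero} {zero} _ _ = refl
    apart′ {zero} {suc j} x∈ x∈′ = contradiction (x∈p∪q⁺ (inj₂ x∈)) (Family.beyond fam j x∈′)
    apart′ {suc i} {zero} x∈ x∈′ = contradiction (x∈p∪q⁺ (inj₂ x∈′)) (Family.beyond fam i x∈)
    apart′ {suc i} {suc j} x∈ x∈′ = cong suc (Family.apart fam x∈ x∈′)
    un : ∀ {x} → (∃[ i ] x ∈ A′ i) → x ∈ base p ⊎ x ∈ union (Family.A fam)
    un (zero , x∈) = inj₁ x∈
    un (suc i , x∈) = inj₂ (∈union⁺ (Family.A fam) i x∈)
    small′ : ∀ i {F′} → F ∪ union A′ ⊆ F′ → ∀ {v} → v ∉ F′ → 2 ^ c * ∣ ComIn (A′ i) ─ F′ ∣ ≤ ∣ N⁻ v ∣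
    small′ zero {F′} F⊆ {v} v∉ = begin
      2 ^ c * ∣ ComIn (base p) ─ F′ ∣    ≤⟨ *-monoʳ-≤ (2 ^ c) (p⊆q⇒∣p∣≤∣q∣ λ x∈ →
                                              case x∈p─q⁻ (ComIn (base p)) F′ x∈ of λ (x∈com , x∉) →
                                                x∈p∧x∉q⇒x∈p─q x∈com (x∉ ∘ F⊆ ∘ x∈p∪q⁺ ∘ inj₁)) ⟩
      2 ^ c * ∣ ComIn (base p) ─ F ∣     ≤⟨ small p ⟩
      ∣ N⁻ y ∣  ≤⟨ y-min (v∉ ∘ F⊆ ∘ x∈p∪q⁺ ∘ inj₁) ⟩
      ∣ N⁻ v ∣  ∎
    small′ (suc i) {F′} F⊆ = Family.small fam i ([ [ F⊆ ∘ x∈p∪q⁺ ∘ inj₁ , F⊆ ∘ x∈p∪q⁺ ∘ inj₂ ∘ ∈union⁺ A′ zero ]′ ∘ x∈p∪q⁻ F (base p)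
      , (λ x∈ → case ∈union⁻ (Family.A fam) x∈ of λ (j , x∈j) → F⊆ (x∈p∪q⁺ (inj₂ (∈union⁺ A′ (suc j) x∈j)))) ]′ ∘ x∈p∪q⁻ (F ∪ base p) _)

  family : ∀ F r → ∣ F ∣ + r * suc c ≤ n → Family F r
  family F zero _ = no-family F
  family F (suc r) room = cons-family (proj₂ (proj₂ y-min) ∘ x∉p⇒x∈∁p) p (family (F ∪ base p) r (begin
      ∣ F ∪ base p ∣ + r * suc c          ≤⟨ +-monoˡ-≤ _ (∣p∪q∣≤∣p∣+∣q∣ F (base p)) ⟩
      ∣ F ∣ + ∣ base p ∣ + r * suc c      ≤⟨ +-monoˡ-≤ _ (+-monoʳ-≤ ∣ F ∣ (∣base∣ p)) ⟩
      ∣ F ∣ + suc c + r * suc c           ≡⟨ +-assoc ∣ F ∣ _ _ ⟩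
      ∣ F ∣ + suc r * suc c  ≤⟨ room ⟩
      n  ∎))
    where
    open ≤-Reasoning
    y-min = argmin (λ v → ∣ N⁻ v ∣) (∁ F) (case ∃∈∉ ⊤ F (begin-strict
        ∣ F ∣  <⟨ m<m+n ∣ F ∣ (s≤s z≤n) ⟩
        ∣ F ∣ + suc r * suc c    ≤⟨ room ⟩
        n  ≡⟨ sym (∣⊤∣≡n n) ⟩
        ∣ ⊤ {n} ∣  ∎) of λ { (v , _ , v∉) → v , x∉p⇒x∈∁p v∉ })
    y = proj₁ y-min
    p = pyramid y (x∈∁p⇒x∉p (proj₁ (proj₂ y-min))) c

-- Self-serving pods around the blocks

card-room : {p q : Subset n} {x : ℕ} → ∣ q ∣ + x ≤ ∣ p ∣ → x ≤ ∣ p ─ q ∣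
card-room {p = p} {q} {x} le = +-cancelˡ-≤ ∣ q ∣ _ _ (begin
  ∣ q ∣ + x            ≤⟨ le ⟩
  ∣ p ∣  ≤⟨ ∣p∣≤∣p─q∣+∣q∣ p q ⟩
  ∣ p ─ q ∣ + ∣ q ∣    ≡⟨ +-comm ∣ p ─ q ∣ _ ⟩
  ∣ q ∣ + ∣ p ─ q ∣    ∎)
  where open ≤-Reasoning

halves : ∀ {x y z} → 2 * x ≤ z → 2 * y ≤ z → x + y ≤ z
halves {x} {y} {z} 2x≤ 2y≤ = *-cancelˡ-≤ 2 (begin
  2 * (x + y)      ≡⟨ *-distribˡ-+ 2 x y ⟩
  2 * x + 2 * y    ≤⟨ +-mono-≤ 2x≤ 2y≤ ⟩
  z + z            ≡⟨ cong (z +_) (sym (+-identityʳ z)) ⟩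
  2 * z            ∎)
  where open ≤-Reasoning

module _ {Ω : Set} (D : Subset n) (own : Fin n → Ω) (Q : Subset n) (C : Fin n → Subset n) (r : ℕ) where

  -- One round of reservation, in which new vertices inherit the owner of the vertex they serve.
  -- `own` is total but has a meaning on `D` only, so a round may redefine it elsewhere.
  record Growth : Set where
    field
      D′     : Subset n
      own′   : Fin n → Ω
      D⊆D′   : D ⊆ D′
      keeps  : ∀ {w} → w ∈ D → own′ w ≡ own w
      size′  : ∣ D′ ∣ ≤ ∣ D ∣ + r * ∣ Q ∣
      ∣new∣  : ∣ D′ ─ D ∣ ≤ r * ∣ Q ∣
      fresh  : ∀ {v} → v ∈ Q → ∃[ P ] ∣ P ∣ ≡ r ×
                 (∀ {w} → w ∈ P → w ∈ C v × w ∉ D × w ∈ D′ × own′ w ≡ own v)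
      origin : ∀ {w} → w ∈ D′ → w ∉ D → ∃[ v ] v ∈ Q × w ∈ C v

  abstract
    grow : (∀ {v} → v ∈ Q → r * ∣ Q ∣ ≤ ∣ C v ─ D ∣) → Growth
    grow enough = record
      { D′ = D ∪ union (part ch) ; own′ = λ w → recolour w (source? w)
      ; D⊆D′ = x∈p∪q⁺ ∘ inj₁
      ; keeps = λ {w} w∈ → kept w∈ (source? w)
      ; size′ = ≤-trans (∣p∪q∣≤∣p∣+∣q∣ D _) (+-monoʳ-≤ ∣ D ∣ (total ch))
      ; ∣new∣ = ≤-trans (p⊆q⇒∣p∣≤∣q∣ λ x∈ → case x∈p─q⁻ (D ∪ union (part ch)) D x∈ of λ (x∈′ , x∉) →
          [ (λ x∈D → contradiction x∈D x∉) , id ]′ (x∈p∪q⁻ D _ x∈′)) (total ch)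
      ; fresh = λ {v} v∈ → part ch v , size ch v∈ , λ {w} w∈ →
          ⊆C ch v w∈ , avoids ch v w∈ , x∈p∪q⁺ (inj₂ (∈union⁺ (part ch) v w∈)) , coloured w∈ (source? w)
      ; origin = λ w∈ w∉ → [ (λ w∈D → contradiction w∈D w∉)
          , (λ w∈u → case ∈union⁻ (part ch) w∈u of λ (v , w∈v) → v , support ch w∈v , ⊆C ch v w∈v) ]′
          (x∈p∪q⁻ D _ w∈) }
      where
      ch : Choice Q C D r
      ch = disjoint-choice Q C D r enough
      source? : ∀ w → Dec (∃[ v ] w ∈ part ch v)
      source? w = any? λ v → w ∈? part ch v
      recolour : ∀ w → Dec (∃[ v ] w ∈ part ch v) → Ω
      recolour w (yes (v , _)) = own v
      recolour w (no _) = own w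
      kept : ∀ {w} → w ∈ D → (d : Dec (∃[ v ] w ∈ part ch v)) → recolour w d ≡ own w
      kept w∈ (yes (v , w∈v)) = contradiction w∈ (avoids ch v w∈v)
      kept w∈ (no _) = refl
      coloured : ∀ {v w} → w ∈ part ch v → (d : Dec (∃[ v ] w ∈ part ch v)) → recolour w d ≡ own v
      coloured w∈v (yes (v′ , w∈v′)) = cong own (disjoint ch w∈v′ w∈v)
      coloured w∈v (no none) = contradiction (_ , w∈v) none

-- Deleting fewer than k vertices cannot cut a served vertex off from the base.

data Served (G : Arcs n) (k : ℕ) (Base Ok : Fin n → Set) (v : Fin n) : Set where
  base : Base v → Served G k Base Ok v
  more : ∀ Q → k ≤ ∣ Q ∣ →
    (∀ {w} → w ∈ Q → Arcs._⟶_ G w v × Ok w × Served G k Base Ok w) → Served G k Base Ok v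

served-map : ∀ {G : Arcs n} {k} {Base Ok Ok′ : Fin n → Set} → (∀ {w} → Ok w → Ok′ w) →
  ∀ {v} → Served G k Base Ok v → Served G k Base Ok′ v
served-map f (base b) = base b
served-map f (more Q le ws) = more Q le λ w∈ →
  proj₁ (ws w∈) , f (proj₁ (proj₂ (ws w∈))) , served-map f (proj₂ (proj₂ (ws w∈)))

record Blocks (G : Arcs n) (N c : ℕ) : Set where
  open Arcs G
  field
    A B    : Fin N → Subset n
    α β    : Fin N → Fin n
    α∈     : ∀ i → α i ∈ A i
    β∈     : ∀ i → β i ∈ B i
    α⟶     : ∀ i {u} → u ∈ A i → u ≢ α i → α i ⟶ u
    ⟶β     : ∀ i {u} → u ∈ B i → u ≢ β i → u ⟶ β i
    A-apart : ∀ {i j x} → x ∈ A i → x ∈ A j → i ≡ j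
    B-apart : ∀ {i j x} → x ∈ B i → x ∈ B j → i ≡ j
    A#B    : ∀ {i j x} → x ∈ A i → x ∉ B j
    F₀     : Subset n
    A⊆F₀   : ∀ i → A i ⊆ F₀
    B⊆F₀   : ∀ i → B i ⊆ F₀
    F₀⊆    : ∀ {x} → x ∈ F₀ → (∃[ i ] x ∈ A i) ⊎ (∃[ i ] x ∈ B i)
    ∣F₀∣   : ∣ F₀ ∣ ≤ N * suc c + N * suc c
    smallA : ∀ i {v} → v ∉ F₀ → 2 ^ c * ∣ ComIn (A i) ─ F₀ ∣ ≤ ∣ N⁻ v ∣
    smallB : ∀ i {v} → v ∉ F₀ → 2 ^ c * ∣ Arcs.ComIn (op G) (B i) ─ F₀ ∣ ≤ ∣ Arcs.N⁻ (op G) v ∣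

  Ex : Subset n
  Ex = union (λ i → ComIn (A i) ─ F₀)

  Ex-small : ∀ {v} → v ∉ F₀ → 2 ^ c * ∣ Ex ∣ ≤ N * ∣ N⁻ v ∣
  Ex-small v∉ = union-bound (λ i → ComIn (A i) ─ F₀) (2 ^ c) _ λ i → smallA i v∉

  -- All blocks are required at once, since which unit survives is known only after the deletion.
  Dominated : Fin n → Set
  Dominated v = ∀ i → ∃[ u ] u ∈ A i × u ⟶ v

  dominated : ∀ {v} → v ∉ F₀ → v ∉ Ex → Dominated v
  dominated {v} v∉F v∉Ex i with any? (λ u → u ∈? A i ×-dec u ⟶? v)
  ... | yes found = found
  ... | no none = contradiction
    (∈union⁺ (λ i → ComIn (A i) ─ F₀) i (x∈p∧x∉q⇒x∈p─q (∈set⁺ (dominates? (A i)) λ u u∈ →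
      [ id , (λ u⟶v → contradiction (u , u∈ , u⟶v) none) ]′
        (connex λ { refl → v∉F (A⊆F₀ i u∈) })) v∉F)) v∉Ex

op-blocks : {G : Arcs n} {N c : ℕ} → Blocks G N c → Blocks (op G) N c
op-blocks bl = record
  { A = B ; B = A ; α = β ; β = α ; α∈ = β∈ ; β∈ = α∈ ; α⟶ = ⟶β ; ⟶β = α⟶
  ; A-apart = B-apart ; B-apart = A-apart ; A#B = λ x∈ x∈′ → A#B x∈′ x∈
  ; F₀ = F₀ ; A⊆F₀ = B⊆F₀ ; B⊆F₀ = A⊆F₀ ; F₀⊆ = [ inj₂ , inj₁ ]′ ∘ F₀⊆ ; ∣F₀∣ = ∣F₀∣
  ; smallA = smallB ; smallB = smallA }
  where open Blocks bl

blocks : (G : Arcs n) (N c : ℕ) → N * suc c + N * suc c ≤ n → Blocks G N c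
blocks {n} G N c room = record
  { A = As.A ; B = Bs.A ; α = As.top ; β = Bs.top ; α∈ = As.top∈ ; β∈ = Bs.top∈ ; α⟶ = As.top⟶
  ; ⟶β = λ i u∈ u≢ → Bs.top⟶ i u∈ u≢
  ; A-apart = As.apart ; B-apart = Bs.apart
  ; A#B = λ {i} {j} x∈A x∈B → Bs.beyond j x∈B (∈union⁺ As.A i x∈A)
  ; F₀ = F₀ ; A⊆F₀ = λ i → x∈p∪q⁺ ∘ inj₁ ∘ ∈union⁺ As.A i ; B⊆F₀ = λ i → x∈p∪q⁺ ∘ inj₂ ∘ ∈union⁺ Bs.A i
  ; F₀⊆ = [ inj₁ ∘ ∈union⁻ As.A , inj₂ ∘ ∈union⁻ Bs.A ]′ ∘ x∈p∪q⁻ _ _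
  ; ∣F₀∣ = ≤-trans (∣p∪q∣≤∣p∣+∣q∣ (union As.A) (union Bs.A)) (+-mono-≤ As.size Bs.size)
  ; smallA = λ i → As.small i ([ (λ x∈ → contradiction x∈ ∉⊥) , x∈p∪q⁺ ∘ inj₁ ]′ ∘ x∈p∪q⁻ ∅ _)
  ; smallB = λ i → Bs.small i id }
  where
  open ≤-Reasoning
  As = Units.family G c ∅ N (begin
    ∣ ∅ {n} ∣ + N * suc c    ≡⟨ cong (_+ N * suc c) (∣⊥∣≡0 n) ⟩
    N * suc c  ≤⟨ m≤m+n _ _ ⟩
    N * suc c + N * suc c    ≤⟨ room ⟩
    n  ∎)
  module As = Units.Family As
  Bs = Units.family (op G) c (union As.A) N (≤-trans (+-monoˡ-≤ _ As.size) room)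
  module Bs = Units.Family Bs
  F₀ = union As.A ∪ union Bs.A

-- Service never leaves the set of vertices with the same owner. A pod can therefore be given to any
-- class as a whole.
record Pods {G : Arcs n} {N c : ℕ} (bl : Blocks G N c) (k bound : ℕ) : Set where
  module In = Blocks bl
  module Out = Blocks (op-blocks bl)
  field
    F      : Subset n
    F₀⊆F   : In.F₀ ⊆ F
    own    : Fin n → Fin N ⊎ Fin N
    own-A  : ∀ {i v} → v ∈ In.A i → own v ≡ inj₁ i
    own-B  : ∀ {i v} → v ∈ In.B i → own v ≡ inj₂ i
    ∣F∣    : ∣ F ∣ ≤ bound
    serve⁻ : ∀ {v} → v ∈ F → Served G k In.Dominated (λ w → w ∈ F × own w ≡ own v) v
    serve⁺ : ∀ {v} → v ∈ F → Served (op G) k Out.Dominated (λ w → w ∈ F × own w ≡ own v) v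

-- Vertices of F₀ get k in- and k out-neighbours off F₀, those get k in-neighbours
-- off Ex⁻, and all of these get k out-neighbours off Ex⁻ ∪ Ex⁺. The last step
-- needs Ex⁻ to be small compared with out-degrees, which is why ∣Ex⁻∣ ≤ ∣Ex⁺∣.

module _ {G : Arcs n} {N c : ℕ} (bl : Blocks G N c) (k g₀ : ℕ) where
  private
    module In = Blocks bl
    module Out = Blocks (op-blocks bl)
    open Arcs G
    N⁺ : Fin n → Subset n
    N⁺ = Arcs.N⁻ (op G)
    -- The first two rounds add `k` vertices per vertex of `F₀`, each later one at most `k` per
    -- vertex present so far.
    g₁ = g₀ + k * g₀ + k * g₀
    g₂ = g₁ + k * g₁
    g₃ = g₂ + k * g₂
    F₀ = In.F₀
    Ω = Fin N ⊎ Fin N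

  module Assemble {own₀ : Fin n → Fin N ⊎ Fin N}
    (own₀-A : ∀ {i v} → v ∈ In.A i → own₀ v ≡ inj₁ i) (own₀-B : ∀ {i v} → v ∈ In.B i → own₀ v ≡ inj₂ i)
    (S₁ : Growth F₀ own₀ F₀ N⁻ k)
    (S₂ : Growth (Growth.D′ S₁) (Growth.own′ S₁) F₀ N⁺ k)
    (S₃ : Growth (Growth.D′ S₂) (Growth.own′ S₂) (Growth.D′ S₂ ─ F₀) (λ v → N⁻ v ─ In.Ex) k)
    (S₄ : Growth (Growth.D′ S₃) (Growth.own′ S₃) (Growth.D′ S₃ ─ F₀) (λ v → N⁺ v ─ (In.Ex ∪ Out.Ex)) k)
    (∣D₄∣ : ∣ Growth.D′ S₄ ∣ ≤ g₃) where

    module S₁ = Growth S₁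
    module S₂ = Growth S₂
    module S₃ = Growth S₃
    module S₄ = Growth S₄

    keeps₃ : ∀ {w} → w ∈ S₃.D′ → S₄.own′ w ≡ S₃.own′ w
    keeps₃ = S₄.keeps
    keeps₂ : ∀ {w} → w ∈ S₂.D′ → S₄.own′ w ≡ S₂.own′ w
    keeps₂ w∈ = trans (keeps₃ (S₃.D⊆D′ w∈)) (S₃.keeps w∈)
    keeps₁ : ∀ {w} → w ∈ S₁.D′ → S₄.own′ w ≡ S₁.own′ w
    keeps₁ w∈ = trans (keeps₂ (S₂.D⊆D′ w∈)) (S₂.keeps w∈)
    keeps₀ : ∀ {w} → w ∈ F₀ → S₄.own′ w ≡ own₀ w
    keeps₀ w∈ = trans (keeps₁ (S₁.D⊆D′ w∈)) (S₁.keeps w∈)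

    D₂⊆F : S₂.D′ ⊆ S₄.D′
    D₂⊆F = S₄.D⊆D′ ∘ S₃.D⊆D′
    D₁⊆F : S₁.D′ ⊆ S₄.D′
    D₁⊆F = D₂⊆F ∘ S₂.D⊆D′
    F₀⊆F : F₀ ⊆ S₄.D′
    F₀⊆F = D₁⊆F ∘ S₁.D⊆D′

    Mate : Fin n → Fin n → Set
    Mate v w = w ∈ S₄.D′ × S₄.own′ w ≡ S₄.own′ v

    base-in : ∀ {v w} → w ∉ F₀ → w ∉ In.Ex → Served G k In.Dominated (Mate v) w
    base-in w∉F₀ w∉Ex = base (In.dominated w∉F₀ w∉Ex)

    base-out : ∀ {v w} → w ∉ F₀ → w ∉ Out.Ex → Served (op G) k Out.Dominated (Mate v) w
    base-out w∉F₀ w∉Ex = base (Out.dominated w∉F₀ w∉Ex)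

    in-D₂ : ∀ {v w} → w ∈ S₂.D′ → w ∉ F₀ → S₄.own′ w ≡ S₄.own′ v → Served G k In.Dominated (Mate v) w
    in-D₂ w∈ w∉ eq with S₃.fresh (x∈p∧x∉q⇒x∈p─q w∈ w∉)
    ... | P , ∣P∣ , new = more P (≤-reflexive (sym ∣P∣)) λ {x} x∈ →
      let x∈C , x∉D₂ , x∈D₃ , own≡ = new x∈
          x∈N , x∉Ex = x∈p─q⁻ (N⁻ _) In.Ex x∈C
      in ∈set⁻ (_⟶? _) x∈N ,
         (S₄.D⊆D′ x∈D₃ , trans (keeps₃ x∈D₃) (trans own≡ (trans (sym (keeps₂ w∈)) eq))) ,
         base-in (x∉D₂ ∘ S₂.D⊆D′ ∘ S₁.D⊆D′) x∉Ex

    serve-in : ∀ {v} → v ∈ S₄.D′ → Served G k In.Dominated (Mate v) v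
    serve-in {v} v∈ with v ∈? F₀ | v ∈? S₂.D′ | v ∈? S₃.D′
    ... | yes v∈F₀ | _ | _ with S₁.fresh v∈F₀
    ... | P , ∣P∣ , new = more P (≤-reflexive (sym ∣P∣)) λ {x} x∈ →
      let x∈N , x∉F₀ , x∈D₁ , own≡ = new x∈
          eq = trans (keeps₁ x∈D₁) (trans own≡ (sym (keeps₀ v∈F₀)))
      in ∈set⁻ (_⟶? v) x∈N , (D₁⊆F x∈D₁ , eq) , in-D₂ (S₂.D⊆D′ x∈D₁) x∉F₀ eq
    serve-in v∈ | no v∉F₀ | yes v∈D₂ | _ = in-D₂ v∈D₂ v∉F₀ refl
    serve-in v∈ | no v∉F₀ | no v∉D₂ | yes v∈D₃ with S₃.origin v∈D₃ v∉D₂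
    ... | u , _ , v∈C = base-in v∉F₀ (proj₂ (x∈p─q⁻ (N⁻ u) In.Ex v∈C))
    serve-in v∈ | no v∉F₀ | no _ | no v∉D₃ with S₄.origin v∈ v∉D₃
    ... | u , _ , v∈C = base-in v∉F₀ (proj₂ (x∈p─q⁻ (N⁺ u) _ v∈C) ∘ x∈p∪q⁺ ∘ inj₁)

    out-D₃ : ∀ {v w} → w ∈ S₃.D′ → w ∉ F₀ → S₄.own′ w ≡ S₄.own′ v →
      Served (op G) k Out.Dominated (Mate v) w
    out-D₃ w∈ w∉ eq with S₄.fresh (x∈p∧x∉q⇒x∈p─q w∈ w∉)
    ... | P , ∣P∣ , new = more P (≤-reflexive (sym ∣P∣)) λ {x} x∈ →
      let x∈C , x∉D₃ , x∈F , own≡ = new x∈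
          x∈N , x∉Ex = x∈p─q⁻ (N⁺ _) (In.Ex ∪ Out.Ex) x∈C
      in ∈set⁻ (_ ⟶?_) x∈N ,
         (x∈F , trans own≡ (trans (sym (keeps₃ w∈)) eq)) ,
         base-out (x∉D₃ ∘ S₃.D⊆D′ ∘ S₂.D⊆D′ ∘ S₁.D⊆D′) (x∉Ex ∘ x∈p∪q⁺ ∘ inj₂)

    serve-out : ∀ {v} → v ∈ S₄.D′ → Served (op G) k Out.Dominated (Mate v) v
    serve-out {v} v∈ with v ∈? F₀ | v ∈? S₃.D′
    ... | yes v∈F₀ | _ with S₂.fresh v∈F₀
    ... | P , ∣P∣ , new = more P (≤-reflexive (sym ∣P∣)) λ {x} x∈ →
      let x∈N , x∉D₁ , x∈D₂ , own≡ = new x∈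
          eq = trans (keeps₂ x∈D₂) (trans own≡ (trans (S₁.keeps v∈F₀) (sym (keeps₀ v∈F₀))))
      in ∈set⁻ (v ⟶?_) x∈N , (D₂⊆F x∈D₂ , eq) , out-D₃ (S₃.D⊆D′ x∈D₂) (x∉D₁ ∘ S₁.D⊆D′) eq
    serve-out v∈ | no v∉F₀ | yes v∈D₃ = out-D₃ v∈D₃ v∉F₀ refl
    serve-out v∈ | no v∉F₀ | no v∉D₃ with S₄.origin v∈ v∉D₃
    ... | u , _ , v∈C = base-out v∉F₀ (proj₂ (x∈p─q⁻ (N⁺ u) _ v∈C) ∘ x∈p∪q⁺ ∘ inj₂)

    pods : Pods bl k g₃
    pods = record
      { F = S₄.D′ ; F₀⊆F = F₀⊆F ; own = S₄.own′
      ; own-A = λ v∈ → trans (keeps₀ (In.A⊆F₀ _ v∈)) (own₀-A v∈)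
      ; own-B = λ v∈ → trans (keeps₀ (In.B⊆F₀ _ v∈)) (own₀-B v∈)
      ; ∣F∣ = ∣D₄∣
      ; serve⁻ = serve-in ; serve⁺ = serve-out }

  build-pods : ∀ {K} → Fin N → ∣ In.F₀ ∣ ≤ g₀ → 2 * g₃ ≤ K →
    (∀ v → K ≤ ∣ N⁻ v ∣) → (∀ v → K ≤ ∣ N⁺ v ∣) →
    (∀ {v} → v ∉ In.F₀ → 4 * ∣ In.Ex ∣ ≤ ∣ N⁻ v ∣) → (∀ {v} → v ∉ In.F₀ → 4 * ∣ Out.Ex ∣ ≤ ∣ N⁺ v ∣) →
    ∣ In.Ex ∣ ≤ ∣ Out.Ex ∣ → Pods bl k g₃
  build-pods {K} i₀ ∣F₀∣≤ 2g₃≤K K≤⁻ K≤⁺ e⁻-small e⁺-small e⁻≤e⁺ = Assemble.pods (own₀-A (dec-A _) (dec-B _)) (own₀-B (dec-A _) (dec-B _)) S₁ S₂ S₃ S₄ ∣D₄∣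
    where
    open ≤-Reasoning
    dec-A : ∀ v → Dec (∃[ i ] v ∈ In.A i)
    dec-A v = any? λ i → v ∈? In.A i
    dec-B : ∀ v → Dec (∃[ i ] v ∈ In.B i)
    dec-B v = any? λ i → v ∈? In.B i
    index : ∀ {v} → Dec (∃[ i ] v ∈ In.A i) → Dec (∃[ i ] v ∈ In.B i) → Ω
    index (yes (i , _)) _ = inj₁ i
    index (no _) (yes (i , _)) = inj₂ i
    -- A default off `F₀`; reserved vertices get their owner from the vertex they serve.
    index (no _) (no _) = inj₁ i₀
    own₀ : Fin n → Ω
    own₀ v = index (dec-A v) (dec-B v)
    own₀-A : ∀ {i v} (d : Dec (∃[ i ] v ∈ In.A i)) d′ → v ∈ In.A i → index d d′ ≡ inj₁ i
    own₀-A (yes (j , v∈′)) _ v∈ = cong inj₁ (In.A-apart v∈′ v∈)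
    own₀-A (no none) _ v∈ = contradiction (_ , v∈) none
    own₀-B : ∀ {i v} (d : Dec (∃[ i ] v ∈ In.A i)) d′ → v ∈ In.B i → index d d′ ≡ inj₂ i
    own₀-B (yes (j , v∈′)) _ v∈ = contradiction v∈ (In.A#B v∈′)
    own₀-B (no _) (yes (j , v∈′)) v∈ = cong inj₂ (In.B-apart v∈′ v∈)
    own₀-B (no _) (no none) v∈ = contradiction (_ , v∈) none

    g₁≤g₂ : g₁ ≤ g₂
    g₁≤g₂ = m≤m+n g₁ _
    g₂≤g₃ : g₂ ≤ g₃
    g₂≤g₃ = m≤m+n g₂ _
    g₃≤K : g₃ ≤ K
    g₃≤K = ≤-trans (m≤m+n g₃ _) 2g₃≤K

    S₁ = grow F₀ own₀ F₀ N⁻ k λ {v} _ → card-room {p = N⁻ v} {F₀} (begin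
      ∣ F₀ ∣ + k * ∣ F₀ ∣    ≤⟨ +-mono-≤ ∣F₀∣≤ (*-monoʳ-≤ k ∣F₀∣≤) ⟩
      g₀ + k * g₀            ≤⟨ m≤m+n _ _ ⟩
      g₁  ≤⟨ ≤-trans g₁≤g₂ (≤-trans g₂≤g₃ g₃≤K) ⟩
      K  ≤⟨ K≤⁻ v ⟩
      ∣ N⁻ v ∣  ∎)
    module S₁ = Growth S₁
    ∣D₁∣ : ∣ S₁.D′ ∣ ≤ g₀ + k * g₀
    ∣D₁∣ = ≤-trans S₁.size′ (+-mono-≤ ∣F₀∣≤ (*-monoʳ-≤ k ∣F₀∣≤))

    S₂ = grow S₁.D′ S₁.own′ F₀ N⁺ k λ {v} _ → card-room {p = N⁺ v} {S₁.D′} (begin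
      ∣ S₁.D′ ∣ + k * ∣ F₀ ∣    ≤⟨ +-mono-≤ ∣D₁∣ (*-monoʳ-≤ k ∣F₀∣≤) ⟩
      g₁  ≤⟨ ≤-trans g₁≤g₂ (≤-trans g₂≤g₃ g₃≤K) ⟩
      K  ≤⟨ K≤⁺ v ⟩
      ∣ N⁺ v ∣  ∎)
    module S₂ = Growth S₂
    ∣D₂∣ : ∣ S₂.D′ ∣ ≤ g₁
    ∣D₂∣ = ≤-trans S₂.size′ (+-mono-≤ ∣D₁∣ (*-monoʳ-≤ k ∣F₀∣≤))

    ∣_─F₀∣ : ∀ {x} D → ∣ D ∣ ≤ x → ∣ D ─ F₀ ∣ ≤ x
    ∣ D ─F₀∣ = ≤-trans (∣p─q∣≤∣p∣ D F₀)

    room : ∀ {D E g X d} → ∣ D ∣ ≤ g → 2 * (g + k * g) ≤ d → 2 * ∣ E ∣ ≤ d → d ≤ ∣ X ∣ →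
      k * ∣ D ─ F₀ ∣ ≤ ∣ (X ─ E) ─ D ∣
    room {D} {E} {g} {X} {d} D≤g 2g≤d 2E≤d d≤X = card-room {p = X ─ E} {D} (card-room {p = X} {E} (begin
      ∣ E ∣ + (∣ D ∣ + k * ∣ D ─ F₀ ∣)  ≤⟨ +-monoʳ-≤ ∣ E ∣ (+-mono-≤ D≤g (*-monoʳ-≤ k (∣ D ─F₀∣ D≤g))) ⟩
      ∣ E ∣ + (g + k * g)  ≤⟨ halves {∣ E ∣} {g + k * g} 2E≤d 2g≤d ⟩
      d  ≤⟨ d≤X ⟩
      ∣ X ∣  ∎))

    S₃ = grow S₂.D′ S₂.own′ (S₂.D′ ─ F₀) (λ v → N⁻ v ─ In.Ex) k λ {v} v∈ → room {E = In.Ex} {X = N⁻ v} ∣D₂∣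
      (≤-trans (*-monoʳ-≤ 2 g₂≤g₃) (≤-trans 2g₃≤K (K≤⁻ v)))
      (≤-trans (*-monoˡ-≤ ∣ In.Ex ∣ (s≤s (s≤s (z≤n {2})))) (e⁻-small (proj₂ (x∈p─q⁻ S₂.D′ F₀ v∈)))) ≤-refl
    module S₃ = Growth S₃
    ∣D₃∣ : ∣ S₃.D′ ∣ ≤ g₂
    ∣D₃∣ = ≤-trans S₃.size′ (+-mono-≤ ∣D₂∣ (*-monoʳ-≤ k (∣ S₂.D′ ─F₀∣ ∣D₂∣)))

    -- The two exceptional sets together have at most `2 * ∣ Out.Ex ∣` vertices, half of the
    -- out-degree by the factor 4 in `e⁺-small`; the other half holds the pods and the new vertices.
    S₄ = grow S₃.D′ S₃.own′ (S₃.D′ ─ F₀) (λ v → N⁺ v ─ (In.Ex ∪ Out.Ex)) k λ {v} v∈ → room {E = In.Ex ∪ Out.Ex} {X = N⁺ v} ∣D₃∣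
      (≤-trans 2g₃≤K (K≤⁺ v)) (begin
        2 * ∣ In.Ex ∪ Out.Ex ∣           ≤⟨ *-monoʳ-≤ 2 (∣p∪q∣≤∣p∣+∣q∣ In.Ex Out.Ex) ⟩
        2 * (∣ In.Ex ∣ + ∣ Out.Ex ∣)     ≤⟨ *-monoʳ-≤ 2 (+-monoˡ-≤ ∣ Out.Ex ∣ e⁻≤e⁺) ⟩
        2 * (∣ Out.Ex ∣ + ∣ Out.Ex ∣)  ≡⟨ cong (λ z → 2 * (∣ Out.Ex ∣ + z)) (sym (+-identityʳ _)) ⟩
        2 * (2 * ∣ Out.Ex ∣)             ≡⟨ sym (*-assoc 2 2 ∣ Out.Ex ∣) ⟩
        4 * ∣ Out.Ex ∣  ≤⟨ e⁺-small (proj₂ (x∈p─q⁻ S₃.D′ F₀ v∈)) ⟩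
        ∣ N⁺ v ∣  ∎) ≤-refl
    module S₄ = Growth S₄
    ∣D₄∣ : ∣ S₄.D′ ∣ ≤ g₃
    ∣D₄∣ = ≤-trans S₄.size′ (+-mono-≤ ∣D₃∣ (*-monoʳ-≤ k (∣ S₃.D′ ─F₀∣ ∣D₃∣)))

-- Systems of short disjoint paths

-- A greedy independent set: each pick removes its closed neighbourhood in the conflict graph, at
-- most `b` elements. By `Conf-refl` the conclusion includes injectivity.
select-independent : ∀ {m b} (G : Subset m) (Conf : Fin m → Subset m) →
  (∀ i → i ∈ Conf i) → (∀ {i j} → i ∈ Conf j → j ∈ Conf i) → 1 ≤ b →
  (∀ {i} → i ∈ G → ∣ Conf i ∣ ≤ b) → ∀ r → r * b ≤ ∣ G ∣ →
  Σ[ f ∈ (Fin r → Fin m) ] (∀ i → f i ∈ G) × (∀ {i j} → f i ∈ Conf (f j) → i ≡ j)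
select-independent G Conf Conf-refl Conf-sym 1≤b bound zero _ = (λ ()) , (λ ()) , λ { {()} }
select-independent {m} {b} G Conf Conf-refl Conf-sym 1≤b bound (suc r) room
  with ∃∈∉ G ∅ (begin-strict
    ∣ ∅ {m} ∣      ≡⟨ ∣⊥∣≡0 m ⟩
    0  <⟨ 1≤b ⟩
    b  ≤⟨ m≤m+n b (r * b) ⟩
    b + r * b      ≤⟨ room ⟩
    ∣ G ∣          ∎)
  where open ≤-Reasoning
... | x , x∈G , _ with select-independent (G ─ Conf x) Conf Conf-refl Conf-sym 1≤b
      (λ {i} i∈ → bound (proj₁ (x∈p─q⁻ G (Conf x) {i} i∈))) r
      (card-room {p = G} {Conf x} (≤-trans (+-monoˡ-≤ (r * b) (bound x∈G)) room))
... | f , f∈ , f-indep = f′ ,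
  (λ { zero → x∈G ; (suc i) → proj₁ (x∈p─q⁻ G (Conf x) (f∈ i)) }) , λ {i} {j} → indep i j
  where
  f′ : Fin (suc r) → Fin m
  f′ zero = x
  f′ (suc i) = f i
  indep : ∀ i j → f′ i ∈ Conf (f′ j) → i ≡ j
  indep zero zero _ = refl
  indep zero (suc j) x∈ = contradiction (Conf-sym x∈) (proj₂ (x∈p─q⁻ G (Conf x) (f∈ j)))
  indep (suc i) zero x∈ = contradiction x∈ (proj₂ (x∈p─q⁻ G (Conf x) (f∈ i)))
  indep (suc i) (suc j) x∈ = cong suc (f-indep x∈)

module Lengths {n : ℕ} (E : Rel (Fin n) 0ℓ) where
  open Walks E

  len : ∀ {s e} → Star E s e → ℕ
  len ε = 0
  len (_ ◅ p) = suc (len p)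

  penult : ∀ {s e} → Star E s e → Fin n
  penult {s} ε = s
  penult {s} (_ ◅ ε) = s
  penult (_ ◅ (a ◅ p)) = penult (a ◅ p)

  last-two : ∀ {s e} → Star E s e → Subset n
  last-two {e = e} p = ⁅ e ⁆ ∪ ⁅ penult p ⁆

  ∣last-two∣ : ∀ {s e} (p : Star E s e) → ∣ last-two p ∣ ≤ 2
  ∣last-two∣ {e = e} p = ≤-trans (∣p∪q∣≤∣p∣+∣q∣ ⁅ e ⁆ ⁅ penult p ⁆)
    (+-mono-≤ (≤-reflexive (∣⁅x⁆∣≡1 e)) (≤-reflexive (∣⁅x⁆∣≡1 (penult p))))

  penult∈ : ∀ {s e} (p : Star E s e) → penult p ∈ʷ p
  penult∈ ε = here
  penult∈ (_ ◅ ε) = here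
  penult∈ (_ ◅ (a ◅ p)) = there (penult∈ (a ◅ p))

  last-two⊆ : ∀ {s e} (p : Star E s e) {x} → x ∈ last-two p → x ∈ʷ p
  last-two⊆ {e = e} p x∈ = [ (λ x∈e → subst (_∈ʷ p) (sym (x∈⁅y⁆⇒x≡y e x∈e)) (end∈ p))
    , (λ x∈p → subst (_∈ʷ p) (sym (x∈⁅y⁆⇒x≡y (penult p) x∈p)) (penult∈ p)) ]′ (x∈p∪q⁻ ⁅ e ⁆ _ x∈)

  -- The margin of two leaves the prefix with one further arc still shorter than `p`.
  Prefix : ∀ {s e} → Star E s e → Fin n → Set
  Prefix {s} p x = Σ[ q ∈ Star E s x ] (∀ {y} → y ∈ʷ q → y ∈ʷ p) × 2 + len q ≤ len p

  early : ∀ {s e} {p : Star E s e} {x} → x ∈ʷ p → x ≡ e ⊎ x ≡ penult p ⊎ Prefix p x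
  early {p = ε} here = inj₁ refl
  early {p = _ ◅ ε} here = inj₂ (inj₁ refl)
  early {p = _ ◅ ε} (there here) = inj₁ refl
  early {p = _ ◅ (_ ◅ p)} here = inj₂ (inj₂ (ε , (λ { here → here }) , s≤s (s≤s z≤n)))
  early {p = a ◅ (b ◅ p)} (there x∈) with early x∈
  ... | inj₁ eq = inj₁ eq
  ... | inj₂ (inj₁ eq) = inj₂ (inj₁ eq)
  ... | inj₂ (inj₂ (q , q⊆ , le)) = inj₂ (inj₂ (a ◅ q , (λ { here → here ; (there y∈) → there (q⊆ y∈) }) , s≤s le))

  early-prefix : ∀ {s e} (p : Star E s e) {x} → x ∈ʷ p → x ∉ last-two p → Prefix p x
  early-prefix {e = e} p x∈ x∉ with early x∈
  ... | inj₁ refl = contradiction (x∈p∪q⁺ (inj₁ (x∈⁅x⁆ e))) x∉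
  ... | inj₂ (inj₁ refl) = contradiction (x∈p∪q⁺ {p = ⁅ e ⁆} (inj₂ (x∈⁅x⁆ (penult p)))) x∉
  ... | inj₂ (inj₂ prefix) = prefix

  len-◅◅ : ∀ {s y e} (p : Star E s y) (q : Star E y e) → len (p ◅◅ q) ≡ len p + len q
  len-◅◅ ε q = refl
  len-◅◅ (_ ◅ p) q = cong suc (len-◅◅ p q)

  ∣vset∣≤ : ∀ {s e} (p : Star E s e) → ∣ vset p ∣ ≤ suc (len p)
  ∣vset∣≤ {s} ε = ≤-trans (p⊆q⇒∣p∣≤∣q∣ λ x∈ → at (∈set⁻ (_∈ʷ? ε) x∈)) (≤-reflexive (∣⁅x⁆∣≡1 s))
    where
    at : ∀ {x} → x ∈ʷ ε {x = s} → x ∈ ⁅ s ⁆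
    at here = x∈⁅x⁆ s
  ∣vset∣≤ {s} (a ◅ p) = ≤-trans (card-cover {q = ⁅ s ⁆} {vset p} λ x∈ → at (∈set⁻ (_∈ʷ? (a ◅ p)) x∈))
    (+-mono-≤ (≤-reflexive (∣⁅x⁆∣≡1 s)) (∣vset∣≤ p))
    where
    at : ∀ {x} → x ∈ʷ a ◅ p → x ∈ ⁅ s ⁆ ⊎ x ∈ vset p
    at here = inj₁ (x∈⁅x⁆ s)
    at (there x∈) = inj₂ (∈set⁺ (_∈ʷ? p) x∈)

  simple-len : ∀ {s e} (p : Star E s e) → Simple p → suc (len p) ≤ ∣ vset p ∣
  simple-len {s} ε _ = ≤-trans (≤-reflexive (sym (∣⁅x⁆∣≡1 s)))
    (p⊆q⇒∣p∣≤∣q∣ λ x∈ → ∈set⁺ (_∈ʷ? ε) (subst (_∈ʷ ε) (sym (x∈⁅y⁆⇒x≡y s x∈)) here))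
  simple-len {s} (a ◅ p) (s∉ , simple) = ≤-trans
    (+-mono-≤ (≤-reflexive (sym (∣⁅x⁆∣≡1 s))) (simple-len p simple))
    (card-disjoint {p = ⁅ s ⁆} {vset p}
      (λ x∈ x∈′ → s∉ (subst (_∈ʷ p) (x∈⁅y⁆⇒x≡y s x∈) (∈set⁻ (_∈ʷ? p) x∈′)))
      (λ x∈ → ∈set⁺ (_∈ʷ? (a ◅ p)) (subst (_∈ʷ a ◅ p) (sym (x∈⁅y⁆⇒x≡y s x∈)) here))
      (λ x∈ → ∈set⁺ (_∈ʷ? (a ◅ p)) (there (∈set⁻ (_∈ʷ? p) x∈))))

-- Reversal, tightness and shortening of path systems

module Reversal (E₀ : Rel (Fin n) 0ℓ) (U : Subset n) where
  private
    E  = Within E₀ U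
    Eᵒ = Within (flip E₀) U
    module W = Walks E
    module Wᵒ = Walks Eᵒ

  rev : ∀ {s e} → Star E s e → Star Eᵒ e s
  rev ε = ε
  rev ((u∈ , v∈ , arc) ◅ p) = rev p ◅◅ (v∈ , u∈ , arc) ◅ ε

  rev⁻ : ∀ {s e} (p : Star E s e) {x} → x Wᵒ.∈ʷ rev p → x W.∈ʷ p
  rev⁻ ε Wᵒ.here = W.here
  rev⁻ (a ◅ p) x∈ with Wᵒ.◅◅⁻ʷ (rev p) x∈
  ... | inj₁ x∈p = W.there (rev⁻ p (Wᵒ.ⁱ⇒ʷ x∈p))
  ... | inj₂ Wᵒ.here = W.there W.here
  ... | inj₂ (Wᵒ.there Wᵒ.here) = W.here

  len-rev : ∀ {s e} (p : Star E s e) → Lengths.len Eᵒ (rev p) ≡ Lengths.len E p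
  len-rev ε = refl
  len-rev (_ ◅ p) = trans (Lengths.len-◅◅ Eᵒ (rev p) _) (trans (+-comm _ 1) (cong suc (len-rev p)))

  ʷ-◅◅ : ∀ {s y e} (p : Star Eᵒ s y) {q : Star Eᵒ y e} {x} → x Wᵒ.∈ʷ p ⊎ x Wᵒ.∈ʷ q → x Wᵒ.∈ʷ p ◅◅ q
  ʷ-◅◅ ε (inj₁ Wᵒ.here) = Wᵒ.here
  ʷ-◅◅ ε (inj₂ x∈) = x∈
  ʷ-◅◅ (_ ◅ p) (inj₁ Wᵒ.here) = Wᵒ.here
  ʷ-◅◅ (_ ◅ p) (inj₁ (Wᵒ.there x∈)) = Wᵒ.there (ʷ-◅◅ p (inj₁ x∈))
  ʷ-◅◅ (_ ◅ p) (inj₂ x∈) = Wᵒ.there (ʷ-◅◅ p (inj₂ x∈))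

  rev⁺ : ∀ {s e} (p : Star E s e) {x} → x W.∈ʷ p → x Wᵒ.∈ʷ rev p
  rev⁺ ε W.here = Wᵒ.here
  rev⁺ (a ◅ p) W.here = ʷ-◅◅ (rev p) (inj₂ (Wᵒ.there Wᵒ.here))
  rev⁺ (a ◅ p) (W.there x∈) = ʷ-◅◅ (rev p) (inj₁ (rev⁺ p x∈))

-- With its arcs `enter` and `exit` a walk leads from some `β` to some `α`, the direction in which a
-- unit is crossed. `R` is the number of walks from which the `M` walks are taken: `short` allows
-- twice the average number of vertices of `R` disjoint walks.
record System {n N : ℕ} (E : Rel (Fin n) 0ℓ) (α β : Fin N → Fin n) (U : Subset n) (M R : ℕ) : Set where
  open Walks (Within E U)
  open Path
  open Lengths (Within E U)
  field
    P     : Fin M → Path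
    ai bi : Fin M → Fin N
    ai-inj : ∀ {p q} → ai p ≡ ai q → p ≡ q
    bi-inj : ∀ {p q} → bi p ≡ bi q → p ≡ q
    enter : ∀ q → E (β (bi q)) (src (P q))
    exit  : ∀ q → E (tgt (P q)) (α (ai q))
    inU   : ∀ q {x} → x ∈ʷ trail (P q) → x ∈ U
    dis   : ∀ {p q x} → x ∈ʷ trail (P p) → x ∈ʷ trail (P q) → p ≡ q
    short : ∀ q → suc (len (trail (P q))) * R ≤ 2 * n

  length : ℕ
  length = sum λ q → len (trail (P q))

  OffPaths : Fin n → Set
  OffPaths v = ∀ q → ¬ (v ∈ʷ trail (P q))

  -- The shortcuts available to a walk at `x`. The detour vertex `v` is included because the
  -- exceptional vertex to be served may itself lie off all walks.
  Exit : Fin n → Set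
  Exit x = ∃[ i ] (∀ q → ai q ≢ i) × (E x (α i) ⊎ ∃[ v ] v ∈ U × OffPaths v × E x v × E v (α i))

  Tight : Set
  Tight = ∀ q {x} → x ∈ʷ trail (P q) → x ∉ last-two (trail (P q)) → ¬ Exit x

module _ {N M R : ℕ} {E : Rel (Fin n) 0ℓ} {α β : Fin N → Fin n} {U : Subset n} where

  op-system : System E α β U M R → System (flip E) β α U M R
  op-system sys = record
    { P = λ q → Walks.path (rev (trail (P q))) ; ai = bi ; bi = ai ; ai-inj = bi-inj ; bi-inj = ai-inj
    ; enter = exit ; exit = enter ; inU = λ q x∈ → inU q (rev⁻ (trail (P q)) x∈)
    ; dis = λ {p} {q} x∈ x∈′ → dis (rev⁻ (trail (P p)) x∈) (rev⁻ (trail (P q)) x∈′)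
    ; short = λ q → subst (λ l → suc l * R ≤ 2 * n) (sym (len-rev (trail (P q)))) (short q) }
    where
    open System sys
    open Walks.Path
    open Reversal E U

  op-length : (sys : System E α β U M R) → System.length (op-system sys) ≡ System.length sys
  op-length sys = sum-cong-≗ λ q → Reversal.len-rev E U (Walks.Path.trail (System.P sys q))

module Shorten {N M R : ℕ} {_⟶_ : Rel (Fin n) 0ℓ} (_⟶?_ : ∀ u v → Dec (u ⟶ v))
  {α β : Fin N → Fin n} {U : Subset n} (sys : System _⟶_ α β U M R) where
  open Walks (Within _⟶_ U)
  open Path
  open Lengths (Within _⟶_ U)
  open System sys

  Shorter : Set
  Shorter = ∃[ s ] System.length {E = _⟶_} {α} {β} {U} {M} {R} s < length

  exit? : ∀ x → Dec (Exit x)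
  exit? x = any? λ i → all? (λ q → ¬? (ai q ≟ i)) ×-dec (x ⟶? α i ⊎-dec
    any? λ v → v ∈? U ×-dec (all? (λ q → ¬? (v ∈ʷ? trail (P q))) ×-dec (x ⟶? v ×-dec v ⟶? α i)))

  module Replace (q₀ : Fin M) (i : Fin N) (surplus : ∀ q → ai q ≢ i) {e : Fin n}
    (w : Star (Within _⟶_ U) (src (P q₀)) e) (e⟶ : e ⟶ α i)
    (new : ∀ {y} → y ∈ʷ w → y ∈ʷ trail (P q₀) ⊎ y ∈ U × OffPaths y)
    (shorter : len w < len (trail (P q₀))) where

    P′ : Fin M → Path
    P′ q with q ≟ q₀
    ... | yes _ = path w
    ... | no _ = P q

    ai′ : Fin M → Fin N
    ai′ q with q ≟ q₀
    ... | yes _ = i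
    ... | no _ = ai q

    ai′-inj : ∀ p q → ai′ p ≡ ai′ q → p ≡ q
    ai′-inj p q eq with p ≟ q₀ | q ≟ q₀
    ... | yes refl | yes refl = refl
    ... | yes _ | no _ = contradiction (sym eq) (surplus q)
    ... | no _ | yes _ = contradiction eq (surplus p)
    ... | no _ | no _ = ai-inj eq

    enter′ : ∀ q → β (bi q) ⟶ src (P′ q)
    enter′ q with q ≟ q₀
    ... | yes refl = enter q
    ... | no _ = enter q

    exit′ : ∀ q → tgt (P′ q) ⟶ α (ai′ q)
    exit′ q with q ≟ q₀
    ... | yes _ = e⟶
    ... | no _ = exit q

    old-or-new : ∀ q {x} → x ∈ʷ trail (P′ q) → x ∈ʷ trail (P q) ⊎ q ≡ q₀ × x ∈ U × OffPaths x
    old-or-new q x∈ with q ≟ q₀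
    ... | no _ = inj₁ x∈
    ... | yes refl with new x∈
    ... | inj₁ x∈P = inj₁ x∈P
    ... | inj₂ off = inj₂ (refl , off)

    dis′ : ∀ p q {x} → x ∈ʷ trail (P′ p) → x ∈ʷ trail (P′ q) → p ≡ q
    dis′ p q x∈ x∈′ with old-or-new p x∈ | old-or-new q x∈′
    ... | inj₁ x∈p | inj₁ x∈q = dis x∈p x∈q
    ... | inj₁ x∈p | inj₂ (_ , _ , off) = contradiction x∈p (off p)
    ... | inj₂ (_ , _ , off) | inj₁ x∈q = contradiction x∈q (off q)
    ... | inj₂ (refl , _) | inj₂ (refl , _) = refl

    len≤ : ∀ q → len (trail (P′ q)) ≤ len (trail (P q))
    len≤ q with q ≟ q₀
    ... | yes refl = <⇒≤ shorter
    ... | no _ = ≤-refl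

    len< : len (trail (P′ q₀)) < len (trail (P q₀))
    len< with q₀ ≟ q₀
    ... | yes _ = shorter
    ... | no q≢ = contradiction refl q≢

    sys′ : System _⟶_ α β U M R
    sys′ = record
      { P = P′ ; ai = ai′ ; bi = bi ; ai-inj = ai′-inj _ _ ; bi-inj = bi-inj ; enter = enter′ ; exit = exit′
      ; inU = λ q x∈ → [ inU q , (λ (_ , x∈U , _) → x∈U) ]′ (old-or-new q x∈)
      ; dis = dis′ _ _ ; short = λ q → ≤-trans (*-monoˡ-≤ R (s≤s (len≤ q))) (short q) }

    result : Shorter
    result = sys′ , sum-mono-< _ _ len≤ q₀ len<

  shorten : ∀ q {x} → x ∈ʷ trail (P q) → x ∉ last-two (trail (P q)) → Exit x → Shorter
  shorten q {x} x∈ x∉ (i , surplus , way) with early-prefix (trail (P q)) x∈ x∉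
  ... | w , w⊆ , le with way
  ... | inj₁ x⟶α = Replace.result q i surplus w x⟶α (inj₁ ∘ w⊆) (≤-trans (s≤s (n≤1+n _)) le)
  ... | inj₂ (v , v∈ , off , x⟶v , v⟶α) =
    Replace.result q i surplus (w ◅◅ step ◅ ε) v⟶α new
      (≤-trans (s≤s (≤-reflexive (trans (len-◅◅ w _) (+-comm _ 1)))) le)
    where
    step : Within _⟶_ U x v
    step = inU q x∈ , v∈ , x⟶v
    new : ∀ {y} → y ∈ʷ w ◅◅ step ◅ ε → y ∈ʷ trail (P q) ⊎ y ∈ U × OffPaths y
    new y∈ with ◅◅⁻ʷ w y∈
    ... | inj₁ y∈w = inj₁ (w⊆ (ⁱ⇒ʷ y∈w))
    ... | inj₂ here = inj₁ x∈
    ... | inj₂ (there here) = inj₂ (v∈ , off)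

  tight-or-shorter : Tight ⊎ Shorter
  tight-or-shorter with any? (λ q → any? λ x →
    x ∈ʷ? trail (P q) ×-dec (¬? (x ∈? last-two (trail (P q))) ×-dec exit? x))
  ... | yes (q , x , x∈ , x∉ , ex) = inj₂ (shorten q x∈ x∉ ex)
  ... | no none = inj₁ λ q {x} x∈ x∉ ex → none (q , x , x∈ , x∉ , ex)

-- Tightness at the other end is tightness of the reversed system, so the two
-- orientations are shortened alternately.

settle : ∀ {N M R} {_⟶_ : Rel (Fin n) 0ℓ} (_⟶?_ : ∀ u v → Dec (u ⟶ v)) {α β : Fin N → Fin n} {U : Subset n}
  (sys : System _⟶_ α β U M R) → Acc _<_ (System.length sys) →
  Σ[ sys ∈ System _⟶_ α β U M R ] System.Tight sys × System.Tight (op-system sys)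
settle _⟶?_ sys (acc rs) with Shorten.tight-or-shorter _⟶?_ sys
... | inj₂ (sys′ , lt) = settle _⟶?_ sys′ (rs lt)
... | inj₁ tight with Shorten.tight-or-shorter (flip _⟶?_) (op-system sys)
... | inj₂ (sys′ , lt) = settle _⟶?_ (op-system sys′)
        (rs (subst₂ _<_ (sym (op-length sys′)) (op-length sys) lt))
... | inj₁ tightᵒ = sys , tight , tightᵒ

card-union≥ : (f : Fin a → Subset n) (r : ℕ) → (∀ i → r ≤ ∣ f i ∣) →
  (∀ {i j x} → x ∈ f i → x ∈ f j → i ≡ j) → a * r ≤ ∣ union f ∣
card-union≥ {zero} f r _ _ = z≤n
card-union≥ {suc a} f r large dis = ≤-trans
  (+-mono-≤ (large zero) (card-union≥ (f ∘ suc) r (large ∘ suc) λ x∈ x∈′ → suc-injective (dis x∈ x∈′)))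
  (card-disjoint {p = f zero} {union (f ∘ suc)} apart (∈union⁺ f zero)
    (λ x∈ → case ∈union⁻ (f ∘ suc) x∈ of λ (i , x∈i) → ∈union⁺ f (suc i) x∈i))
  where
  apart : ∀ {x} → x ∈ f zero → x ∉ union (f ∘ suc)
  apart x∈ x∈′ with ∈union⁻ (f ∘ suc) x∈′
  ... | i , x∈i with dis x∈ x∈i
  ... | ()

Within-∈ : ∀ {E : Rel (Fin n) 0ℓ} {U s e} (p : Star (Within E U) s e) → s ∈ U →
  ∀ {x} → Walks._∈ʷ_ (Within E U) x p → x ∈ U
Within-∈ p s∈ Walks.here = s∈
Within-∈ ((_ , v∈ , _) ◅ p) _ (Walks.there x∈) = Within-∈ p v∈ x∈

widen : ∀ {E : Rel (Fin n) 0ℓ} {U W s e} → U ⊆ W → Star (Within E U) s e → Star (Within E W) s e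
widen U⊆W = Star.map λ (u∈ , v∈ , arc) → U⊆W u∈ , U⊆W v∈ , arc

widen-∈ : ∀ {E : Rel (Fin n) 0ℓ} {U W s e} (U⊆W : U ⊆ W) (p : Star (Within E U) s e) → s ∈ U →
  ∀ {x} → Walks._∈ʷ_ (Within E W) x (widen U⊆W p) → x ∈ U
widen-∈ U⊆W ε s∈ Walks.here = s∈
widen-∈ U⊆W ((s∈ , v∈ , _) ◅ p) _ Walks.here = s∈
widen-∈ U⊆W ((_ , v∈ , _) ◅ p) _ (Walks.there x∈) = widen-∈ U⊆W p v∈ x∈

-- Many disjoint walks between fans of out-neighbours of the β i and fans of
-- in-neighbours of the α i; at least half of them are short, and among these one
-- can pick M that use each fan at most once.

module InitialSystem (G : Arcs n) {N r M : ℕ} (α β : Fin N → Fin n) (F : Subset n) (K : ℕ)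
  (conn : Arcs.Connected G K)
  (K≤⁻ : ∀ v → K ≤ ∣ Arcs.N⁻ G v ∣) (K≤⁺ : ∀ v → K ≤ ∣ Arcs.N⁻ (op G) v ∣)
  (room : ∣ F ∣ + N * r ≤ K) (1≤r : 1 ≤ r) (4M≤N : 4 * M ≤ N) (1≤n : 1 ≤ n) where
  open Arcs G
  private
    R = N * r
    U = ∁ F
    N⁺ : Fin n → Subset n
    N⁺ = Arcs.N⁻ (op G)
  open Walks (Within _⟶_ U)
  open Lengths (Within _⟶_ U)
  open Path
  open Simplified
  open ≤-Reasoning

  fan : (C : Fin n → Subset n) → (∀ v → K ≤ ∣ C v ∣) → (γ : Fin N → Fin n) → Choice ⊤ (C ∘ γ) F r
  fan C K≤ γ = disjoint-choice ⊤ (C ∘ γ) F r λ {i} _ → card-room {p = C (γ i)} {F} (begin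
    ∣ F ∣ + r * ∣ ⊤ {N} ∣    ≡⟨ cong (λ x → ∣ F ∣ + r * x) (∣⊤∣≡n N) ⟩
    ∣ F ∣ + r * N            ≡⟨ cong (∣ F ∣ +_) (*-comm r N) ⟩
    ∣ F ∣ + R  ≤⟨ room ⟩
    K  ≤⟨ K≤ (γ i) ⟩
    ∣ C (γ i) ∣  ∎)

  module Fans (out : Choice ⊤ (N⁺ ∘ β) F r) (inn : Choice ⊤ (N⁻ ∘ α) F r) where

    Src Tgt : Subset n
    Src = union (part out)
    Tgt = union (part inn)

    big : ∀ {C : Fin N → Subset n} (ch : Choice ⊤ C F r) → R ≤ ∣ union (part ch) ∣
    big ch = card-union≥ (part ch) r (λ i → ≤-reflexive (sym (size ch (∈⊤ {x = i})))) (disjoint ch)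

    off-F : ∀ {C : Fin N → Subset n} {x} (ch : Choice ⊤ C F r) → x ∈ union (part ch) → x ∉ F
    off-F ch x∈ x∈F with ∈union⁻ (part ch) x∈
    ... | i , x∈i = avoids ch i x∈i x∈F

    linked : ∀ S → ∣ S ∣ < R → LinkedOutside Src Tgt S
    linked S lt with ∃∈∉ Src S (<-≤-trans lt (big out)) | ∃∈∉ Tgt S (<-≤-trans lt (big inn))
    ... | s , s∈ , s∉S | e , e∈ , e∉S = s , e , s∈ , e∈ , widen W⊆U p ,
        λ x∈ x∈S → x∈∁p⇒x∉p (widen-∈ W⊆U p (in-W out s∈ s∉S) x∈) (x∈p∪q⁺ (inj₂ x∈S))
      where
      W = ∁ (F ∪ S)
      W⊆U : W ⊆ U
      W⊆U x∈ = x∉p⇒x∈∁p (x∈∁p⇒x∉p x∈ ∘ x∈p∪q⁺ ∘ inj₁)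
      in-W : ∀ {C : Fin N → Subset n} {x} (ch : Choice ⊤ C F r) → x ∈ union (part ch) → x ∉ S → x ∈ W
      in-W ch x∈ x∉S = x∉p⇒x∈∁p ([ off-F ch x∈ , x∉S ]′ ∘ x∈p∪q⁻ F S)
      p = conn (F ∪ S) (begin-strict
        ∣ F ∪ S ∣        ≤⟨ ∣p∪q∣≤∣p∣+∣q∣ F S ⟩
        ∣ F ∣ + ∣ S ∣    <⟨ +-monoʳ-< ∣ F ∣ lt ⟩
        ∣ F ∣ + R        ≤⟨ room ⟩
        K  ∎) (in-W out s∈ s∉S) (in-W inn e∈ e∉S)

    module Pick (𝒫 : Linkage Src Tgt R) where
      open Linkage 𝒫

      simp : ∀ p → Simplified (trail (P p))
      simp p = simplify (trail (P p))

      PS : Fin R → Subset n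
      PS p = vset (walk (simp p))

      ∣PS∣-sum : sum (λ p → ∣ PS p ∣) ≤ n
      ∣PS∣-sum = begin
        sum (λ p → ∣ PS p ∣)  ≡⟨ double-counting on? ⟩
        sum (λ x → ∣ set (λ p → on? p x) ∣) ≤⟨ sum-bound _ 1 at-most-one ⟩
        n * 1  ≡⟨ *-identityʳ n ⟩
        n  ∎
        where
        on? : ∀ p x → Dec (x ∈ʷ walk (simp p))
        on? p x = x ∈ʷ? walk (simp p)
        at-most-one : ∀ x → ∣ set (λ p → on? p x) ∣ ≤ 1
        at-most-one x = card-injection (set (λ p → on? p x)) (⊤ {1}) (λ _ → zero) (λ _ → ∈⊤)
          λ p∈ q∈ _ → dis (sub (simp _) (∈set⁻ (λ p → on? p x) p∈)) (sub (simp _) (∈set⁻ (λ p → on? p x) q∈))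

      long? : ∀ p → Dec (2 * n < ∣ PS p ∣ * R)
      long? p = 2 * n <? ∣ PS p ∣ * R

      Long Good : Subset R
      Long = set long?
      Good = ∁ Long

      sum-scale : ∀ {m} (f : Fin m → ℕ) → sum (λ p → f p * R) ≡ sum f * R
      sum-scale {zero} f = refl
      sum-scale {suc m} f = trans (cong (f zero * R +_) (sum-scale (f ∘ suc))) (sym (*-distribʳ-+ R (f zero) _))

      2∣Long∣≤R : 2 * ∣ Long ∣ ≤ R
      2∣Long∣≤R = *-cancelˡ-≤ n {{>-nonZero 1≤n}} (begin
        n * (2 * ∣ Long ∣)            ≡⟨ sym (*-assoc n 2 _) ⟩
        n * 2 * ∣ Long ∣  ≤⟨ *-monoˡ-≤ ∣ Long ∣ (≤-trans (≤-reflexive (*-comm n 2)) (n≤1+n _)) ⟩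
        suc (2 * n) * ∣ Long ∣        ≤⟨ markov (λ p → ∣ PS p ∣ * R) (2 * n) ⟩
        sum (λ p → ∣ PS p ∣ * R)      ≡⟨ sum-scale (λ p → ∣ PS p ∣) ⟩
        sum (λ p → ∣ PS p ∣) * R      ≤⟨ *-monoˡ-≤ R ∣PS∣-sum ⟩
        n * R  ∎)

      R≤2∣Good∣ : R ≤ 2 * ∣ Good ∣
      R≤2∣Good∣ = +-cancelˡ-≤ R _ _ (begin
        R + R  ≡⟨ cong (R +_) (sym (+-identityʳ R)) ⟩
        2 * R  ≡⟨ cong (2 *_) (sym (∣⊤∣≡n R)) ⟩
        2 * ∣ ⊤ {R} ∣  ≤⟨ *-monoʳ-≤ 2 (card-cover {p = ⊤} {Long} {Good} λ {x} _ → either x) ⟩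
        2 * (∣ Long ∣ + ∣ Good ∣)           ≡⟨ *-distribˡ-+ 2 ∣ Long ∣ _ ⟩
        2 * ∣ Long ∣ + 2 * ∣ Good ∣         ≤⟨ +-monoˡ-≤ _ 2∣Long∣≤R ⟩
        R + 2 * ∣ Good ∣  ∎)
        where
        either : ∀ x → x ∈ Long ⊎ x ∈ Good
        either x with x ∈? Long
        ... | yes x∈ = inj₁ x∈
        ... | no x∉ = inj₂ (x∉p⇒x∈∁p x∉)

      bi ai : Fin R → Fin N
      bi p = proj₁ (∈union⁻ (part out) (s∈A p))
      ai p = proj₁ (∈union⁻ (part inn) (e∈B p))

      src∈ : ∀ p → src (P p) ∈ part out (bi p)
      src∈ p = proj₂ (∈union⁻ (part out) (s∈A p))

      tgt∈ : ∀ p → tgt (P p) ∈ part inn (ai p)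
      tgt∈ p = proj₂ (∈union⁻ (part inn) (e∈B p))

      clash? : ∀ p q → Dec (bi p ≡ bi q ⊎ ai p ≡ ai q)
      clash? p q = bi p ≟ bi q ⊎-dec ai p ≟ ai q

      Clash : Fin R → Subset R
      Clash p = set (clash? p)

      -- Disjoint walks that share a fan use different vertices of it, and a fan has `r` vertices.
      ∣Clash∣ : ∀ p → ∣ Clash p ∣ ≤ r + r
      ∣Clash∣ p = begin
        ∣ Clash p ∣  ≤⟨ card-cover {q = set same-b?} {set same-a?}
                                      (λ {q} q∈ → [ inj₁ ∘ ∈set⁺ same-b? {q} , inj₂ ∘ ∈set⁺ same-a? {q} ]′ (∈set⁻ (clash? p) q∈)) ⟩
        ∣ set same-b? ∣ + ∣ set same-a? ∣
          ≤⟨ +-mono-≤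
               (card-injection (set same-b?) (part out (bi p)) (src ∘ P)
                 (λ {q} q∈ → subst (λ i → src (P q) ∈ part out i) (sym (∈set⁻ same-b? q∈)) (src∈ q))
                 (λ {q} {q′} _ _ eq → dis here (subst (_∈ʷ trail (P q′)) (sym eq) here)))
               (card-injection (set same-a?) (part inn (ai p)) (tgt ∘ P)
                 (λ {q} q∈ → subst (λ i → tgt (P q) ∈ part inn i) (sym (∈set⁻ same-a? q∈)) (tgt∈ q))
                 (λ {q} {q′} _ _ eq → dis (end∈ (trail (P q))) (subst (_∈ʷ trail (P q′)) (sym eq) (end∈ (trail (P q′)))))) ⟩
        ∣ part out (bi p) ∣ + ∣ part inn (ai p) ∣  ≡⟨ cong₂ _+_ (size out (∈⊤ {x = bi p})) (size inn (∈⊤ {x = ai p})) ⟩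
        r + r  ∎
        where
        same-b? : ∀ q → Dec (bi p ≡ bi q)
        same-b? q = bi p ≟ bi q
        same-a? : ∀ q → Dec (ai p ≡ ai q)
        same-a? q = ai p ≟ ai q

      -- At least half of the `N * r` walks are short and each pick excludes at most `2 * r` of
      -- them, which asks for `4 * M ≤ N`.
      enough : M * (r + r) ≤ ∣ Good ∣
      enough = *-cancelˡ-≤ 2 (begin
        2 * (M * (r + r))     ≡⟨ arith M r ⟩
        4 * M * r             ≤⟨ *-monoˡ-≤ r 4M≤N ⟩
        R  ≤⟨ R≤2∣Good∣ ⟩
        2 * ∣ Good ∣          ∎)
        where
        arith : ∀ M r → 2 * (M * (r + r)) ≡ 4 * M * r
        arith = solve-∀

      module Chosen (f : Fin M → Fin R) (f-good : ∀ q → f q ∈ Good)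
        (f-indep : ∀ {p q} → f p ∈ Clash (f q) → p ≡ q) where

        f-inj : ∀ {p q} → bi (f p) ≡ bi (f q) ⊎ ai (f p) ≡ ai (f q) → p ≡ q
        f-inj {p} {q} eq = f-indep (∈set⁺ (clash? (f q)) ([ inj₁ ∘ sym , inj₂ ∘ sym ]′ eq))

        chosen : System _⟶_ α β U M R
        chosen = record
          { P = λ q → path (walk (simp (f q))) ; ai = ai ∘ f ; bi = bi ∘ f
          ; ai-inj = f-inj ∘ inj₂ ; bi-inj = f-inj ∘ inj₁
          ; enter = λ q → ∈set⁻ (β (bi (f q)) ⟶?_) (⊆C out _ (src∈ (f q)))
          ; exit = λ q → ∈set⁻ (_⟶? α (ai (f q))) (⊆C inn _ (tgt∈ (f q)))
          ; inU = λ q → Within-∈ (walk (simp (f q))) (x∉p⇒x∈∁p (off-F out (s∈A (f q))))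
          ; dis = λ {p} {q} x∈ x∈′ → f-inj (inj₁ (cong bi (dis (sub (simp (f p)) x∈) (sub (simp (f q)) x∈′))))
          ; short = λ q → ≤-trans
              (*-monoˡ-≤ R (simple-len (walk (simp (f q))) (simple (simp (f q)))))
              (≮⇒≥ λ lt → x∈∁p⇒x∉p (f-good q) (∈set⁺ long? lt)) }

      system : System _⟶_ α β U M R
      system = case select-independent Good Clash (λ p → ∈set⁺ (clash? p) (inj₁ refl))
        (λ {p} {q} p∈ → ∈set⁺ (clash? p) ([ inj₁ ∘ sym , inj₂ ∘ sym ]′ (∈set⁻ (clash? q) p∈)))
        (≤-trans 1≤r (m≤m+n r r)) (λ {p} _ → ∣Clash∣ p) M enough
        of λ (f , f-good , f-indep) → Chosen.chosen f f-good f-indep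

    initial : System _⟶_ α β U M R
    initial = Pick.system (Menger.menger (Within _⟶_ U) Src R linked)

  abstract
    tight-system : Σ[ sys ∈ System _⟶_ α β U M R ] System.Tight sys × System.Tight (op-system sys)
    tight-system = settle _⟶?_ sys₀ (<-wellFounded _)
      where
      sys₀ : System _⟶_ α β U M R
      sys₀ = Fans.initial (fan N⁺ K≤⁺ β) (fan N⁻ K≤⁻ α)

-- Selection of paths

∣union∣≤sum : (f : Fin a → Subset n) → ∣ union f ∣ ≤ sum (λ i → ∣ f i ∣)
∣union∣≤sum {zero} f = ≤-trans (≤-reflexive (sym (*-identityˡ _))) (union-bound f 1 0 λ ())
∣union∣≤sum {suc a} f = ≤-trans (card-cover {q = f zero} {union (f ∘ suc)} (cover ∘ ∈union⁻ f))
  (+-monoʳ-≤ ∣ f zero ∣ (∣union∣≤sum (f ∘ suc)))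
  where
  cover : ∀ {x} → (∃[ i ] x ∈ f i) → x ∈ f zero ⊎ x ∈ union (f ∘ suc)
  cover (zero , x∈) = inj₁ x∈
  cover (suc i , x∈) = inj₂ (∈union⁺ (f ∘ suc) i x∈)

sum-support : (f : Fin n → ℕ) (S : Subset n) (b : ℕ) →
  (∀ {v} → v ∈ S → f v ≤ b) → (∀ {v} → v ∉ S → f v ≡ 0) → sum f ≤ b * ∣ S ∣
sum-support f [] b _ _ = z≤n
sum-support f (true ∷ S) b le off = ≤-trans
  (+-mono-≤ (le here) (sum-support (f ∘ suc) S b (le ∘ there) (λ v∉ → off λ { (there v∈) → v∉ v∈ })))
  (≤-reflexive (sym (*-suc b ∣ S ∣)))
sum-support f (false ∷ S) b le off rewrite off {zero} (λ ()) =
  sum-support (f ∘ suc) S b (le ∘ there) (λ v∉ → off λ { (there v∈) → v∉ v∈ })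

card-empty : {S : Subset n} → (∀ {x} → x ∉ S) → ∣ S ∣ ≡ 0
card-empty {n} {S} none = n≤0⇒n≡0 (≤-trans (p⊆q⇒∣p∣≤∣q∣ {q = ∅} λ x∈ → contradiction x∈ none)
  (≤-reflexive (∣⊥∣≡0 n)))

-- Each q conflicts with the other claims of the vertices of X that claim q. On
-- average q is claimed at most 12 times; those claimed at most 24 times are kept.

module Selection {n M : ℕ} {Claim : Fin n → Fin M → Set} (claim? : ∀ v q → Dec (Claim v q))
  (X : Subset n) (∣X∣ : ∣ X ∣ ≤ 4 * M) (∣claims∣ : ∀ {v} → v ∈ X → ∣ set (claim? v) ∣ ≤ 3) where
  open ≤-Reasoning

  by? : ∀ q v → Dec (v ∈ X × Claim v q)
  by? q v = v ∈? X ×-dec claim? v q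

  load : Fin M → ℕ
  load q = ∣ set (by? q) ∣

  total-load : sum load ≤ 12 * M
  total-load = begin
    sum load  ≡⟨ double-counting by? ⟩
    sum (λ v → ∣ set (λ q → by? q v) ∣)   ≤⟨ sum-support (λ v → ∣ set (λ q → by? q v) ∣) X 3
      (λ {v} v∈ → ≤-trans (p⊆q⇒∣p∣≤∣q∣ λ {q} q∈ → ∈set⁺ (claim? v) (proj₂ (∈set⁻ (λ q → by? q v) q∈))) (∣claims∣ v∈))
      (λ {v} v∉ → card-empty λ q∈ → v∉ (proj₁ (∈set⁻ (λ q → by? q v) q∈))) ⟩
    3 * ∣ X ∣  ≤⟨ *-monoʳ-≤ 3 ∣X∣ ⟩
    3 * (4 * M)  ≡⟨ sym (*-assoc 3 4 M) ⟩
    12 * M  ∎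

  heavy? : ∀ q → Dec (24 < load q)
  heavy? q = 24 <? load q

  Heavy Light : Subset M
  Heavy = set heavy?
  Light = ∁ Heavy

  2∣Heavy∣≤M : 2 * ∣ Heavy ∣ ≤ M
  2∣Heavy∣≤M = *-cancelˡ-≤ 12 (begin
    12 * (2 * ∣ Heavy ∣)    ≡⟨ sym (*-assoc 12 2 ∣ Heavy ∣) ⟩
    24 * ∣ Heavy ∣          ≤⟨ *-monoˡ-≤ ∣ Heavy ∣ (n≤1+n 24) ⟩
    25 * ∣ Heavy ∣          ≤⟨ markov load 24 ⟩
    sum load  ≤⟨ total-load ⟩
    12 * M  ∎)

  M≤2∣Light∣ : M ≤ 2 * ∣ Light ∣
  M≤2∣Light∣ = +-cancelˡ-≤ M _ _ (begin
    M + M  ≡⟨ cong (M +_) (sym (+-identityʳ M)) ⟩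
    2 * M  ≡⟨ cong (2 *_) (sym (∣⊤∣≡n M)) ⟩
    2 * ∣ ⊤ {M} ∣  ≤⟨ *-monoʳ-≤ 2 (card-cover {p = ⊤} {Heavy} {Light} λ {x} _ → either x) ⟩
    2 * (∣ Heavy ∣ + ∣ Light ∣)         ≡⟨ *-distribˡ-+ 2 ∣ Heavy ∣ _ ⟩
    2 * ∣ Heavy ∣ + 2 * ∣ Light ∣       ≤⟨ +-monoˡ-≤ _ 2∣Heavy∣≤M ⟩
    M + 2 * ∣ Light ∣  ∎)
    where
    either : ∀ x → x ∈ Heavy ⊎ x ∈ Light
    either x with x ∈? Heavy
    ... | yes x∈ = inj₁ x∈
    ... | no x∉ = inj₂ (x∉p⇒x∈∁p x∉)

  clash? : ∀ p q → Dec (p ≡ q ⊎ ∃[ v ] v ∈ X × Claim v p × Claim v q)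
  clash? p q = p ≟ q ⊎-dec any? λ v → v ∈? X ×-dec (claim? v p ×-dec claim? v q)

  Clash : Fin M → Subset M
  Clash p = set (clash? p)

  -- `73 = 1 + 24 * 3`: the index `p` itself, and the at most 3 claims of each of the at most 24
  -- vertices that claim `p`.
  ∣Clash∣ : ∀ {p} → p ∈ Light → ∣ Clash p ∣ ≤ 73
  ∣Clash∣ {p} p∈ = begin
    ∣ Clash p ∣  ≤⟨ card-cover {p = Clash p} {⁅ p ⁆} {union through} cover ⟩
    ∣ ⁅ p ⁆ ∣ + ∣ union through ∣  ≤⟨ +-mono-≤ (≤-reflexive (∣⁅x⁆∣≡1 p)) (∣union∣≤sum through) ⟩
    1 + sum (λ v → ∣ through v ∣)  ≤⟨ +-monoʳ-≤ 1 (sum-support (λ v → ∣ through v ∣) (set (by? p)) 3 few none) ⟩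
    1 + 3 * load p  ≤⟨ +-monoʳ-≤ 1 (*-monoʳ-≤ 3 (≮⇒≥ λ lt → x∈∁p⇒x∉p p∈ (∈set⁺ heavy? lt))) ⟩
    73  ∎
    where
    through? : ∀ v q → Dec ((v ∈ X × Claim v p) × Claim v q)
    through? v q = by? p v ×-dec claim? v q
    through : Fin n → Subset M
    through v = set (through? v)
    few : ∀ {v} → v ∈ set (by? p) → ∣ through v ∣ ≤ 3
    few {v} v∈ = ≤-trans (p⊆q⇒∣p∣≤∣q∣ λ q∈ → ∈set⁺ (claim? v) (proj₂ (∈set⁻ (through? v) q∈)))
      (∣claims∣ (proj₁ (∈set⁻ (by? p) v∈)))
    none : ∀ {v} → v ∉ set (by? p) → ∣ through v ∣ ≡ 0
    none {v} v∉ = card-empty λ q∈ → v∉ (∈set⁺ (by? p) (proj₁ (∈set⁻ (through? v) q∈)))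
    cover : ∀ {q} → q ∈ Clash p → q ∈ ⁅ p ⁆ ⊎ q ∈ union through
    cover q∈ with ∈set⁻ (clash? p) q∈
    ... | inj₁ refl = inj₁ (x∈⁅x⁆ p)
    ... | inj₂ (v , v∈ , vp , vq) = inj₂ (∈union⁺ through v (∈set⁺ (through? v) ((v∈ , vp) , vq)))

  -- `146 = 2 * 73`: at least half of the indices are light, and each selected one excludes at most
  -- 73.
  select : ∀ r → r * 146 ≤ M → Σ[ f ∈ (Fin r → Fin M) ]
    (∀ {x y} → f x ≡ f y → x ≡ y) × (∀ {v x y} → v ∈ X → Claim v (f x) → Claim v (f y) → x ≡ y)
  select r room = f ,
    (λ {x} {y} eq → indep (∈set⁺ (clash? (f y)) (inj₁ (sym eq)))) ,
    (λ {v} {x} {y} v∈ c c′ → indep (∈set⁺ (clash? (f y)) (inj₂ (v , v∈ , c′ , c))))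
    where
    swap-factors : ∀ x y → 2 * (x * y) ≡ x * (2 * y)
    swap-factors = solve-∀
    enough : r * 73 ≤ ∣ Light ∣
    enough = *-cancelˡ-≤ 2 (≤-trans (≤-reflexive (swap-factors r 73)) (≤-trans room M≤2∣Light∣))
    clash-sym : ∀ {p q} → p ∈ Clash q → q ∈ Clash p
    clash-sym {p} {q} p∈ = ∈set⁺ (clash? p)
      ([ inj₁ ∘ sym , (λ (v , v∈ , c , c′) → inj₂ (v , v∈ , c′ , c)) ]′ (∈set⁻ (clash? q) p∈))
    selected = select-independent {b = 73} Light Clash (λ p → ∈set⁺ (clash? p) (inj₁ refl)) clash-sym
      (s≤s z≤n) ∣Clash∣ r enough
    f = proj₁ selected
    indep : ∀ {i j} → f i ∈ Clash (f j) → i ≡ j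
    indep = proj₂ (proj₂ selected)
-- From here on walks are vertex sets with a guaranteed passage. `Ext` holds the first two and last
-- two vertices of every walk, about which tightness says nothing.
record Routing {G : Arcs n} {N c : ℕ} (bl : Blocks G N c) (F : Subset n) (M R : ℕ) : Set where
  open Arcs G
  open Blocks bl using (α; β)
  field
    PS     : Fin M → Subset n
    Ext    : Subset n
    ai bi  : Fin M → Fin N
    ai-inj : ∀ {p q} → ai p ≡ ai q → p ≡ q
    bi-inj : ∀ {p q} → bi p ≡ bi q → p ≡ q
    PS#F   : ∀ q → Disjoint (PS q) F
    PS-dis : ∀ {p q x} → x ∈ PS p → x ∈ PS q → p ≡ q
    ∣PS∣   : ∀ q → ∣ PS q ∣ * R ≤ 2 * n
    Ext⊆   : ∀ {v} → v ∈ Ext → ∃[ q ] v ∈ PS q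
    ∣Ext∣  : ∣ Ext ∣ ≤ 4 * M
    route  : ∀ q {W} → β (bi q) ∈ W → α (ai q) ∈ W → PS q ⊆ W →
             Star (Within _⟶_ W) (β (bi q)) (α (ai q))
    tight⁻ : ∀ {q x v i} → x ∈ PS q → x ∉ Ext → v ∉ F → v ∉ Ext → (∀ q → ai q ≢ i) →
             x ⟶ v → ¬ (v ⟶ α i)
    tight⁺ : ∀ {q x v i} → x ∈ PS q → x ∉ Ext → v ∉ F → v ∉ Ext → (∀ q → bi q ≢ i) →
             v ⟶ x → ¬ (β i ⟶ v)

routing : {G : Arcs n} {N c : ℕ} (bl : Blocks G N c) {F : Subset n} {M R : ℕ} →
  let open Arcs G ; open Blocks bl using (α; β) in
  (sys : System _⟶_ α β (∁ F) M R) → System.Tight sys → System.Tight (op-system sys) → Routing bl F M R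
routing {n} {G} bl {F} {M} {R} sys tight tightᵒ = record
  { PS = PS ; Ext = Ext ; ai = ai ; bi = bi ; ai-inj = ai-inj ; bi-inj = bi-inj
  ; PS#F = λ q x∈ → x∈∁p⇒x∉p (inU q (on x∈)) ; PS-dis = λ x∈ x∈′ → dis (on x∈) (on x∈′)
  ; ∣PS∣ = λ q → ≤-trans (*-monoˡ-≤ R (∣vset∣≤ (trail (P q)))) (short q)
  ; Ext⊆ = λ v∈ → case ∈union⁻ ends v∈ of λ (q , v∈q) → q , ends⊆ q v∈q
  ; ∣Ext∣ = ∣Ext∣
  ; route = route
  ; tight⁻ = λ x∈ x∉ v∉F v∉Ext surplus x⟶v v⟶α → case any? (λ q → _ ∈ʷ? trail (P q)) of λ
      { (yes (q , v∈)) → tight q v∈ (not-last v∉Ext) (_ , surplus , inj₁ v⟶α)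
      ; (no off) → tight _ (on x∈) (not-last x∉)
          (_ , surplus , inj₂ (_ , x∉p⇒x∈∁p v∉F , (λ q v∈ → off (q , v∈)) , x⟶v , v⟶α)) }
  ; tight⁺ = λ x∈ x∉ v∉F v∉Ext surplus v⟶x β⟶v → case any? (λ q → _ ∈ʷ? trail (P q)) of λ
      { (yes (q , v∈)) → tightᵒ q (rev⁺ (trail (P q)) v∈) (not-first v∉Ext) (_ , surplus , inj₁ β⟶v)
      ; (no off) → tightᵒ _ (rev⁺ (trail (P _)) (on x∈)) (not-first x∉)
          (_ , surplus , inj₂ (_ , x∉p⇒x∈∁p v∉F , (λ q v∈ → off (q , rev⁻ (trail (P q)) v∈)) , v⟶x , β⟶v)) } }
  where
  open Arcs G
  open Blocks bl using (α; β)
  U = ∁ F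
  open System sys
  open Walks (Within _⟶_ U)
  open Path
  open Lengths (Within _⟶_ U)
  open Reversal _⟶_ U
  module Lᵒ = Lengths (Within (flip _⟶_) U)
  open ≤-Reasoning
  PS : Fin M → Subset n
  PS q = vset (trail (P q))
  on : ∀ {q x} → x ∈ PS q → x ∈ʷ trail (P q)
  on {q} = ∈set⁻ (_∈ʷ? trail (P q))
  ends : Fin M → Subset n
  ends q = last-two (trail (P q)) ∪ Lᵒ.last-two (rev (trail (P q)))
  Ext = union ends
  ends⊆ : ∀ q {v} → v ∈ ends q → v ∈ PS q
  ends⊆ q v∈ = ∈set⁺ (_∈ʷ? trail (P q)) ([ last-two⊆ (trail (P q))
    , (λ v∈′ → rev⁻ (trail (P q)) (Lᵒ.last-two⊆ (rev (trail (P q))) v∈′)) ]′ (x∈p∪q⁻ (last-two (trail (P q))) _ v∈))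
  not-last : ∀ {q v} → v ∉ Ext → v ∉ last-two (trail (P q))
  not-last {q} v∉ v∈ = v∉ (∈union⁺ ends q (x∈p∪q⁺ (inj₁ v∈)))
  not-first : ∀ {q v} → v ∉ Ext → v ∉ Lᵒ.last-two (rev (trail (P q)))
  not-first {q} v∉ v∈ = v∉ (∈union⁺ ends q (x∈p∪q⁺ {p = last-two (trail (P q))} (inj₂ v∈)))
  ∣Ext∣ : ∣ Ext ∣ ≤ 4 * M
  ∣Ext∣ = begin
    ∣ Ext ∣      ≡⟨ sym (*-identityˡ _) ⟩
    1 * ∣ Ext ∣  ≤⟨ union-bound ends 1 4 (λ q → begin
      1 * ∣ ends q ∣   ≡⟨ *-identityˡ _ ⟩
      ∣ ends q ∣       ≤⟨ ∣p∪q∣≤∣p∣+∣q∣ (last-two (trail (P q))) _ ⟩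
      _  ≤⟨ +-mono-≤ (∣last-two∣ (trail (P q))) (Lᵒ.∣last-two∣ (rev (trail (P q)))) ⟩
      4  ∎) ⟩
    M * 4        ≡⟨ *-comm M 4 ⟩
    4 * M        ∎
  into : ∀ {W s e} (p : Star (Within _⟶_ U) s e) → (∀ {x} → x ∈ʷ p → x ∈ W) → Star (Within _⟶_ W) s e
  into ε _ = ε
  into ((_ , _ , arc) ◅ p) ⊆W = (⊆W here , ⊆W (there here) , arc) ◅ into p (⊆W ∘ there)
  route : ∀ q {W} → β (bi q) ∈ W → α (ai q) ∈ W → PS q ⊆ W → Star (Within _⟶_ W) (β (bi q)) (α (ai q))
  route q {W} b∈ a∈ ⊆W = (b∈ , on-W here , enter q) ◅
    into (trail (P q)) on-W ◅◅ (on-W (end∈ (trail (P q))) , a∈ , exit q) ◅ ε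
    where
    on-W : ∀ {x} → x ∈ʷ trail (P q) → x ∈ W
    on-W x∈ = ⊆W (∈set⁺ (_∈ʷ? trail (P q)) x∈)

-- Colouring

module _ {t : ℕ} (D : Subset n) (own : Fin n → Fin t) (Q : Subset n) (C : Fin n → Subset n) (k : ℕ) where

  -- Unlike in `Growth`, a client gets `k` new neighbours in every class, since it may stay outside
  -- all classes and then belong to any `R`.
  record FullGrowth : Set where
    field
      D′     : Subset n
      own′   : Fin n → Fin t
      D⊆D′   : D ⊆ D′
      keeps  : ∀ {w} → w ∈ D → own′ w ≡ own w
      ∣new∣  : ∣ D′ ─ D ∣ ≤ k * t * ∣ Q ∣
      fresh  : ∀ {v} → v ∈ Q → ∀ j → ∃[ P ] ∣ P ∣ ≡ k ×
                 (∀ {w} → w ∈ P → w ∈ C v × w ∉ D × w ∈ D′ × own′ w ≡ j)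

  abstract
    grow-fully : (∀ {v} → v ∈ Q → k * t * ∣ Q ∣ ≤ ∣ C v ─ D ∣) → FullGrowth
    grow-fully enough = record
      { D′ = D ∪ union (part ch) ; own′ = λ w → recolour w (source? w)
      ; D⊆D′ = x∈p∪q⁺ ∘ inj₁
      ; keeps = λ {w} w∈ → kept w∈ (source? w)
      ; ∣new∣ = ≤-trans (p⊆q⇒∣p∣≤∣q∣ λ x∈ → case x∈p─q⁻ (D ∪ union (part ch)) D x∈ of λ (x∈′ , x∉) →
          [ (λ x∈D → contradiction x∈D x∉) , id ]′ (x∈p∪q⁻ D _ x∈′)) (total ch)
      ; fresh = λ {v} v∈ j → piece v j , ∣piece∣ v∈ (v ∈? Q) j , λ {w} w∈ →
          let w∈v = piece⊆ (v ∈? Q) w∈ in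
          ⊆C ch v w∈v , avoids ch v w∈v , x∈p∪q⁺ (inj₂ (∈union⁺ (part ch) v w∈v)) , coloured {v} {j} w∈ (source? w) }
      where
      ch : Choice Q C D (k * t)
      ch = disjoint-choice Q C D (k * t) enough
      -- The `k * t` reserved vertices are divided among the classes by the same greedy choice, now
      -- with equal candidate sets.
      cut : ∀ {v} → v ∈ Q → Choice (⊤ {t}) (λ _ → part ch v) ∅ k
      cut {v} v∈ = disjoint-choice ⊤ (λ _ → part ch v) ∅ k λ _ → card-room {p = part ch v} {∅}
        (≤-reflexive (trans (cong₂ _+_ (∣⊥∣≡0 n) (cong (k *_) (∣⊤∣≡n t))) (sym (size ch v∈))))
      piece-by : ∀ {v} → Dec (v ∈ Q) → Fin t → Subset n
      piece-by (yes v∈) = part (cut v∈)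
      piece-by (no _) _ = ∅
      piece : Fin n → Fin t → Subset n
      piece v = piece-by (v ∈? Q)
      ∣piece∣ : ∀ {v} → v ∈ Q → (d : Dec (v ∈ Q)) → ∀ j → ∣ piece-by d j ∣ ≡ k
      ∣piece∣ _ (yes v∈) j = size (cut v∈) (∈⊤ {x = j})
      ∣piece∣ v∈ (no v∉) j = contradiction v∈ v∉
      piece⊆ : ∀ {v j w} (d : Dec (v ∈ Q)) → w ∈ piece-by d j → w ∈ part ch v
      piece⊆ {j = j} (yes v∈) w∈ = ⊆C (cut v∈) j w∈
      piece⊆ (no _) w∈ = contradiction w∈ ∉⊥
      piece-dis : ∀ {v i j w} (d : Dec (v ∈ Q)) → w ∈ piece-by d i → w ∈ piece-by d j → i ≡ j
      piece-dis (yes v∈) = disjoint (cut v∈)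
      piece-dis (no _) w∈ = contradiction w∈ ∉⊥
      source? : ∀ w → Dec (∃[ v ] ∃[ j ] w ∈ piece v j)
      source? w = any? λ v → any? λ j → w ∈? piece v j
      recolour : ∀ w → Dec (∃[ v ] ∃[ j ] w ∈ piece v j) → Fin t
      recolour w (yes (_ , j , _)) = j
      recolour w (no _) = own w
      kept : ∀ {w} → w ∈ D → (d : Dec (∃[ v ] ∃[ j ] w ∈ piece v j)) → recolour w d ≡ own w
      kept w∈ (yes (v , j , w∈v)) = contradiction w∈ (avoids ch v (piece⊆ (v ∈? Q) w∈v))
      kept w∈ (no _) = refl
      coloured : ∀ {v j w} → w ∈ piece v j → (d : Dec (∃[ v ] ∃[ j ] w ∈ piece v j)) → recolour w d ≡ j
      coloured {v} w∈ (yes (v′ , _ , w∈′))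
        with refl ← disjoint ch (piece⊆ (v ∈? Q) w∈) (piece⊆ (v′ ∈? Q) w∈′) = piece-dis (v ∈? Q) w∈′ w∈
      coloured {v} {j} w∈ (no none) = contradiction (v , j , w∈) none

-- Induction on the service: one of `k` servers survives and is itself reachable, down to a vertex
-- that receives an arc from the undamaged block `A`.
reach : (G : Arcs n) {k : ℕ} {Base Ok : Fin n → Set} {S W A : Subset n} {top : Fin n} → let open Arcs G in
  ∣ S ∣ < k → (∀ {w} → Ok w → w ∉ S → w ∈ W) →
  A ⊆ W → top ∈ A → (∀ {u} → u ∈ A → u ≢ top → top ⟶ u) →
  (∀ {v} → Base v → ∃[ u ] u ∈ A × u ⟶ v) →
  ∀ {v} → Served G k Base Ok v → v ∈ W → Star (Inside W) top v
reach G {A = A} {top} S<k ok A⊆W top∈ top⟶ dom (base b) v∈ with dom b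
... | u , u∈ , u⟶v with u ≟ top
... | yes refl = (A⊆W u∈ , v∈ , u⟶v) ◅ ε
... | no u≢ = (A⊆W top∈ , A⊆W u∈ , top⟶ u∈ u≢) ◅ (A⊆W u∈ , v∈ , u⟶v) ◅ ε
reach G {S = S} S<k ok A⊆W top∈ top⟶ dom (more Q k≤ ws) v∈ with ∃∈∉ Q S (<-≤-trans S<k k≤)
... | w , w∈Q , w∉S with ws w∈Q
... | w⟶v , ok-w , served-w = reach G S<k ok A⊆W top∈ top⟶ dom served-w w∈W ◅◅ (w∈W , v∈ , w⟶v) ◅ ε
  where w∈W = ok ok-w w∉S

module Serve {G : Arcs n} {N c : ℕ} (bl : Blocks G N c) (k : ℕ) {F Ext D : Subset n} {Ok : Fin n → Set} where
  open Arcs G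
  open Blocks bl using (F₀; Ex; Dominated; dominated)

  -- Service is well-founded: vertices of `Ext` rely on generic ones, these on the surplus tops `D`
  -- or on dominated vertices, and the tops on their pods. If no arc leads from `v` into `D`, then
  -- `connex` makes all of `D` in-neighbours of `v`.
  serve :
    F₀ ⊆ F → (∀ {v} → v ∈ F → Ok v → Served G k Dominated Ok v) →
    k ≤ ∣ D ∣ → (∀ {w} → w ∈ D → w ∈ F × Ok w) →
    (∀ {v w} → v ∉ F → v ∉ Ext → v ∈ Ex → w ∈ D → v ⟶ w →
      ∃[ Q ] k ≤ ∣ Q ∣ × (∀ {w} → w ∈ Q → w ⟶ v × Ok w × w ∉ F × w ∉ Ex)) →
    (∀ {v} → v ∈ Ext → Ok v → ∃[ Q ] k ≤ ∣ Q ∣ × (∀ {w} → w ∈ Q → w ⟶ v × Ok w × w ∉ F × w ∉ Ext)) →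
    ∀ {v} → (v ∈ F → Ok v) → (v ∈ Ext → Ok v) → Served G k Dominated Ok v
  serve F₀⊆F pod k≤D D⊆ request ext {v} F⇒Ok Ext⇒Ok = cases (v ∈? F) (v ∈? Ext)
    where
    generic : ∀ {v} → v ∉ F → v ∉ Ext → Served G k Dominated Ok v
    generic {v} v∉F v∉Ext with v ∈? Ex
    ... | no v∉Ex = base (dominated (v∉F ∘ F₀⊆F) v∉Ex)
    ... | yes v∈Ex with any? (λ w → w ∈? D ×-dec v ⟶? w)
    ... | yes (w , w∈ , v⟶w) with request v∉F v∉Ext v∈Ex w∈ v⟶w
    ... | Q , k≤ , ws = more Q k≤ λ w∈ → let w⟶v , ok , w∉F , w∉Ex = ws w∈ in
      w⟶v , ok , base (dominated (w∉F ∘ F₀⊆F) w∉Ex)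
    generic {v} v∉F v∉Ext | yes v∈Ex | no none = more D k≤D λ {w} w∈ → let w∈F , ok = D⊆ w∈ in
      [ id , (λ v⟶w → contradiction (w , w∈ , v⟶w) none) ]′ (connex λ { refl → v∉F w∈F }) ,
      ok , pod w∈F ok
    cases : Dec (v ∈ F) → Dec (v ∈ Ext) → Served G k Dominated Ok v
    cases (yes v∈F) _ = pod v∈F (F⇒Ok v∈F)
    cases (no v∉F) (no v∉Ext) = generic v∉F v∉Ext
    cases (no _) (yes v∈Ext) with ext v∈Ext (Ext⇒Ok v∈Ext)
    ... | Q , k≤ , ws = more Q k≤ λ w∈ → let w⟶v , ok , w∉F , w∉Ext = ws w∈ in
      w⟶v , ok , generic w∉F w∉Ext

-- If P h were not selected, all of C ∩ P h would lie off the selected sets.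

hogged-or-free : ∀ {M r} (P : Fin M → Subset n) → (∀ {p q x} → x ∈ P p → x ∈ P q → p ≡ q) →
  (I : Fin r → Fin M) (C : Subset n) (h : Fin M) → (∀ q → ∣ C ∩ P q ∣ ≤ ∣ C ∩ P h ∣) →
  ∀ θ → suc r * θ ≤ ∣ C ∣ →
  θ ≤ ∣ C ─ union (P ∘ I) ∣ ⊎ ∃[ x ] h ≡ I x × θ ≤ ∣ C ∩ P h ∣
hogged-or-free {n} {M} {r} P P-dis I C h h-max zero _ = inj₁ z≤n
hogged-or-free {n} {M} {r} P P-dis I C h h-max θ@(suc θ′) large with θ ≤? ∣ C ─ union (P ∘ I) ∣
... | yes free = inj₁ free
... | no ¬free with any? (λ x → θ ≤? ∣ C ∩ P (I x) ∣)
-- If all `r` selected sets and the free part met `C` in fewer than `θ` vertices, then `C` would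
-- have fewer than `suc r * θ`.
... | no none = contradiction large (<⇒≱ (begin-strict
  ∣ C ∣  ≤⟨ card-cover {p = C} {C ─ union (P ∘ I)} {union met} cover ⟩
  ∣ C ─ union (P ∘ I) ∣ + ∣ union met ∣        <⟨ +-mono-<-≤ (≰⇒> ¬free) (begin
    ∣ union met ∣  ≡⟨ sym (*-identityˡ _) ⟩
    1 * ∣ union met ∣  ≤⟨ union-bound met 1 θ (λ x → ≤-trans (≤-reflexive (*-identityˡ _))
                                                     (<⇒≤ (≰⇒> λ le → none (x , le)))) ⟩
    r * θ  ∎) ⟩
  θ + r * θ  ∎))
  where
  open ≤-Reasoning
  met : Fin r → Subset n
  met x = C ∩ P (I x)
  cover : ∀ {v} → v ∈ C → v ∈ C ─ union (P ∘ I) ⊎ v ∈ union met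
  cover {v} v∈ with v ∈? union (P ∘ I)
  ... | no v∉ = inj₁ (x∈p∧x∉q⇒x∈p─q v∈ v∉)
  ... | yes v∈I with ∈union⁻ (P ∘ I) v∈I
  ... | x , v∈x = inj₂ (∈union⁺ met x (x∈p∩q⁺ (v∈ , v∈x)))
... | yes (x , le) with any? (λ y → h ≟ I y)
... | yes (y , eq) = inj₂ (y , eq , ≤-trans le (h-max (I x)))
... | no none = contradiction (≤-trans (≤-trans le (h-max (I x))) (p⊆q⇒∣p∣≤∣q∣ λ v∈ →
    let v∈C , v∈h = x∈p∩q⁻ C (P h) v∈ in
    x∈p∧x∉q⇒x∈p─q v∈C λ v∈I → case ∈union⁻ (P ∘ I) v∈I of λ (y , v∈y) → none (y , P-dis v∈h v∈y))) ¬free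

room-after : {X D D′ : Subset n} {x : ℕ} → ∣ D′ ─ D ∣ + x ≤ ∣ X ─ D ∣ → x ≤ ∣ X ─ D′ ∣
room-after {X = X} {D} {D′} le = ≤-trans (card-room {p = X ─ D} {D′ ─ D} le) (p⊆q⇒∣p∣≤∣q∣ λ x∈ →
  let x∈XD , x∉ = x∈p─q⁻ (X ─ D) (D′ ─ D) x∈
      x∈X , x∉D = x∈p─q⁻ X D x∈XD
  in x∈p∧x∉q⇒x∈p─q x∈X λ x∈D′ → x∉ (x∈p∧x∉q⇒x∈p─q x∈D′ x∉D))

∣─∣-trans : (D D′ D″ : Subset n) → ∣ D″ ─ D ∣ ≤ ∣ D′ ─ D ∣ + ∣ D″ ─ D′ ∣
∣─∣-trans D D′ D″ = card-cover {p = D″ ─ D} {D′ ─ D} {D″ ─ D′} cover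
  where
  cover : ∀ {x} → x ∈ D″ ─ D → x ∈ D′ ─ D ⊎ x ∈ D″ ─ D′
  cover {x} x∈ with x∈p─q⁻ D″ D x∈ | x ∈? D′
  ... | x∈D″ , x∉D | yes x∈D′ = inj₁ (x∈p∧x∉q⇒x∈p─q x∈D′ x∉D)
  ... | x∈D″ , x∉D | no x∉D′ = inj₂ (x∈p∧x∉q⇒x∈p─q x∈D″ x∉D′)

card-⊆─ : {X D : Subset n} → Disjoint X D → ∣ X ∣ ≤ ∣ X ─ D ∣
card-⊆─ X#D = p⊆q⇒∣p∣≤∣q∣ λ x∈ → x∈p∧x∉q⇒x∈p─q x∈ (X#D x∈)

-- Assembly of the classes

private
  budget-arith : ∀ b θ e x → b + (e + ((θ + x * e) + x * e)) ≡ (b + θ) + suc (2 * x) * e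
  budget-arith = solve-∀

  share-arith : ∀ k m p → 2 * k * (4 * m * p) ≡ 8 * m * k * p
  share-arith = solve-∀

  scale-arith : ∀ v m → 4 * (v * m) ≡ 4 * m * v
  scale-arith = solve-∀

  spread-arith : ∀ x b p s e → x * ((b + p) + (s + e)) ≡ x * (b + s) + x * p + x * e
  spread-arith = solve-∀

  quadruple : ∀ n → n + n + n + n ≡ 4 * n
  quadruple = solve-∀

record Parts (G : Arcs n) (k t m : ℕ) : Set where
  open Arcs G
  field
    V      : Fin t → Subset n
    apart  : ∀ {i j x} → x ∈ V i → x ∈ V j → i ≡ j
    ∣V∣    : ∀ j → ∣ V j ∣ * m ≤ n
    robust : ∀ j (X : Subset n) → (∀ {v} → v ∈ X → ∀ i → v ∉ V i) →
      k < ∣ V j ∪ X ∣ × (∀ S → ∣ S ∣ < k → ∀ {u v} → u ∈ (V j ∪ X) ─ S → v ∈ (V j ∪ X) ─ S →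
        Star (Inside ((V j ∪ X) ─ S)) u v)

-- The conclusion is symmetric under reversal, so the orientation may be chosen with
-- `∣ In.Ex ∣ ≤ ∣ Out.Ex ∣`.
op-parts : {G : Arcs n} {k t m : ℕ} → Parts (op G) k t m → Parts G k t m
op-parts {G = G} parts = record
  { V = V ; apart = apart ; ∣V∣ = ∣V∣
  ; robust = λ j X X# → let k< , conn = robust j X X# in
      k< , λ S S<k u∈ v∈ → Star.reverse (λ (u∈ , v∈ , arc) → v∈ , u∈ , arc) (conn S S<k v∈ u∈) }
  where open Parts parts

module Assembly {n : ℕ} {G : Arcs n} {N c : ℕ} (bl : Blocks G N c) {k bound : ℕ} (pods : Pods bl k bound)
  {M R : ℕ} (ro : Routing bl (Pods.F pods) M R) {t K : ℕ} (j₀ : Fin t) (y₀ : Fin k) (q₀ : Fin M)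
  (K≤⁻ : ∀ v → K ≤ ∣ Arcs.N⁻ G v ∣) (K≤⁺ : ∀ v → K ≤ ∣ Arcs.N⁻ (op G) v ∣) where

  open Arcs G
  N⁺ : Fin n → Subset n
  N⁺ = Arcs.N⁻ (op G)
  module In = Blocks bl
  module Out = Blocks (op-blocks bl)
  open In using (A; B; α; β)
  open Pods pods using (F; F₀⊆F; own; own-A; own-B; ∣F∣; serve⁻; serve⁺)
  open Routing ro

  -- Room for `k` new neighbours of each of the at most `4 * M` vertices of `Ext`, in both
  -- directions.
  θ : ℕ
  θ = 2 * (k * (4 * M))

  H : Subset n
  H = F ∪ Ext

  ∣H∣ : ∣ H ∣ ≤ bound + 4 * M
  ∣H∣ = ≤-trans (∣p∪q∣≤∣p∣+∣q∣ F Ext) (+-mono-≤ ∣F∣ ∣Ext∣)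

  C⁻ C⁺ : Fin n → Subset n
  C⁻ v = N⁻ v ─ H
  C⁺ v = N⁺ v ─ H

  C⁻-in : ∀ {v w} → w ∈ C⁻ v → w ⟶ v × w ∉ F × w ∉ Ext
  C⁻-in {v} w∈ = let w∈N , w∉ = x∈p─q⁻ (N⁻ v) H w∈ in
    ∈set⁻ (_⟶? v) w∈N , w∉ ∘ x∈p∪q⁺ ∘ inj₁ , w∉ ∘ x∈p∪q⁺ ∘ inj₂

  C⁺-in : ∀ {v w} → w ∈ C⁺ v → v ⟶ w × w ∉ F × w ∉ Ext
  C⁺-in {v} w∈ = let w∈N , w∉ = x∈p─q⁻ (N⁺ v) H w∈ in
    ∈set⁻ (v ⟶?_) w∈N , w∉ ∘ x∈p∪q⁺ ∘ inj₁ , w∉ ∘ x∈p∪q⁺ ∘ inj₂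

  -- The path that hogs `C` if one does: whenever some path contains `θ` vertices of `C`, so does
  -- this one.
  h : Subset n → Fin M
  h C = proj₁ (argmax (λ q → ∣ C ∩ PS q ∣) q₀)

  h-max : ∀ C q → ∣ C ∩ PS q ∣ ≤ ∣ C ∩ PS (h C) ∣
  h-max C = proj₂ (argmax (λ q → ∣ C ∩ PS q ∣) q₀)

  -- A vertex of Ext has to join the class of any selected path that claims it, since
  -- its neighbours may all lie there; so no vertex may have two selected claimants.

  Claim : Fin n → Fin M → Set
  Claim v q = v ∈ PS q ⊎ q ≡ h (C⁻ v) ⊎ q ≡ h (C⁺ v)

  claim? : ∀ v q → Dec (Claim v q)
  claim? v q = v ∈? PS q ⊎-dec (q ≟ h (C⁻ v) ⊎-dec q ≟ h (C⁺ v))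

  ∣claims∣ : ∀ v → ∣ set (claim? v) ∣ ≤ 3
  ∣claims∣ v = ≤-trans (card-cover {p = set (claim? v)} {set on?} {⁅ h (C⁻ v) ⁆ ∪ ⁅ h (C⁺ v) ⁆} cover)
    (+-mono-≤ {∣ set on? ∣} {1}
      (card-injection (set on?) (⊤ {1}) (λ _ → zero) (λ _ → ∈⊤) λ p∈ q∈ _ → PS-dis (∈set⁻ on? p∈) (∈set⁻ on? q∈))
      (≤-trans (∣p∪q∣≤∣p∣+∣q∣ ⁅ h (C⁻ v) ⁆ ⁅ h (C⁺ v) ⁆)
        (+-mono-≤ (≤-reflexive (∣⁅x⁆∣≡1 (h (C⁻ v)))) (≤-reflexive (∣⁅x⁆∣≡1 (h (C⁺ v)))))))
    where
    on? : ∀ q → Dec (v ∈ PS q)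
    on? q = v ∈? PS q
    cover : ∀ {q} → q ∈ set (claim? v) → q ∈ set on? ⊎ q ∈ ⁅ h (C⁻ v) ⁆ ∪ ⁅ h (C⁺ v) ⁆
    cover q∈ with ∈set⁻ (claim? v) q∈
    ... | inj₁ v∈ = inj₁ (∈set⁺ on? v∈)
    ... | inj₂ (inj₁ refl) = inj₂ (x∈p∪q⁺ (inj₁ (x∈⁅x⁆ _)))
    ... | inj₂ (inj₂ refl) = inj₂ (x∈p∪q⁺ {p = ⁅ h (C⁻ v) ⁆} (inj₂ (x∈⁅x⁆ _)))

  spare? : (ends : Fin M → Fin N) → ∀ i → Dec (∀ q → ends q ≢ i)
  spare? ends i = all? λ q → ¬? (ends q ≟ i)

  Spare : (Fin M → Fin N) → Subset N
  Spare ends = set (spare? ends)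

  spares : (ends : Fin M → Fin N) → M + k * t ≤ N → Choice (⊤ {t}) (λ _ → Spare ends) ∅ k
  spares ends room = disjoint-choice ⊤ (λ _ → Spare ends) ∅ k λ _ → card-room {p = Spare ends} {∅} (begin
    ∣ ∅ {N} ∣ + k * ∣ ⊤ {t} ∣    ≡⟨ cong₂ (λ x y → x + k * y) (∣⊥∣≡0 N) (∣⊤∣≡n t) ⟩
    k * t  ≤⟨ +-cancelˡ-≤ M _ _ (≤-trans room N≤) ⟩
    ∣ Spare ends ∣  ∎)
    where
    open ≤-Reasoning
    used : Fin M → Subset N
    used q = ⁅ ends q ⁆
    either : ∀ i → i ∈ union used ⊎ i ∈ Spare ends
    either i with any? (λ q → ends q ≟ i)
    ... | yes (q , refl) = inj₁ (∈union⁺ used q (x∈⁅x⁆ (ends q)))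
    ... | no none = inj₂ (∈set⁺ (spare? ends) λ q eq → none (q , eq))
    N≤ : N ≤ M + ∣ Spare ends ∣
    N≤ = begin
      N  ≡⟨ sym (∣⊤∣≡n N) ⟩
      ∣ ⊤ {N} ∣  ≤⟨ card-cover {p = ⊤} {union used} {Spare ends} (λ {i} _ → either i) ⟩
      ∣ union used ∣ + ∣ Spare ends ∣  ≤⟨ +-monoˡ-≤ _ (≤-trans (≤-reflexive (sym (*-identityˡ _)))
                                           (union-bound used 1 1 λ q → ≤-reflexive (trans (*-identityˡ _) (∣⁅x⁆∣≡1 (ends q))))) ⟩
      M * 1 + ∣ Spare ends ∣           ≡⟨ cong (_+ ∣ Spare ends ∣) (*-identityʳ M) ⟩
      M + ∣ Spare ends ∣  ∎

  module Selected (I : Fin (t * k) → Fin M) (I-inj : ∀ {x y} → I x ≡ I y → x ≡ y)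
    (one-claim : ∀ {v x y} → v ∈ Ext → Claim v (I x) → Claim v (I y) → x ≡ y)
    (spareA : Choice (⊤ {t}) (λ _ → Spare ai) ∅ k) (spareB : Choice (⊤ {t}) (λ _ → Spare bi) ∅ k) where

    class : Fin (t * k) → Fin t
    class x = proj₁ (remQuot {t} k x)

    PI : Subset n
    PI = union (PS ∘ I)

    module PodClass (ends : Fin M → Fin N) (ends-inj : ∀ {p q} → ends p ≡ ends q → p ≡ q)
      (sp : Choice (⊤ {t}) (λ _ → Spare ends) ∅ k) where

      pod-by : ∀ {i} → Dec (∃[ x ] ends (I x) ≡ i) → Dec (∃[ j ] i ∈ part sp j) → Fin t
      pod-by (yes (x , _)) _ = class x
      pod-by (no _) (yes (j , _)) = j
      -- Pods at unselected paths and unassigned spare pods may join any class, as a pod serves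
      -- itself.
      pod-by (no _) (no _) = j₀

      pod-class : Fin N → Fin t
      pod-class i = pod-by (any? λ x → ends (I x) ≟ i) (any? λ j → i ∈? part sp j)

      at-end : ∀ x → pod-class (ends (I x)) ≡ class x
      at-end x = go (any? λ y → ends (I y) ≟ ends (I x)) (any? λ j → ends (I x) ∈? part sp j)
        where
        go : (d : Dec (∃[ y ] ends (I y) ≡ ends (I x))) (d′ : Dec (∃[ j ] ends (I x) ∈ part sp j)) →
          pod-by d d′ ≡ class x
        go (yes (y , eq)) _ = cong class (I-inj (ends-inj eq))
        go (no none) _ = contradiction (x , refl) none

      at-spare : ∀ {i j} → i ∈ part sp j → pod-class i ≡ j
      at-spare {i} {j} i∈ = go (any? λ y → ends (I y) ≟ i) (any? λ j → i ∈? part sp j)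
        where
        go : (d : Dec (∃[ y ] ends (I y) ≡ i)) (d′ : Dec (∃[ j ] i ∈ part sp j)) → pod-by d d′ ≡ j
        go (yes (y , eq)) _ = contradiction eq (∈set⁻ (spare? ends) (⊆C sp j i∈) (I y))
        go (no _) (yes (j′ , i∈′)) = disjoint sp i∈′ i∈
        go (no _) (no none) = contradiction (j , i∈) none

    module PA = PodClass ai ai-inj spareA
    module PB = PodClass bi bi-inj spareB

    pod-class : Fin N ⊎ Fin N → Fin t
    pod-class = [ PA.pod-class , PB.pod-class ]′

    colour-by : ∀ {v} → Dec (v ∈ F) → Dec (v ∈ Ext) → Dec (∃[ x ] Claim v (I x)) → Dec (∃[ x ] v ∈ PS (I x)) → Fin t
    colour-by {v} (yes _) _ _ _ = pod-class (own v)
    colour-by (no _) (yes _) (yes (x , _)) _ = class x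
    -- No selected path claims `v`, so neither of its hogs is selected and `hogged-or-free` leaves
    -- only the free case; any class will do.
    colour-by (no _) (yes _) (no _) _ = j₀
    colour-by (no _) (no _) _ (yes (x , _)) = class x
    colour-by (no _) (no _) _ (no _) = j₀

    colour : Fin n → Fin t
    colour v = colour-by (v ∈? F) (v ∈? Ext) (any? λ x → claim? v (I x)) (any? λ x → v ∈? PS (I x))

    Ext#F : ∀ {v} → v ∈ Ext → v ∉ F
    Ext#F v∈ = let q , v∈q = Ext⊆ v∈ in PS#F q v∈q

    colour-F : ∀ {v} → v ∈ F → colour v ≡ pod-class (own v)
    colour-F {v} v∈ = go (v ∈? F) (v ∈? Ext) (any? λ x → claim? v (I x)) (any? λ x → v ∈? PS (I x))
      where
      go : (d : Dec (v ∈ F)) → ∀ d₁ d₂ d₃ → colour-by d d₁ d₂ d₃ ≡ pod-class (own v)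
      go (yes _) _ _ _ = refl
      go (no v∉) _ _ _ = contradiction v∈ v∉

    colour-Ext : ∀ {v x} → v ∈ Ext → Claim v (I x) → colour v ≡ class x
    colour-Ext {v} {x} v∈ c = go (v ∈? F) (v ∈? Ext) (any? λ x → claim? v (I x)) (any? λ x → v ∈? PS (I x))
      where
      go : ∀ d (d₁ : Dec (v ∈ Ext)) (d₂ : Dec (∃[ x ] Claim v (I x))) d₃ → colour-by d d₁ d₂ d₃ ≡ class x
      go (yes v∈F) _ _ _ = contradiction v∈F (Ext#F v∈)
      go (no _) (yes _) (yes (y , c′)) _ = cong class (one-claim v∈ c′ c)
      go (no _) (yes _) (no none) _ = contradiction (x , c) none
      go (no _) (no v∉) _ _ = contradiction v∈ v∉

    colour-path : ∀ {v x} → v ∈ PS (I x) → colour v ≡ class x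
    colour-path {v} {x} v∈ = go (v ∈? F) (v ∈? Ext) (any? λ x → claim? v (I x)) (any? λ x → v ∈? PS (I x))
      where
      go : ∀ d (d₁ : Dec (v ∈ Ext)) (d₂ : Dec (∃[ x ] Claim v (I x))) (d₃ : Dec (∃[ x ] v ∈ PS (I x))) →
        colour-by d d₁ d₂ d₃ ≡ class x
      go (yes v∈F) _ _ _ = contradiction v∈F (PS#F (I x) v∈)
      go (no _) (yes v∈E) (yes (y , c)) _ = cong class (one-claim v∈E c (inj₁ v∈))
      go (no _) (yes _) (no none) _ = contradiction (x , inj₁ v∈) none
      go (no _) (no _) _ (yes (y , v∈′)) = cong class (I-inj (PS-dis v∈′ v∈))
      go (no _) (no _) _ (no none) = contradiction (x , v∈) none

    D₀ : Subset n
    D₀ = H ∪ PI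

    F⊆D₀ : F ⊆ D₀
    F⊆D₀ = x∈p∪q⁺ ∘ inj₁ ∘ x∈p∪q⁺ ∘ inj₁

    Ext⊆D₀ : Ext ⊆ D₀
    Ext⊆D₀ = x∈p∪q⁺ ∘ inj₁ ∘ x∈p∪q⁺ {p = F} ∘ inj₂

    PS⊆D₀ : ∀ x → PS (I x) ⊆ D₀
    PS⊆D₀ x v∈ = x∈p∪q⁺ {p = H} (inj₂ (∈union⁺ (PS ∘ I) x v∈))

    free⁻? : ∀ v → Dec (v ∈ Ext × θ ≤ ∣ C⁻ v ─ PI ∣)
    free⁻? v = v ∈? Ext ×-dec θ ≤? ∣ C⁻ v ─ PI ∣

    free⁺? : ∀ v → Dec (v ∈ Ext × θ ≤ ∣ C⁺ v ─ PI ∣)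
    free⁺? v = v ∈? Ext ×-dec θ ≤? ∣ C⁺ v ─ PI ∣

    tops? : (γ : Fin N → Fin n) {C : Fin t → Subset N} (sp : Choice (⊤ {t}) C ∅ k) (j : Fin t) →
      ∀ w → Dec (∃[ i ] i ∈ part sp j × γ i ≡ w)
    tops? γ sp j w = any? λ i → i ∈? part sp j ×-dec γ i ≟ w

    Tops⁻ Tops⁺ : Fin t → Subset n
    Tops⁻ j = set (tops? α spareA j)
    Tops⁺ j = set (tops? β spareB j)

    needy⁻? : ∀ v → Dec (v ∉ H × v ∈ In.Ex × ∃[ j ] ∃[ w ] w ∈ Tops⁻ j × v ⟶ w)
    needy⁻? v = ¬? (v ∈? H) ×-dec (v ∈? In.Ex ×-dec any? λ j → any? λ w → w ∈? Tops⁻ j ×-dec v ⟶? w)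

    needy⁺? : ∀ v → Dec (v ∉ H × v ∈ Out.Ex × ∃[ j ] ∃[ w ] w ∈ Tops⁺ j × w ⟶ v)
    needy⁺? v = ¬? (v ∈? H) ×-dec (v ∈? Out.Ex ×-dec any? λ j → any? λ w → w ∈? Tops⁺ j ×-dec w ⟶? v)

    -- By tightness an in-neighbour of `v` on a selected path would have to lie in `Ext`, which `C⁻`
    -- leaves out. So the selected paths, however long, take nothing from the neighbours available
    -- to `v`.
    needy⁻-off-PI : ∀ {v} → v ∉ H × v ∈ In.Ex × (∃[ j ] ∃[ w ] w ∈ Tops⁻ j × v ⟶ w) →
      Disjoint (C⁻ v ─ In.Ex) PI
    needy⁻-off-PI {v} (v∉H , _ , j , w , w∈ , v⟶w) x∈ x∈PI =
      let i , i∈ , α≡w = ∈set⁻ (tops? α spareA j) w∈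
          y , x∈y = ∈union⁻ (PS ∘ I) x∈PI
          x⟶v , _ , x∉Ext = C⁻-in (proj₁ (x∈p─q⁻ (C⁻ v) In.Ex x∈))
      in tight⁻ x∈y x∉Ext (v∉H ∘ x∈p∪q⁺ ∘ inj₁) (v∉H ∘ x∈p∪q⁺ {p = F} ∘ inj₂)
           (∈set⁻ (spare? ai) (⊆C spareA j i∈)) x⟶v (subst (v ⟶_) (sym α≡w) v⟶w)

    needy⁺-off-PI : ∀ {v} → v ∉ H × v ∈ Out.Ex × (∃[ j ] ∃[ w ] w ∈ Tops⁺ j × w ⟶ v) →
      Disjoint (C⁺ v ─ Out.Ex) PI
    needy⁺-off-PI {v} (v∉H , _ , j , w , w∈ , w⟶v) x∈ x∈PI =
      let i , i∈ , β≡w = ∈set⁻ (tops? β spareB j) w∈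
          y , x∈y = ∈union⁻ (PS ∘ I) x∈PI
          v⟶x , _ , x∉Ext = C⁺-in (proj₁ (x∈p─q⁻ (C⁺ v) Out.Ex x∈))
      in tight⁺ x∈y x∉Ext (v∉H ∘ x∈p∪q⁺ ∘ inj₁) (v∉H ∘ x∈p∪q⁺ {p = F} ∘ inj₂)
           (∈set⁻ (spare? bi) (⊆C spareB j i∈)) v⟶x (subst (_⟶ v) (sym β≡w) w⟶v)

    module Coloured
      (E⁻ : Growth D₀ colour (set free⁻?) C⁻ k)
      (E⁺ : Growth (Growth.D′ E⁻) (Growth.own′ E⁻) (set free⁺?) C⁺ k)
      (G⁻ : FullGrowth (Growth.D′ E⁺) (Growth.own′ E⁺) (set needy⁻?) (λ v → C⁻ v ─ In.Ex) k)
      (G⁺ : FullGrowth (FullGrowth.D′ G⁻) (FullGrowth.own′ G⁻) (set needy⁺?) (λ v → C⁺ v ─ Out.Ex) k)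
      (C⁻-large : ∀ v → suc (t * k) * θ ≤ ∣ C⁻ v ∣) (C⁺-large : ∀ v → suc (t * k) * θ ≤ ∣ C⁺ v ∣)
      (k≤θ : k ≤ θ) where

      module E⁻ = Growth E⁻
      module E⁺ = Growth E⁺
      module G⁻ = FullGrowth G⁻
      module G⁺ = FullGrowth G⁺

      D : Subset n
      D = G⁺.D′

      final : Fin n → Fin t
      final = G⁺.own′

      keeps₃ : ∀ {w} → w ∈ G⁻.D′ → final w ≡ G⁻.own′ w
      keeps₃ = G⁺.keeps
      keeps₂ : ∀ {w} → w ∈ E⁺.D′ → final w ≡ E⁺.own′ w
      keeps₂ w∈ = trans (keeps₃ (G⁻.D⊆D′ w∈)) (G⁻.keeps w∈)
      keeps₁ : ∀ {w} → w ∈ E⁻.D′ → final w ≡ E⁻.own′ w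
      keeps₁ w∈ = trans (keeps₂ (E⁺.D⊆D′ w∈)) (E⁺.keeps w∈)
      keeps₀ : ∀ {w} → w ∈ D₀ → final w ≡ colour w
      keeps₀ w∈ = trans (keeps₁ (E⁻.D⊆D′ w∈)) (E⁻.keeps w∈)

      D₂⊆D : E⁺.D′ ⊆ D
      D₂⊆D = G⁺.D⊆D′ ∘ G⁻.D⊆D′
      D₁⊆D : E⁻.D′ ⊆ D
      D₁⊆D = D₂⊆D ∘ E⁺.D⊆D′
      D₀⊆D : D₀ ⊆ D
      D₀⊆D = D₁⊆D ∘ E⁻.D⊆D′

      Ok : Fin t → Fin n → Set
      Ok j w = w ∈ D × final w ≡ j

      ok-F : ∀ {v} → v ∈ F → Ok (pod-class (own v)) v
      ok-F v∈ = D₀⊆D (F⊆D₀ v∈) , trans (keeps₀ (F⊆D₀ v∈)) (colour-F v∈)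

      ok-path : ∀ {x v} → v ∈ PS (I x) → Ok (class x) v
      ok-path {x} v∈ = D₀⊆D (PS⊆D₀ x v∈) , trans (keeps₀ (PS⊆D₀ x v∈)) (colour-path v∈)

      ok-A : ∀ {i v} → v ∈ A i → Ok (PA.pod-class i) v
      ok-A {i} v∈ = subst (λ o → Ok (pod-class o) _) (own-A v∈) (ok-F (F₀⊆F (In.A⊆F₀ i v∈)))

      ok-B : ∀ {i v} → v ∈ B i → Ok (PB.pod-class i) v
      ok-B {i} v∈ = subst (λ o → Ok (pod-class o) _) (own-B v∈) (ok-F (F₀⊆F (In.B⊆F₀ i v∈)))

      pod-mate : ∀ {v j} → Ok j v → v ∈ F → ∀ {w} → w ∈ F × own w ≡ own v → Ok j w
      pod-mate {v} (_ , v≡j) v∈ {w} (w∈ , eq) = D₀⊆D (F⊆D₀ w∈) , (begin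
        final w  ≡⟨ proj₂ (ok-F w∈) ⟩
        pod-class (own w)    ≡⟨ cong pod-class eq ⟩
        pod-class (own v)    ≡⟨ sym (proj₂ (ok-F v∈)) ⟩
        final v  ≡⟨ v≡j ⟩
        _  ∎)
        where open ≡-Reasoning

      tops : ∀ (γ : Fin N → Fin n) (γ-inj : ∀ {i i′} → γ i ≡ γ i′ → i ≡ i′) {C : Fin t → Subset N}
        (sp : Choice (⊤ {t}) C ∅ k) j → k ≤ ∣ set (tops? γ sp j) ∣
      tops γ γ-inj sp j = ≤-trans (≤-reflexive (sym (size sp (∈⊤ {x = j}))))
        (card-injection (part sp j) (set (tops? γ sp j)) γ (λ i∈ → ∈set⁺ (tops? γ sp j) (_ , i∈ , refl)) λ _ _ → γ-inj)

      α-inj : ∀ {i i′} → α i ≡ α i′ → i ≡ i′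
      α-inj {i} {i′} eq = In.A-apart (In.α∈ i) (subst (_∈ A i′) (sym eq) (In.α∈ i′))

      β-inj : ∀ {i i′} → β i ≡ β i′ → i ≡ i′
      β-inj {i} {i′} eq = In.B-apart (In.β∈ i) (subst (_∈ B i′) (sym eq) (In.β∈ i′))

      Tops⁻⊆ : ∀ j {w} → w ∈ Tops⁻ j → w ∈ F × Ok j w
      Tops⁻⊆ j w∈ with ∈set⁻ (tops? α spareA j) w∈
      ... | i , i∈ , refl = F₀⊆F (In.A⊆F₀ i (In.α∈ i)) , subst (λ c → Ok c (α i)) (PA.at-spare i∈) (ok-A (In.α∈ i))

      Tops⁺⊆ : ∀ j {w} → w ∈ Tops⁺ j → w ∈ F × Ok j w
      Tops⁺⊆ j w∈ with ∈set⁻ (tops? β spareB j) w∈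
      ... | i , i∈ , refl = F₀⊆F (In.B⊆F₀ i (In.β∈ i)) , subst (λ c → Ok c (β i)) (PB.at-spare i∈) (ok-B (In.β∈ i))

      H∌ : ∀ {v} → v ∉ F → v ∉ Ext → v ∉ H
      H∌ v∉F v∉Ext = [ v∉F , v∉Ext ]′ ∘ x∈p∪q⁻ F Ext

      -- The hypothesis holds for the vertices of class `j` and for every vertex outside `D`; thus
      -- one statement covers `V j` and an arbitrary set added to it.
      served⁻ : ∀ j {v} → (v ∈ D → final v ≡ j) → Served G k In.Dominated (Ok j) v
      served⁻ j colour-v = Serve.serve bl k F₀⊆F
        (λ v∈ ok → served-map (pod-mate ok v∈) (serve⁻ v∈))
        (tops α α-inj spareA j) (Tops⁻⊆ j)
        request ext
        (λ v∈ → D₀⊆D (F⊆D₀ v∈) , colour-v (D₀⊆D (F⊆D₀ v∈)))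
        (λ v∈ → D₀⊆D (Ext⊆D₀ v∈) , colour-v (D₀⊆D (Ext⊆D₀ v∈)))
        where
        request : ∀ {v w} → v ∉ F → v ∉ Ext → v ∈ In.Ex → w ∈ Tops⁻ j → v ⟶ w →
          ∃[ Q ] k ≤ ∣ Q ∣ × (∀ {w} → w ∈ Q → w ⟶ v × Ok j w × w ∉ F × w ∉ In.Ex)
        request {v} v∉F v∉Ext v∈Ex w∈ v⟶w
          with G⁻.fresh (∈set⁺ needy⁻? (H∌ v∉F v∉Ext , v∈Ex , j , _ , w∈ , v⟶w)) j
        ... | P , ∣P∣ , new = P , ≤-reflexive (sym ∣P∣) , λ x∈ →
          let x∈C , _ , x∈D , eq = new x∈
              x∈C⁻ , x∉Ex = x∈p─q⁻ (C⁻ v) In.Ex x∈C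
              x⟶v , x∉F , _ = C⁻-in x∈C⁻
          in x⟶v , (G⁺.D⊆D′ x∈D , trans (keeps₃ x∈D) eq) , x∉F , x∉Ex
        ext : ∀ {v} → v ∈ Ext → Ok j v →
          ∃[ Q ] k ≤ ∣ Q ∣ × (∀ {w} → w ∈ Q → w ⟶ v × Ok j w × w ∉ F × w ∉ Ext)
        ext {v} v∈ (_ , v≡j) with hogged-or-free PS PS-dis I (C⁻ v) (h (C⁻ v)) (h-max (C⁻ v)) θ (C⁻-large v)
        ... | inj₁ free with E⁻.fresh (∈set⁺ free⁻? (v∈ , free))
        ... | P , ∣P∣ , new = P , ≤-reflexive (sym ∣P∣) , λ x∈ →
          let x∈C , _ , x∈D , eq = new x∈
              x⟶v , x∉F , x∉Ext = C⁻-in x∈C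
          in x⟶v , (D₁⊆D x∈D , trans (keeps₁ x∈D) (trans eq (trans (sym (keeps₀ (Ext⊆D₀ v∈))) v≡j))) , x∉F , x∉Ext
        -- The hog of `v` is selected. As `v` claims it, both have the same class, so the neighbours
        -- of `v` on it already give service within class `j`.
        ext {v} v∈ (_ , v≡j) | inj₂ (x , h≡ , large) = C⁻ v ∩ PS (h (C⁻ v)) , ≤-trans k≤θ large , λ {w} w∈ →
          let w∈C , w∈P = x∈p∩q⁻ (C⁻ v) _ w∈
              w⟶v , w∉F , w∉Ext = C⁻-in w∈C
              class≡j = trans (sym (colour-Ext v∈ (inj₂ (inj₁ (sym h≡))))) (trans (sym (keeps₀ (Ext⊆D₀ v∈))) v≡j)
          in w⟶v , subst (λ c → Ok c w) class≡j (ok-path (subst (λ q → w ∈ PS q) h≡ w∈P)) , w∉F , w∉Ext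

      served⁺ : ∀ j {v} → (v ∈ D → final v ≡ j) → Served (op G) k Out.Dominated (Ok j) v
      served⁺ j colour-v = Serve.serve (op-blocks bl) k F₀⊆F
        (λ v∈ ok → served-map (pod-mate ok v∈) (serve⁺ v∈))
        (tops β β-inj spareB j) (Tops⁺⊆ j)
        request ext
        (λ v∈ → D₀⊆D (F⊆D₀ v∈) , colour-v (D₀⊆D (F⊆D₀ v∈)))
        (λ v∈ → D₀⊆D (Ext⊆D₀ v∈) , colour-v (D₀⊆D (Ext⊆D₀ v∈)))
        where
        request : ∀ {v w} → v ∉ F → v ∉ Ext → v ∈ Out.Ex → w ∈ Tops⁺ j → w ⟶ v →
          ∃[ Q ] k ≤ ∣ Q ∣ × (∀ {w} → w ∈ Q → v ⟶ w × Ok j w × w ∉ F × w ∉ Out.Ex)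
        request {v} v∉F v∉Ext v∈Ex w∈ w⟶v
          with G⁺.fresh (∈set⁺ needy⁺? (H∌ v∉F v∉Ext , v∈Ex , j , _ , w∈ , w⟶v)) j
        ... | P , ∣P∣ , new = P , ≤-reflexive (sym ∣P∣) , λ x∈ →
          let x∈C , _ , x∈D , eq = new x∈
              x∈C⁺ , x∉Ex = x∈p─q⁻ (C⁺ v) Out.Ex x∈C
              v⟶x , x∉F , _ = C⁺-in x∈C⁺
          in v⟶x , (x∈D , eq) , x∉F , x∉Ex
        ext : ∀ {v} → v ∈ Ext → Ok j v →
          ∃[ Q ] k ≤ ∣ Q ∣ × (∀ {w} → w ∈ Q → v ⟶ w × Ok j w × w ∉ F × w ∉ Ext)
        ext {v} v∈ (_ , v≡j) with hogged-or-free PS PS-dis I (C⁺ v) (h (C⁺ v)) (h-max (C⁺ v)) θ (C⁺-large v)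
        ... | inj₁ free with E⁺.fresh (∈set⁺ free⁺? (v∈ , free))
        ... | P , ∣P∣ , new = P , ≤-reflexive (sym ∣P∣) , λ x∈ →
          let x∈C , _ , x∈D , eq = new x∈
              v⟶x , x∉F , x∉Ext = C⁺-in x∈C
              own-v = trans (E⁻.keeps (Ext⊆D₀ v∈)) (trans (sym (keeps₀ (Ext⊆D₀ v∈))) v≡j)
          in v⟶x , (D₂⊆D x∈D , trans (keeps₂ x∈D) (trans eq own-v)) , x∉F , x∉Ext
        ext {v} v∈ (_ , v≡j) | inj₂ (x , h≡ , large) = C⁺ v ∩ PS (h (C⁺ v)) , ≤-trans k≤θ large , λ {w} w∈ →
          let w∈C , w∈P = x∈p∩q⁻ (C⁺ v) _ w∈
              v⟶w , w∉F , w∉Ext = C⁺-in w∈C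
              class≡j = trans (sym (colour-Ext v∈ (inj₂ (inj₂ (sym h≡))))) (trans (sym (keeps₀ (Ext⊆D₀ v∈))) v≡j)
          in v⟶w , subst (λ c → Ok c w) class≡j (ok-path (subst (λ q → w ∈ PS q) h≡ w∈P)) , w∉F , w∉Ext

      in-V? : ∀ j v → Dec (Ok j v)
      in-V? j v = v ∈? D ×-dec final v ≟ j

      V : Fin t → Subset n
      V j = set (in-V? j)

      V-apart : ∀ {i j x} → x ∈ V i → x ∈ V j → i ≡ j
      V-apart {i} {j} x∈ x∈′ = trans (sym (proj₂ (∈set⁻ (in-V? i) x∈))) (proj₂ (∈set⁻ (in-V? j) x∈′))

      -- The k units of class j are disjoint, so one of them survives.

      module Robust (j : Fin t) (X : Subset n) (X# : ∀ {v} → v ∈ X → ∀ i → v ∉ V i) where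

        path-of : Fin k → Fin M
        path-of y = I (combine j y)

        class≡ : ∀ y → class (combine j y) ≡ j
        class≡ y = cong proj₁ (remQuot-combine j y)

        Unit : Fin k → Fin n → Set
        Unit y v = v ∈ A (ai (path-of y)) ⊎ v ∈ B (bi (path-of y)) ⊎ v ∈ PS (path-of y)

        unit? : ∀ y v → Dec (Unit y v)
        unit? y v = v ∈? A (ai (path-of y)) ⊎-dec (v ∈? B (bi (path-of y)) ⊎-dec v ∈? PS (path-of y))

        unit-ok : ∀ {y v} → Unit y v → Ok j v
        unit-ok {y} (inj₁ v∈) = subst (λ c → Ok c _) (trans (PA.at-end (combine j y)) (class≡ y)) (ok-A v∈)
        unit-ok {y} (inj₂ (inj₁ v∈)) = subst (λ c → Ok c _) (trans (PB.at-end (combine j y)) (class≡ y)) (ok-B v∈)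
        unit-ok {y} (inj₂ (inj₂ v∈)) = subst (λ c → Ok c _) (class≡ y) (ok-path v∈)

        same-path : ∀ {y y′ v} → Unit y v → Unit y′ v → path-of y ≡ path-of y′
        same-path (inj₁ v∈) (inj₁ v∈′) = ai-inj (In.A-apart v∈ v∈′)
        same-path (inj₁ v∈) (inj₂ (inj₁ v∈′)) = contradiction v∈′ (In.A#B v∈)
        same-path (inj₁ v∈) (inj₂ (inj₂ v∈′)) = contradiction (F₀⊆F (In.A⊆F₀ _ v∈)) (PS#F _ v∈′)
        same-path (inj₂ (inj₁ v∈)) (inj₁ v∈′) = contradiction v∈ (In.A#B v∈′)
        same-path (inj₂ (inj₁ v∈)) (inj₂ (inj₁ v∈′)) = bi-inj (In.B-apart v∈ v∈′)
        same-path (inj₂ (inj₁ v∈)) (inj₂ (inj₂ v∈′)) = contradiction (F₀⊆F (In.B⊆F₀ _ v∈)) (PS#F _ v∈′)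
        same-path (inj₂ (inj₂ v∈)) (inj₁ v∈′) = contradiction (F₀⊆F (In.A⊆F₀ _ v∈′)) (PS#F _ v∈)
        same-path (inj₂ (inj₂ v∈)) (inj₂ (inj₁ v∈′)) = contradiction (F₀⊆F (In.B⊆F₀ _ v∈′)) (PS#F _ v∈)
        same-path (inj₂ (inj₂ v∈)) (inj₂ (inj₂ v∈′)) = PS-dis v∈ v∈′

        units-apart : ∀ {y y′ v} → Unit y v → Unit y′ v → y ≡ y′
        units-apart {y} {y′} u u′ = combine-injectiveʳ j y j y′ (I-inj (same-path u u′))

        survivor : ∀ S → ∣ S ∣ < k → ∃[ y ] (∀ {v} → Unit y v → v ∉ S)
        survivor S S<k with any? (λ y → ¬? (any? λ v → unit? y v ×-dec v ∈? S))
        ... | yes (y , none) = y , λ u v∈ → none (_ , u , v∈)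
        ... | no all-hit = contradiction (≤-trans (≤-reflexive (sym (∣⊤∣≡n k)))
            (card-injection ⊤ S (λ y → proj₁ (hit y)) (λ {y} _ → proj₂ (proj₂ (hit y)))
              λ {y} {y′} _ _ eq → units-apart (proj₁ (proj₂ (hit y))) (subst (Unit y′) (sym eq) (proj₁ (proj₂ (hit y′))))))
            (<⇒≱ S<k)
          where
          hit : ∀ y → ∃[ v ] Unit y v × v ∈ S
          hit y with any? (λ v → unit? y v ×-dec v ∈? S)
          ... | yes found = found
          ... | no none = contradiction (y , none) all-hit

        ok⇒V : ∀ {v} → Ok j v → v ∈ V j
        ok⇒V = ∈set⁺ (in-V? j)

        strong : ∀ S → ∣ S ∣ < k → ∀ {u v} → u ∈ (V j ∪ X) ─ S → v ∈ (V j ∪ X) ─ S →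
          Star (Inside ((V j ∪ X) ─ S)) u v
        strong S S<k {u} {v} u∈ v∈ with survivor S S<k
        ... | y , alive = reverse-inside (op G) to-β ◅◅ route (path-of y) (W-unit (inj₂ (inj₁ (In.β∈ _))))
                            (W-unit (inj₁ (In.α∈ _))) (λ w∈ → W-unit (inj₂ (inj₂ w∈))) ◅◅ from-α
          where
          W = (V j ∪ X) ─ S
          W-ok : ∀ {w} → Ok j w → w ∉ S → w ∈ W
          W-ok ok = x∈p∧x∉q⇒x∈p─q (x∈p∪q⁺ (inj₁ (ok⇒V ok)))
          W-unit : ∀ {w} → Unit y w → w ∈ W
          W-unit w∈ = W-ok (unit-ok {y} w∈) (alive w∈)
          coloured : ∀ {w} → w ∈ W → w ∈ D → final w ≡ j
          coloured w∈ w∈D with x∈p∪q⁻ (V j) X (proj₁ (x∈p─q⁻ (V j ∪ X) S w∈))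
          ... | inj₁ w∈V = proj₂ (∈set⁻ (in-V? j) w∈V)
          ... | inj₂ w∈X = contradiction (∈set⁺ (in-V? (final _)) (w∈D , refl)) (X# w∈X (final _))
          from-α : Star (Inside W) (α (ai (path-of y))) v
          from-α = reach G S<k W-ok (λ w∈ → W-unit (inj₁ w∈)) (In.α∈ _) (In.α⟶ _) (λ b → b (ai (path-of y)))
            (served⁻ j (coloured v∈)) v∈
          to-β : Star (Arcs.Inside (op G) W) (β (bi (path-of y))) u
          to-β = reach (op G) S<k W-ok (λ w∈ → W-unit (inj₂ (inj₁ w∈))) (In.β∈ _) (Out.α⟶ _)
            (λ b → b (bi (path-of y))) (served⁺ j (coloured u∈)) u∈

        -- The `k` surplus tops of the class, and for strictness the top of one of its units, which
        -- is not spare.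
        k<∣V∪X∣ : k < ∣ V j ∪ X ∣
        k<∣V∪X∣ = begin
          1 + k  ≡⟨ cong (_+ k) (sym (∣⁅x⁆∣≡1 a₀)) ⟩
          ∣ ⁅ a₀ ⁆ ∣ + k  ≤⟨ +-monoʳ-≤ _ (tops α α-inj spareA j) ⟩
          ∣ ⁅ a₀ ⁆ ∣ + ∣ Tops⁻ j ∣       ≤⟨ card-disjoint {p = ⁅ a₀ ⁆} {Tops⁻ j} {V j ∪ X}
                                            (λ x∈ x∈′ → a₀∉ (subst (_∈ Tops⁻ j) (x∈⁅y⁆⇒x≡y a₀ x∈) x∈′))
                                            (λ x∈ → subst (_∈ V j ∪ X) (sym (x∈⁅y⁆⇒x≡y a₀ x∈))
                                              (x∈p∪q⁺ (inj₁ (ok⇒V (unit-ok {y₀} (inj₁ (In.α∈ _)))))))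
                                            (λ x∈ → x∈p∪q⁺ (inj₁ (ok⇒V (proj₂ (Tops⁻⊆ j x∈))))) ⟩
          ∣ V j ∪ X ∣  ∎
          where
          open ≤-Reasoning
          a₀ = α (ai (path-of y₀))
          a₀∉ : a₀ ∉ Tops⁻ j
          a₀∉ a₀∈ with ∈set⁻ (tops? α spareA j) a₀∈
          ... | i , i∈ , eq = ∈set⁻ (spare? ai) (⊆C spareA j i∈) (path-of y₀) (sym (α-inj eq))

    module Rooms (K-half : 2 * ((bound + 4 * M) + θ) ≤ K)
      (e⁻-small : ∀ {v} → v ∉ In.F₀ → 2 * (suc (2 * (k * t)) * ∣ In.Ex ∣) ≤ ∣ N⁻ v ∣)
      (e⁺-small : ∀ {v} → v ∉ In.F₀ → 2 * (suc (2 * (k * t)) * ∣ Out.Ex ∣) ≤ ∣ N⁺ v ∣)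
      (e⁻≤e⁺ : ∣ In.Ex ∣ ≤ ∣ Out.Ex ∣) where
      open ≤-Reasoning

      e⁻ = ∣ In.Ex ∣
      e⁺ = ∣ Out.Ex ∣

      off-D₀ : ∀ {X} → (∀ {w} → w ∈ X → w ∉ H) → (∀ {w} → w ∈ X → w ∉ PI) → Disjoint X D₀
      off-D₀ X#H X#PI w∈ = [ X#H w∈ , X#PI w∈ ]′ ∘ x∈p∪q⁻ H PI

      free-room : ∀ {C} → Disjoint C H → θ ≤ ∣ C ─ PI ∣ → θ ≤ ∣ C ─ D₀ ∣
      free-room {C} C#H free = ≤-trans free (p⊆q⇒∣p∣≤∣q∣ λ w∈ → let w∈C , w∉PI = x∈p─q⁻ C PI w∈ in
        x∈p∧x∉q⇒x∈p─q w∈C ([ C#H w∈C , w∉PI ]′ ∘ x∈p∪q⁻ H PI))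

      Ext-share : ∀ {Q} → Q ⊆ Ext → k * ∣ Q ∣ ≤ k * (4 * M)
      Ext-share Q⊆ = *-monoʳ-≤ k (≤-trans (p⊆q⇒∣p∣≤∣q∣ Q⊆) ∣Ext∣)

      θ≡ : θ ≡ k * (4 * M) + k * (4 * M)
      θ≡ = cong (k * (4 * M) +_) (+-identityʳ _)

      E⁻-share : k * ∣ set free⁻? ∣ ≤ k * (4 * M)
      E⁻-share = Ext-share {set free⁻?} λ v∈ → proj₁ (∈set⁻ free⁻? v∈)

      E⁺-share : k * ∣ set free⁺? ∣ ≤ k * (4 * M)
      E⁺-share = Ext-share {set free⁺?} λ v∈ → proj₁ (∈set⁻ free⁺? v∈)

      E⁻-room : ∀ {v} → v ∈ set free⁻? → k * ∣ set free⁻? ∣ ≤ ∣ C⁻ v ─ D₀ ∣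
      E⁻-room {v} v∈ = begin
        k * ∣ set free⁻? ∣    ≤⟨ E⁻-share ⟩
        k * (4 * M)           ≤⟨ m≤m+n _ _ ⟩
        θ  ≤⟨ free-room {C⁻ v} (λ w∈ → proj₂ (x∈p─q⁻ (N⁻ v) H w∈)) (proj₂ (∈set⁻ free⁻? v∈)) ⟩
        ∣ C⁻ v ─ D₀ ∣         ∎

      module _ (E⁻ : Growth D₀ colour (set free⁻?) C⁻ k) where

        E⁺-room : ∀ {v} → v ∈ set free⁺? → k * ∣ set free⁺? ∣ ≤ ∣ C⁺ v ─ Growth.D′ E⁻ ∣
        E⁺-room {v} v∈ = room-after {X = C⁺ v} {D₀} (begin
          ∣ Growth.D′ E⁻ ─ D₀ ∣ + k * ∣ set free⁺? ∣  ≤⟨ +-mono-≤ (≤-trans (Growth.∣new∣ E⁻) E⁻-share) E⁺-share ⟩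
          k * (4 * M) + k * (4 * M)  ≡⟨ sym θ≡ ⟩
          θ  ≤⟨ free-room {C⁺ v} (λ w∈ → proj₂ (x∈p─q⁻ (N⁺ v) H w∈)) (proj₂ (∈set⁻ free⁺? v∈)) ⟩
          ∣ C⁺ v ─ D₀ ∣  ∎)

        module _ (E⁺ : Growth (Growth.D′ E⁻) (Growth.own′ E⁻) (set free⁺?) C⁺ k) where

          ∣D₂─D₀∣ : ∣ Growth.D′ E⁺ ─ D₀ ∣ ≤ θ
          ∣D₂─D₀∣ = begin
            ∣ Growth.D′ E⁺ ─ D₀ ∣  ≤⟨ ∣─∣-trans D₀ (Growth.D′ E⁻) (Growth.D′ E⁺) ⟩
            ∣ Growth.D′ E⁻ ─ D₀ ∣ + ∣ Growth.D′ E⁺ ─ Growth.D′ E⁻ ∣  ≤⟨ +-mono-≤ (≤-trans (Growth.∣new∣ E⁻) E⁻-share)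
                                                                                 (≤-trans (Growth.∣new∣ E⁺) E⁺-share) ⟩
            k * (4 * M) + k * (4 * M)  ≡⟨ sym θ≡ ⟩
            θ  ∎

          needy-room : ∀ {X E D} {e d s} → ∣ H ∣ + (e + (s + d)) ≤ ∣ X ∣ → ∣ E ∣ ≤ e → ∣ D ─ D₀ ∣ ≤ s →
            Disjoint ((X ─ H) ─ E) PI → d ≤ ∣ ((X ─ H) ─ E) ─ D ∣
          needy-room {X} {E} {D} {e} {d} {s} le E≤ D≤ X#PI = room-after {X = (X ─ H) ─ E} {D₀} (begin
            ∣ D ─ D₀ ∣ + d             ≤⟨ +-monoˡ-≤ d D≤ ⟩
            s + d  ≤⟨ card-room {p = X ─ H} {E} (≤-trans (+-monoˡ-≤ _ E≤) (card-room {p = X} {H} le)) ⟩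
            ∣ (X ─ H) ─ E ∣            ≤⟨ card-⊆─ {X = (X ─ H) ─ E} {D₀}
                                            (off-D₀ {(X ─ H) ─ E} (λ w∈ → proj₂ (x∈p─q⁻ X H (proj₁ (x∈p─q⁻ (X ─ H) E w∈)))) X#PI) ⟩
            ∣ ((X ─ H) ─ E) ─ D₀ ∣     ∎)

          -- One half of the degree pays for `H` and for the service of `Ext`, the other for the
          -- exceptional set and two rounds of at most `k * t * e` fresh vertices. The paths are not
          -- charged.
          budget : ∀ e {d} → K ≤ d → 2 * (suc (2 * (k * t)) * e) ≤ d →
            ∣ H ∣ + (e + ((θ + k * t * e) + k * t * e)) ≤ d
          budget e {d} K≤ 2e≤ = begin
            ∣ H ∣ + (e + ((θ + k * t * e) + k * t * e))             ≤⟨ +-monoˡ-≤ _ ∣H∣ ⟩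
            bound + 4 * M + (e + ((θ + k * t * e) + k * t * e))  ≡⟨ budget-arith (bound + 4 * M) θ e (k * t) ⟩
            (bound + 4 * M + θ) + suc (2 * (k * t)) * e  ≤⟨ halves {bound + 4 * M + θ} (≤-trans K-half K≤) 2e≤ ⟩
            d  ∎

          ∣needy⁻∣ : k * t * ∣ set needy⁻? ∣ ≤ k * t * e⁻
          ∣needy⁻∣ = *-monoʳ-≤ (k * t) (p⊆q⇒∣p∣≤∣q∣ λ v∈ → proj₁ (proj₂ (∈set⁻ needy⁻? v∈)))

          ∣needy⁺∣ : k * t * ∣ set needy⁺? ∣ ≤ k * t * e⁺
          ∣needy⁺∣ = *-monoʳ-≤ (k * t) (p⊆q⇒∣p∣≤∣q∣ λ v∈ → proj₁ (proj₂ (∈set⁻ needy⁺? v∈)))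

          G⁻-room : ∀ {v} → v ∈ set needy⁻? → k * t * ∣ set needy⁻? ∣ ≤ ∣ (C⁻ v ─ In.Ex) ─ Growth.D′ E⁺ ∣
          G⁻-room {v} v∈ = ≤-trans ∣needy⁻∣ (needy-room {N⁻ v} {In.Ex} {Growth.D′ E⁺}
            (≤-trans (+-monoʳ-≤ ∣ H ∣ (+-monoʳ-≤ e⁻ (+-monoˡ-≤ (k * t * e⁻) (m≤m+n θ (k * t * e⁻)))))
              (budget e⁻ (K≤⁻ v) (e⁻-small (proj₁ (∈set⁻ needy⁻? v∈) ∘ x∈p∪q⁺ ∘ inj₁ ∘ F₀⊆F))))
            ≤-refl ∣D₂─D₀∣ (needy⁻-off-PI (∈set⁻ needy⁻? v∈)))

          module _ (G⁻ : FullGrowth (Growth.D′ E⁺) (Growth.own′ E⁺) (set needy⁻?) (λ v → C⁻ v ─ In.Ex) k) where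

            -- The vertices reserved for in-service are charged against out-degrees in the next
            -- round, so their number must be measured by `e⁺`; this uses `e⁻≤e⁺`.
            ∣D₃─D₀∣ : ∣ FullGrowth.D′ G⁻ ─ D₀ ∣ ≤ θ + k * t * e⁺
            ∣D₃─D₀∣ = ≤-trans (∣─∣-trans D₀ (Growth.D′ E⁺) (FullGrowth.D′ G⁻))
              (+-mono-≤ ∣D₂─D₀∣ (≤-trans (FullGrowth.∣new∣ G⁻) (≤-trans ∣needy⁻∣ (*-monoʳ-≤ (k * t) e⁻≤e⁺))))

            G⁺-room : ∀ {v} → v ∈ set needy⁺? → k * t * ∣ set needy⁺? ∣ ≤ ∣ (C⁺ v ─ Out.Ex) ─ FullGrowth.D′ G⁻ ∣
            G⁺-room {v} v∈ = ≤-trans ∣needy⁺∣ (needy-room {N⁺ v} {Out.Ex} {FullGrowth.D′ G⁻}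
              (budget e⁺ (K≤⁺ v) (e⁺-small (proj₁ (∈set⁻ needy⁺? v∈) ∘ x∈p∪q⁺ ∘ inj₁ ∘ F₀⊆F)))
              ≤-refl ∣D₃─D₀∣ (needy⁺-off-PI (∈set⁻ needy⁺? v∈)))

            module _ (G⁺ : FullGrowth (FullGrowth.D′ G⁻) (FullGrowth.own′ G⁻) (set needy⁺?) (λ v → C⁺ v ─ Out.Ex) k)
              (C⁻-large : ∀ v → suc (t * k) * θ ≤ ∣ C⁻ v ∣) (C⁺-large : ∀ v → suc (t * k) * θ ≤ ∣ C⁺ v ∣)
              (k≤θ : k ≤ θ) {m : ℕ} (m-H : 4 * m * ((bound + 4 * M) + θ) ≤ n) (m-R : 8 * m * k ≤ R)
              (m-e : 4 * m * (2 * (k * t * e⁺)) ≤ n) where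

              open Coloured E⁻ E⁺ G⁻ G⁺ C⁻-large C⁺-large k≤θ

              PJ : Fin t → Subset n
              PJ j = union λ y → PS (I (combine j y))

              ∣D─D₀∣ : ∣ D ─ D₀ ∣ ≤ θ + 2 * (k * t * e⁺)
              ∣D─D₀∣ = begin
                ∣ D ─ D₀ ∣  ≤⟨ ∣─∣-trans D₀ (FullGrowth.D′ G⁻) D ⟩
                _  ≤⟨ +-mono-≤ ∣D₃─D₀∣ (≤-trans (FullGrowth.∣new∣ G⁺) ∣needy⁺∣) ⟩
                θ + k * t * e⁺ + k * t * e⁺  ≡⟨ +-assoc θ _ _ ⟩
                θ + (k * t * e⁺ + k * t * e⁺)  ≡⟨ cong (λ z → θ + (k * t * e⁺ + z)) (sym (+-identityʳ _)) ⟩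
                θ + 2 * (k * t * e⁺)  ∎

              -- All of `H` and all reserved vertices are charged to every class. Only the paths,
              -- which may be long, have to be shared out.
              V-cover : ∀ j {v} → v ∈ V j → v ∈ H ∪ PJ j ⊎ v ∈ D ─ D₀
              V-cover j {v} v∈ with ∈set⁻ (in-V? j) v∈ | v ∈? D₀
              ... | v∈D , _ | no v∉ = inj₂ (x∈p∧x∉q⇒x∈p─q v∈D v∉)
              ... | _ , v≡j | yes v∈D₀ with x∈p∪q⁻ H PI v∈D₀
              ... | inj₁ v∈H = inj₁ (x∈p∪q⁺ (inj₁ v∈H))
              ... | inj₂ v∈PI with ∈union⁻ (PS ∘ I) v∈PI
              ... | x , v∈x = inj₁ (x∈p∪q⁺ {p = H} (inj₂ (∈union⁺ (λ y → PS (I (combine j y))) (proj₂ (remQuot {t} k x))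
                (subst (λ z → v ∈ PS (I z)) x≡ v∈x))))
                where
                class≡j : class x ≡ j
                class≡j = trans (sym (trans (keeps₀ v∈D₀) (colour-path v∈x))) v≡j
                x≡ : x ≡ combine j (proj₂ (remQuot {t} k x))
                x≡ = trans (sym (combine-remQuot {t} k x)) (cong (λ i → combine i (proj₂ (remQuot {t} k x))) class≡j)

              -- A class has `k` paths of at most `2 * n / R` vertices, and `R` is at least
              -- `8 * m * k`.
              4m∣PJ∣ : ∀ j → 4 * m * ∣ PJ j ∣ ≤ n
              4m∣PJ∣ j = *-cancelˡ-≤ (2 * k) {{m*n≢0 2 k {{_}} {{nonZero y₀}}}} (begin
                2 * k * (4 * m * ∣ PJ j ∣)    ≡⟨ share-arith k m ∣ PJ j ∣ ⟩
                8 * m * k * ∣ PJ j ∣          ≤⟨ *-monoˡ-≤ ∣ PJ j ∣ m-R ⟩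
                R * ∣ PJ j ∣  ≤⟨ union-bound (λ y → PS (I (combine j y))) R (2 * n)
                                                  (λ y → ≤-trans (≤-reflexive (*-comm R _)) (∣PS∣ (I (combine j y)))) ⟩
                k * (2 * n)  ≡⟨ sym (*-assoc k 2 n) ⟩
                k * 2 * n  ≡⟨ cong (_* n) (*-comm k 2) ⟩
                2 * k * n  ∎)
                where
                nonZero : ∀ {k} → Fin k → NonZero k
                nonZero zero = _
                nonZero (suc _) = _

              ∣V∣ : ∀ j → ∣ V j ∣ * m ≤ n
              ∣V∣ j = *-cancelˡ-≤ 4 (begin
                4 * (∣ V j ∣ * m)  ≡⟨ scale-arith ∣ V j ∣ m ⟩
                4 * m * ∣ V j ∣  ≤⟨ *-monoʳ-≤ (4 * m) (begin
                  ∣ V j ∣  ≤⟨ card-cover {p = V j} {H ∪ PJ j} {D ─ D₀} (V-cover j) ⟩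
                  ∣ H ∪ PJ j ∣ + ∣ D ─ D₀ ∣  ≤⟨ +-mono-≤ (≤-trans (∣p∪q∣≤∣p∣+∣q∣ H (PJ j))
                                                                                   (+-monoˡ-≤ _ ∣H∣)) ∣D─D₀∣ ⟩
                  (bound + 4 * M + ∣ PJ j ∣) + (θ + 2 * (k * t * e⁺))          ∎) ⟩
                4 * m * ((bound + 4 * M + ∣ PJ j ∣) + (θ + 2 * (k * t * e⁺)))
                  ≡⟨ spread-arith (4 * m) (bound + 4 * M) ∣ PJ j ∣ θ (2 * (k * t * e⁺)) ⟩
                4 * m * (bound + 4 * M + θ) + 4 * m * ∣ PJ j ∣ + 4 * m * (2 * (k * t * e⁺))
                                                                             ≤⟨ +-mono-≤ (+-mono-≤ m-H (4m∣PJ∣ j)) m-e ⟩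
                n + n + n  ≤⟨ m≤m+n (n + n + n) n ⟩
                n + n + n + n  ≡⟨ quadruple n ⟩
                4 * n  ∎)

              parts : Parts G k t m
              parts = record
                { V = V ; apart = V-apart ; ∣V∣ = ∣V∣
                ; robust = λ j X X# → Robust.k<∣V∪X∣ j X X# , Robust.strong j X X# }

      finish : (∀ v → suc (t * k) * θ ≤ ∣ C⁻ v ∣) → (∀ v → suc (t * k) * θ ≤ ∣ C⁺ v ∣) → k ≤ θ →
        ∀ {m} → 4 * m * ((bound + 4 * M) + θ) ≤ n → 8 * m * k ≤ R → 4 * m * (2 * (k * t * e⁺)) ≤ n → Parts G k t m
      finish C⁻-large C⁺-large k≤θ m-H m-R m-e = from-E⁻ (grow D₀ colour (set free⁻?) C⁻ k E⁻-room)
        where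
        from-G⁻ : ∀ E⁻ E⁺ → FullGrowth (Growth.D′ E⁺) (Growth.own′ E⁺) (set needy⁻?) (λ v → C⁻ v ─ In.Ex) k → Parts G k t _
        from-G⁻ E⁻ E⁺ G⁻ = parts E⁻ E⁺ G⁻
          (grow-fully (FullGrowth.D′ G⁻) (FullGrowth.own′ G⁻) (set needy⁺?) (λ v → C⁺ v ─ Out.Ex) k (G⁺-room E⁻ E⁺ G⁻))
          C⁻-large C⁺-large k≤θ m-H m-R m-e
        from-E⁺ : ∀ E⁻ → Growth (Growth.D′ E⁻) (Growth.own′ E⁻) (set free⁺?) C⁺ k → Parts G k t _
        from-E⁺ E⁻ E⁺ = from-G⁻ E⁻ E⁺
          (grow-fully (Growth.D′ E⁺) (Growth.own′ E⁺) (set needy⁻?) (λ v → C⁻ v ─ In.Ex) k (G⁻-room E⁻ E⁺))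
        from-E⁻ : Growth D₀ colour (set free⁻?) C⁻ k → Parts G k t _
        from-E⁻ E⁻ = from-E⁺ E⁻ (grow (Growth.D′ E⁻) (Growth.own′ E⁻) (set free⁺?) C⁺ k (E⁺-room E⁻))

  assemble : ∀ {m} → t * k * 146 ≤ M → M + k * t ≤ N → bound + 4 * M + suc (t * k) * θ ≤ K →
    2 * ((bound + 4 * M) + θ) ≤ K →
    (∀ {v} → v ∉ In.F₀ → 2 * (suc (2 * (k * t)) * ∣ In.Ex ∣) ≤ ∣ N⁻ v ∣) →
    (∀ {v} → v ∉ In.F₀ → 2 * (suc (2 * (k * t)) * ∣ Out.Ex ∣) ≤ ∣ N⁺ v ∣) →
    ∣ In.Ex ∣ ≤ ∣ Out.Ex ∣ → k ≤ θ →
    4 * m * ((bound + 4 * M) + θ) ≤ n → 8 * m * k ≤ R → 4 * m * (2 * (k * t * ∣ Out.Ex ∣)) ≤ n → Parts G k t m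
  assemble M-room N-room K-ext K-half e⁻-small e⁺-small e⁻≤e⁺ k≤θ m-H m-R m-e =
    let I , I-inj , one-claim = Selection.select claim? Ext ∣Ext∣ (λ {v} _ → ∣claims∣ v) (t * k) M-room
    in Selected.Rooms.finish I I-inj one-claim (spares ai N-room) (spares bi N-room)
      K-half e⁻-small e⁺-small e⁻≤e⁺ (λ v → large {N⁻ v} (K≤⁻ v)) (λ v → large {N⁺ v} (K≤⁺ v)) k≤θ m-H m-R m-e
    where
    large : ∀ {X} → K ≤ ∣ X ∣ → suc (t * k) * θ ≤ ∣ X ─ H ∣
    large {X} K≤ = card-room {p = X} {H} (≤-trans (+-monoˡ-≤ _ ∣H∣) (≤-trans K-ext K≤))

-- Constants

-- The integer part of the logarithm. Its lower estimate feeds the connectivity, its upper one the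
-- number `c` of halvings.
log-bracket : ∀ p → 1 ≤ p → ∃[ l ] 2 ^ l ≤ p × p < 2 ^ suc l
log-bracket (suc zero) _ = 0 , ≤-refl , s≤s (s≤s z≤n)
log-bracket (suc (suc p)) _ with log-bracket (suc p) (s≤s z≤n)
... | l , lower , upper with suc (suc p) <? 2 ^ suc l
... | yes below = l , m≤n⇒m≤1+n lower , below
... | no ¬below = suc l , ≮⇒≥ ¬below , ≤-<-trans upper (m<m+n (2 ^ suc l) (≤-trans (m^n>0 2 (suc l)) (m≤m+n _ 0)))

bound-lower : ∀ k t m l → 2 ^ l ≤ k * t * m → l * (k ^ 6 * t ^ 2 * m * 10 ^ 7) ≤ connectivityBound k t m
bound-lower k t m l lower = begin
  l * e  ≡⟨ sym (⌈log₂2^n⌉≡n (l * e)) ⟩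
  ⌈log₂ 2 ^ (l * e) ⌉          ≡⟨ cong ⌈log₂_⌉ (sym (^-*-assoc 2 l e)) ⟩
  ⌈log₂ (2 ^ l) ^ e ⌉          ≤⟨ ⌈log₂⌉-mono-≤ (^-monoˡ-≤ e lower) ⟩
  connectivityBound k t m      ∎
  where
  open ≤-Reasoning
  e = k ^ 6 * t ^ 2 * m * 10 ^ 7

module Constants (k t m l : ℕ) (1≤k : 1 ≤ k) (1≤t : 1 ≤ t) (1≤m : 1 ≤ m) (1≤l : 1 ≤ l)
  (p<2^ : k * t * m < 2 ^ suc l) where
  open ≤-Reasoning

  M N c g₀ g₁ g₂ g₃ θ S Q Y : ℕ
  -- `M` is dictated by `select`, `N` by the fans, and `c` by the multiples of exceptional sets that
  -- must fit into a degree. `g₀` to `g₃` follow the rounds of pod building, `S` is the size of all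
  -- that is set aside before fresh vertices, and `Q` and `Y` are monomials for comparison.
  M = t * k * 146
  N = 4 * M
  c = l + l + 15
  g₀ = N * suc c + N * suc c
  g₁ = g₀ + k * g₀ + k * g₀
  g₂ = g₁ + k * g₁
  g₃ = g₂ + k * g₂
  θ = 2 * (k * (4 * M))
  S = g₃ + 4 * M + θ
  Q = t * k * l * (k * k * k)
  Y = l * (k ^ 6 * t ^ 2 * m)

  1≤* : ∀ {x y} → 1 ≤ x → 1 ≤ y → 1 ≤ x * y
  1≤* = *-mono-≤

  x≤x*y : ∀ x {y} → 1 ≤ y → x ≤ x * y
  x≤x*y x 1≤y = ≤-trans (≤-reflexive (sym (*-identityʳ x))) (*-monoʳ-≤ x 1≤y)

  1≤k³ : 1 ≤ k * k * k
  1≤k³ = 1≤* (1≤* 1≤k 1≤k) 1≤k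

  suc-c : suc c ≤ l * 18
  suc-c = begin
    suc (l + l + 15)      ≡⟨ +-comm 1 (l + l + 15) ⟩
    l + l + 15 + 1        ≡⟨ +-assoc (l + l) 15 1 ⟩
    l + l + 16            ≤⟨ +-monoʳ-≤ (l + l) (*-monoˡ-≤ 16 1≤l) ⟩
    l + l + l * 16        ≡⟨ arith l ⟩
    l * 18  ∎
    where
    arith : ∀ l → l + l + l * 16 ≡ l * 18
    arith = solve-∀

  N≡ : N ≡ t * k * 584
  N≡ = trans (*-comm 4 M) (*-assoc (t * k) 146 4)

  g₀≤ : g₀ ≤ t * k * l * 21024
  g₀≤ = begin
    N * suc c + N * suc c            ≡⟨ arith₀ (N * suc c) ⟩
    N * suc c * 2  ≤⟨ *-monoˡ-≤ 2 (*-mono-≤ (≤-reflexive N≡) suc-c) ⟩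
    t * k * 584 * (l * 18) * 2       ≡⟨ arith (t * k) 584 l 18 2 ⟩
    t * k * l * (584 * 18 * 2)       ∎
    where
    arith₀ : ∀ x → x + x ≡ x * 2
    arith₀ = solve-∀
    arith : ∀ x a l b d → x * a * (l * b) * d ≡ x * l * (a * b * d)
    arith = solve-∀

  -- As `k` is positive, the rounds cost factors `1 + 2 * k ≤ 3 * k` and twice `1 + k ≤ 2 * k`, so
  -- the coefficient is `21024 * 3 * 2 * 2`.
  g₃≤ : g₃ ≤ Q * 252288
  g₃≤ = begin
    g₂ + k * g₂  ≤⟨ double g₂ ⟩
    k * g₂ * 2  ≤⟨ *-monoˡ-≤ 2 (*-monoʳ-≤ k (double g₁)) ⟩
    k * (k * g₁ * 2) * 2  ≤⟨ *-monoˡ-≤ 2 (*-monoʳ-≤ k (*-monoˡ-≤ 2 (*-monoʳ-≤ k triple))) ⟩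
    k * (k * (k * g₀ * 3) * 2) * 2  ≤⟨ *-monoˡ-≤ 2 (*-monoʳ-≤ k (*-monoˡ-≤ 2 (*-monoʳ-≤ k
                                                  (*-monoˡ-≤ 3 (*-monoʳ-≤ k g₀≤))))) ⟩
    k * (k * (k * (t * k * l * 21024) * 3) * 2) * 2    ≡⟨ arith k (t * k * l) 21024 3 2 ⟩
    Q * (21024 * 3 * 2 * 2)  ∎
    where
    arith₁ : ∀ x → x + x ≡ x * 2
    arith₁ = solve-∀
    arith₂ : ∀ x → x + x + x ≡ x * 3
    arith₂ = solve-∀
    g≤kg : ∀ g → g ≤ k * g
    g≤kg g = ≤-trans (x≤x*y g 1≤k) (≤-reflexive (*-comm g k))
    double : ∀ g → g + k * g ≤ k * g * 2
    double g = ≤-trans (+-monoˡ-≤ _ (g≤kg g)) (≤-reflexive (arith₁ (k * g)))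
    triple : g₁ ≤ k * g₀ * 3
    triple = ≤-trans (+-monoˡ-≤ _ (+-monoˡ-≤ _ (g≤kg g₀))) (≤-reflexive (arith₂ (k * g₀)))
    arith : ∀ k x a b d → k * (k * (k * (x * a) * b) * d) * d ≡ x * (k * k * k) * (a * b * d * d)
    arith = solve-∀

  tk≤Q : t * k ≤ Q
  tk≤Q = ≤-trans (x≤x*y (t * k) 1≤l) (x≤x*y (t * k * l) 1≤k³)

  4M≤ : 4 * M ≤ Q * 584
  4M≤ = ≤-trans (≤-reflexive N≡) (*-monoˡ-≤ 584 tk≤Q)

  θ≡ : θ ≡ k * (t * k) * 1168
  θ≡ = trans (cong (λ x → 2 * (k * x)) N≡) (arith k (t * k) 584 2)
    where
    arith : ∀ k x a b → b * (k * (x * a)) ≡ k * x * (a * b)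
    arith = solve-∀

  ktk≤Q : k * (t * k) ≤ Q
  ktk≤Q = begin
    k * (t * k)  ≤⟨ x≤x*y _ (1≤* 1≤l (1≤* 1≤k 1≤k)) ⟩
    k * (t * k) * (l * (k * k))      ≡⟨ arith k t l ⟩
    Q  ∎
    where
    arith : ∀ k t l → k * (t * k) * (l * (k * k)) ≡ t * k * l * (k * k * k)
    arith = solve-∀

  S≤ : S ≤ Q * 254040
  S≤ = begin
    g₃ + 4 * M + θ  ≤⟨ +-mono-≤ (+-mono-≤ g₃≤ 4M≤) (≤-trans (≤-reflexive θ≡) (*-monoˡ-≤ 1168 ktk≤Q)) ⟩
    Q * 252288 + Q * 584 + Q * 1168           ≡⟨ arith Q 252288 584 1168 ⟩
    Q * (252288 + 584 + 1168)  ∎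
    where
    arith : ∀ q a b d → q * a + q * b + q * d ≡ q * (a + b + d)
    arith = solve-∀

  Qm≤Y : Q * m ≤ Y
  Qm≤Y = begin
    Q * m  ≤⟨ x≤x*y _ (1≤* (1≤* 1≤k 1≤k) 1≤t) ⟩
    Q * m * (k * k * t)       ≡⟨ arith k t l m ⟩
    Y  ∎
    where
    arith : ∀ k t l m → t * k * l * (k * k * k) * m * (k * k * t) ≡ l * (k * (k * (k * (k * (k * (k * 1))))) * (t * (t * 1)) * m)
    arith = solve-∀

  4mS≤ : 4 * m * S ≤ Y * 1016160
  4mS≤ = begin
    4 * m * S  ≤⟨ *-monoʳ-≤ (4 * m) S≤ ⟩
    4 * m * (Q * 254040)      ≡⟨ arith m Q 254040 4 ⟩
    Q * m * (254040 * 4)      ≤⟨ *-monoˡ-≤ (254040 * 4) Qm≤Y ⟩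
    Y * (254040 * 4)          ∎
    where
    arith : ∀ m q a b → b * m * (q * a) ≡ q * m * (a * b)
    arith = solve-∀

  ext≤ : g₃ + 4 * M + suc (t * k) * θ ≤ Y * 256376
  ext≤ = begin
    g₃ + 4 * M + suc (t * k) * θ  ≤⟨ +-mono-≤ {g₃ + 4 * M} (≤-trans (m≤m+n (g₃ + 4 * M) θ) S≤) (*-mono-≤ suc≤ (≤-reflexive θ≡)) ⟩
    Q * 254040 + t * k * 2 * (k * (t * k) * 1168)  ≤⟨ +-mono-≤ (*-monoˡ-≤ 254040 (≤-trans (x≤x*y Q 1≤m) Qm≤Y))
                                                         (≤-trans (≤-reflexive (arith₁ (t * k) (k * (t * k)) 2 1168)) (*-monoˡ-≤ 2336 monomial)) ⟩
    Y * 254040 + Y * 2336  ≡⟨ sym (*-distribˡ-+ Y 254040 2336) ⟩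
    Y * 256376  ∎
    where
    suc≤ : suc (t * k) ≤ t * k * 2
    suc≤ = ≤-trans (+-monoˡ-≤ (t * k) (1≤* 1≤t 1≤k)) (≤-reflexive (arith₀ (t * k)))
      where
      arith₀ : ∀ x → x + x ≡ x * 2
      arith₀ = solve-∀
    arith₁ : ∀ x y a b → x * a * (y * b) ≡ x * y * (a * b)
    arith₁ = solve-∀
    monomial : t * k * (k * (t * k)) ≤ Y
    monomial = begin
      t * k * (k * (t * k))  ≤⟨ x≤x*y _ (1≤* (1≤* 1≤l 1≤k³) 1≤m) ⟩
      t * k * (k * (t * k)) * (l * (k * k * k) * m)    ≡⟨ arith₂ k t l m ⟩
      Y  ∎
      where
      arith₂ : ∀ k t l m → t * k * (k * (t * k)) * (l * (k * k * k) * m) ≡ l * (k * (k * (k * (k * (k * (k * 1))))) * (t * (t * 1)) * m)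
      arith₂ = solve-∀

  -- 2^c dominates 8192 (k t m)², hence every multiplier of an exceptional set that occurs.

  p²≤ : (k * t * m) * (k * t * m) * 8192 ≤ 2 ^ c
  p²≤ = begin
    (k * t * m) * (k * t * m) * 8192      ≤⟨ *-monoˡ-≤ 8192 (*-mono-≤ (<⇒≤ p<2^) (<⇒≤ p<2^)) ⟩
    2 ^ suc l * 2 ^ suc l * 2 ^ 13  ≡⟨ cong (_* 2 ^ 13) (sym (^-distribˡ-+-* 2 (suc l) (suc l))) ⟩
    2 ^ (suc l + suc l) * 2 ^ 13          ≡⟨ sym (^-distribˡ-+-* 2 (suc l + suc l) 13) ⟩
    2 ^ (suc l + suc l + 13)  ≡⟨ cong (2 ^_) (arith l) ⟩
    2 ^ c  ∎
    where
    arith : ∀ l → suc l + suc l + 13 ≡ l + l + 15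
    arith = solve-∀

  8mktN≤ : 8 * m * (k * t) * N ≤ 2 ^ c
  8mktN≤ = begin
    8 * m * (k * t) * N  ≡⟨ cong (8 * m * (k * t) *_) N≡ ⟩
    8 * m * (k * t) * (t * k * 584)          ≡⟨ arith k t m 8 584 ⟩
    -- `8 * 584 = 4672`, and `8192 = 2 ^ 13` is the next power of two.
    k * t * (k * t * m) * (8 * 584)  ≤⟨ *-mono-≤ (*-monoˡ-≤ (k * t * m) (x≤x*y (k * t) 1≤m)) (≤ᵇ⇒≤ 4672 8192 _) ⟩
    (k * t * m) * (k * t * m) * 8192         ≤⟨ p²≤ ⟩
    2 ^ c  ∎
    where
    arith : ∀ k t m a b → a * m * (k * t) * (t * k * b) ≡ k * t * (k * t * m) * (a * b)
    arith = solve-∀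

  multiplier : ∀ {x} → x ≤ 8 * m * (k * t) → x * N ≤ 2 ^ c
  multiplier x≤ = ≤-trans (*-monoˡ-≤ N x≤) 8mktN≤

  1≤kt : 1 ≤ k * t
  1≤kt = 1≤* 1≤k 1≤t

  4≤ : 4 ≤ 8 * m * (k * t)
  4≤ = *-mono-≤ {4} {8 * m} {1} (*-mono-≤ {4} {8} {1} (≤ᵇ⇒≤ 4 8 _) 1≤m) 1≤kt

  6kt≤ : 2 * suc (2 * (k * t)) ≤ 8 * m * (k * t)
  6kt≤ = begin
    2 * (1 + 2 * (k * t))          ≤⟨ *-monoʳ-≤ 2 (+-monoˡ-≤ _ 1≤kt) ⟩
    2 * (k * t + 2 * (k * t))      ≡⟨ arith (k * t) ⟩
    6 * (k * t)  ≤⟨ *-monoˡ-≤ (k * t) (*-mono-≤ {6} {8} {1} (≤ᵇ⇒≤ 6 8 _) 1≤m) ⟩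
    8 * m * (k * t)  ∎
    where
    arith : ∀ x → 2 * (x + 2 * x) ≡ 6 * x
    arith = solve-∀

-- The construction with the chosen constants

module Main {n : ℕ} (k t m l K : ℕ) (1≤k : 1 ≤ k) (1≤t : 1 ≤ t) (1≤m : 1 ≤ m) (1≤l : 1 ≤ l)
  (p<2^ : k * t * m < 2 ^ suc l) (K-large : l * (k ^ 6 * t ^ 2 * m) * 10 ^ 7 ≤ K) (K<n : K < n) where
  open Constants k t m l 1≤k 1≤t 1≤m 1≤l p<2^
  open ≤-Reasoning

  10⁷-covers : ∀ {x} a → x ≤ Y * a → a ≤ 10 ^ 7 → x ≤ K
  10⁷-covers a x≤ a≤ = ≤-trans x≤ (≤-trans (*-monoʳ-≤ Y a≤) K-large)

  4mS≤K : 4 * m * S ≤ K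
  4mS≤K = 10⁷-covers 1016160 4mS≤ (≤ᵇ⇒≤ 1016160 (10 ^ 7) _)

  ext≤K : g₃ + 4 * M + suc (t * k) * θ ≤ K
  ext≤K = 10⁷-covers 256376 ext≤ (≤ᵇ⇒≤ 256376 (10 ^ 7) _)

  2mS≤K : 2 * (S * m) ≤ K
  2mS≤K = begin
    2 * (S * m)    ≤⟨ *-monoˡ-≤ (S * m) (≤ᵇ⇒≤ 2 4 _) ⟩
    4 * (S * m)    ≡⟨ arith S m ⟩
    4 * m * S      ≤⟨ 4mS≤K ⟩
    K  ∎
    where
    arith : ∀ s m → 4 * (s * m) ≡ 4 * m * s
    arith = solve-∀

  2S≤K : 2 * S ≤ K
  2S≤K = ≤-trans (*-monoʳ-≤ 2 (x≤x*y S 1≤m)) 2mS≤K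

  g₃≤S : g₃ ≤ S
  g₃≤S = ≤-trans (m≤m+n g₃ (4 * M)) (m≤m+n (g₃ + 4 * M) θ)

  2g₃≤K : 2 * g₃ ≤ K
  2g₃≤K = ≤-trans (*-monoʳ-≤ 2 g₃≤S) 2S≤K

  g₀≤g₃ : g₀ ≤ g₃
  g₀≤g₃ = ≤-trans (m≤m+n g₀ (k * g₀)) (≤-trans (m≤m+n (g₀ + k * g₀) (k * g₀))
    (≤-trans (m≤m+n g₁ (k * g₁)) (m≤m+n g₂ (k * g₂))))

  g₀≤K : g₀ ≤ K
  g₀≤K = ≤-trans g₀≤g₃ (≤-trans (m≤m+n g₃ (g₃ + 0)) 2g₃≤K)

  fan-room : g₃ + N * m ≤ K
  fan-room = begin
    g₃ + N * m          ≤⟨ +-mono-≤ (≤-trans g₃≤S (x≤x*y S 1≤m))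
                             (*-monoˡ-≤ m (≤-trans (m≤n+m (4 * M) g₃) (m≤m+n (g₃ + 4 * M) θ))) ⟩
    S * m + S * m       ≡⟨ cong (S * m +_) (sym (+-identityʳ (S * m))) ⟩
    2 * (S * m)         ≤⟨ 2mS≤K ⟩
    K  ∎

  spare-room : M + k * t ≤ N
  spare-room = begin
    M + k * t  ≤⟨ +-monoʳ-≤ M (≤-trans (≤-reflexive (*-comm k t)) (x≤x*y (t * k) (≤ᵇ⇒≤ 1 146 _))) ⟩
    M + M          ≤⟨ +-monoʳ-≤ M (m≤m+n M (M + (M + 0))) ⟩
    4 * M          ∎

  k≤θ : k ≤ θ
  k≤θ = begin
    k  ≤⟨ x≤x*y k (1≤* 1≤t 1≤k) ⟩
    k * (t * k)             ≤⟨ x≤x*y (k * (t * k)) (≤ᵇ⇒≤ 1 1168 _) ⟩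
    k * (t * k) * 1168      ≡⟨ sym θ≡ ⟩
    θ  ∎

  share-room : 8 * m * k ≤ N * m
  share-room = begin
    8 * m * k          ≡⟨ arith m k 8 ⟩
    k * 8 * m  ≤⟨ *-monoˡ-≤ m (*-mono-≤ (≤-trans (x≤x*y k 1≤t) (≤-reflexive (*-comm k t))) (≤ᵇ⇒≤ 8 584 _)) ⟩
    t * k * 584 * m    ≡⟨ cong (_* m) (sym N≡) ⟩
    N * m  ∎
    where
    arith : ∀ m k a → a * m * k ≡ k * a * m
    arith = solve-∀

  Fin⁺ : ∀ {x} → 1 ≤ x → Fin x
  Fin⁺ (s≤s _) = zero

  1≤M : 1 ≤ M
  1≤M = 1≤* (1≤* 1≤t 1≤k) (≤ᵇ⇒≤ 1 146 _)

  1≤N : 1 ≤ N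
  1≤N = ≤-trans 1≤M (m≤m+n M _)

  module Oriented (G : Arcs n) (conn : Arcs.Connected G K) (bl : Blocks G N c) where
    open Arcs G
    module In = Blocks bl

    exceptional : ∀ {x e d} → x ≤ 8 * m * (k * t) → 2 ^ c * e ≤ N * d → x * e ≤ d
    exceptional {x} {e} {d} x≤ e≤ = *-cancelˡ-≤ N {{>-nonZero 1≤N}} (begin
      N * (x * e)    ≡⟨ sym (*-assoc N x e) ⟩
      N * x * e      ≡⟨ cong (_* e) (*-comm N x) ⟩
      x * N * e      ≤⟨ *-monoˡ-≤ e (multiplier x≤) ⟩
      2 ^ c * e      ≤⟨ e≤ ⟩
      N * d          ∎)

    small-Ex : ∀ {x v} → x ≤ 8 * m * (k * t) → v ∉ In.F₀ → x * ∣ In.Ex ∣ ≤ ∣ N⁻ v ∣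
    small-Ex x≤ v∉ = exceptional x≤ (In.Ex-small v∉)

    -- The exceptional set is compared with the degree of any vertex outside `F₀`, and no degree
    -- exceeds `n`.
    share-Ex : 4 * m * (2 * (k * t * ∣ In.Ex ∣)) ≤ n
    share-Ex = case ∃∈∉ ⊤ In.F₀ (begin-strict
        ∣ In.F₀ ∣      ≤⟨ In.∣F₀∣ ⟩
        g₀             ≤⟨ g₀≤K ⟩
        K  <⟨ K<n ⟩
        n  ≡⟨ sym (∣⊤∣≡n n) ⟩
        ∣ ⊤ {n} ∣      ∎) of λ (v , _ , v∉) → begin
      4 * m * (2 * (k * t * ∣ In.Ex ∣))    ≡⟨ arith m (k * t) ∣ In.Ex ∣ ⟩
      8 * m * (k * t) * ∣ In.Ex ∣          ≤⟨ small-Ex ≤-refl v∉ ⟩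
      ∣ N⁻ v ∣  ≤⟨ ∣p∣≤n (N⁻ v) ⟩
      n  ∎
      where
      arith : ∀ m x e → 4 * m * (2 * (x * e)) ≡ 8 * m * x * e
      arith = solve-∀

    min⁻ : ∀ v → K ≤ ∣ N⁻ v ∣
    min⁻ = Degrees.min-degree G conn K<n

  module _ (G : Arcs n) (conn : Arcs.Connected G K) (bl : Blocks G N c) where
    private
      module O⁻ = Oriented G conn bl
      module O⁺ = Oriented (op G) (op-connected G conn) (op-blocks bl)

    from-pods : (pods : Pods bl k g₃) → ∣ Blocks.Ex bl ∣ ≤ ∣ Blocks.Ex (op-blocks bl) ∣ → Parts G k t m
    from-pods pods e⁻≤e⁺ =
      -- Fans of `m` neighbours yield `N * m` walks, which makes the walks short enough for the
      -- bound `n / m`.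
      let sys , tight , tightᵒ = InitialSystem.tight-system G {N} {m} {M} (Blocks.α bl) (Blocks.β bl) (Pods.F pods) K
            conn O⁻.min⁻ O⁺.min⁻ (≤-trans (+-monoˡ-≤ (N * m) (Pods.∣F∣ pods)) fan-room) 1≤m ≤-refl (≤-trans (s≤s z≤n) K<n)
      in Assembly.assemble bl pods (routing bl sys tight tightᵒ) {t} {K} (Fin⁺ 1≤t) (Fin⁺ 1≤k) (Fin⁺ 1≤M) O⁻.min⁻ O⁺.min⁻
        {m} ≤-refl spare-room ext≤K 2S≤K
        (λ {v} v∉ → ≤-trans (≤-reflexive (sym (*-assoc 2 (suc (2 * (k * t))) _))) (O⁻.small-Ex 6kt≤ v∉))
        (λ {v} v∉ → ≤-trans (≤-reflexive (sym (*-assoc 2 (suc (2 * (k * t))) _))) (O⁺.small-Ex 6kt≤ v∉))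
        e⁻≤e⁺ k≤θ (≤-trans 4mS≤K (<⇒≤ K<n)) share-room O⁺.share-Ex

    oriented-parts : ∣ Blocks.Ex bl ∣ ≤ ∣ Blocks.Ex (op-blocks bl) ∣ → Parts G k t m
    oriented-parts e⁻≤e⁺ = from-pods (build-pods bl k g₀ (Fin⁺ 1≤N) (Blocks.∣F₀∣ bl) 2g₃≤K O⁻.min⁻ O⁺.min⁻
      (O⁻.small-Ex 4≤) (O⁺.small-Ex 4≤) e⁻≤e⁺) e⁻≤e⁺

  connected-parts : (G : Arcs n) → Arcs.Connected G K → Parts G k t m
  connected-parts G conn = either (≤-total ∣ Blocks.Ex bl ∣ ∣ Blocks.Ex (op-blocks bl) ∣)
    where
    bl = blocks G N c (≤-trans g₀≤K (<⇒≤ K<n))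
    either : ∣ Blocks.Ex bl ∣ ≤ ∣ Blocks.Ex (op-blocks bl) ∣ ⊎ ∣ Blocks.Ex (op-blocks bl) ∣ ≤ ∣ Blocks.Ex bl ∣ → Parts G k t m
    either (inj₁ e⁻≤e⁺) = oriented-parts G conn bl e⁻≤e⁺
    either (inj₂ e⁺≤e⁻) = op-parts (oriented-parts (op G) (op-connected G conn) (op-blocks bl) e⁺≤e⁻)

-- From tournaments to the stated theorem

∈⋃⁺ : ∀ {t} (V : Fin t → Subset n) {i x} → x ∈ V i → x ∈ ⋃ (tabulate V)
∈⋃⁺ V {zero} x∈ = x∈p∪q⁺ (inj₁ x∈)
∈⋃⁺ V {suc i} x∈ = x∈p∪q⁺ {p = V zero} (inj₂ (∈⋃⁺ (V ∘ suc) x∈))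

arcs : Tournament n → Arcs n
arcs T = record
  { _⟶_ = _⟶_
  ; _⟶?_ = λ u v → case compare u v of λ
      { (tri< u⟶v _ _) → yes u⟶v ; (tri≈ u⟶̸v _ _) → no u⟶̸v ; (tri> u⟶̸v _ _) → no u⟶̸v }
  ; connex = λ {u} {v} u≢v → case compare u v of λ
      { (tri< u⟶v _ _) → inj₁ u⟶v ; (tri≈ _ u≡v _) → contradiction u≡v u≢v ; (tri> _ _ v⟶u) → inj₂ v⟶u }
  ; asym = λ {u} {v} u⟶v v⟶u → case compare u v of λ
      { (tri< _ _ v⟶̸u) → v⟶̸u v⟶u ; (tri≈ u⟶̸v _ _) → u⟶̸v u⟶v ; (tri> u⟶̸v _ _) → u⟶̸v u⟶v } }
  where open Tournament T

arcs-connected : (T : Tournament n) {K : ℕ} → Strongly T -Connected K ⊤ → Arcs.Connected (arcs T) K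
arcs-connected T (_ , conn) S S<K u∈ v∈ =
  Star.map (λ (u∈ , v∈ , arc) → outside u∈ , outside v∈ , arc) (conn S ⊆⊤ S<K (inside u∈) (inside v∈))
  where
  inside : ∀ {x} → x ∈ ∁ S → x ∈ ⊤ ─ S
  inside x∈ = x∈p∧x∉q⇒x∈p─q ∈⊤ (x∈∁p⇒x∉p x∈)
  outside : ∀ {x} → x ∈ ⊤ ─ S → x ∈ ∁ S
  outside x∈ = x∉p⇒x∈∁p (proj₂ (x∈p─q⁻ ⊤ S x∈))

tournament-parts : (T : Tournament n) (k m t : ℕ) → k ≥ 1 → m ≥ t → t ≥ 2 →
  Strongly T -Connected (connectivityBound k t m) ⊤ → Parts (arcs T) k t m
tournament-parts {n} T k m t 1≤k t≤m 2≤t strong@(K<∣⊤∣ , _) with log-bracket (k * t * m) 1≤p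
  where
  1≤p : 1 ≤ k * t * m
  1≤p = *-mono-≤ (*-mono-≤ 1≤k (<⇒≤ 2≤t)) (≤-trans (<⇒≤ 2≤t) t≤m)
... | l , lower , upper = Main.connected-parts k t m l K 1≤k 1≤t 1≤m 1≤l upper
    (≤-trans (≤-reflexive (*-assoc l _ (10 ^ 7))) (bound-lower k t m l lower))
    (subst (K <_) (∣⊤∣≡n n) K<∣⊤∣) (arcs T) (arcs-connected T strong)
  where
  K = connectivityBound k t m
  1≤t : 1 ≤ t
  1≤t = <⇒≤ 2≤t
  1≤m : 1 ≤ m
  1≤m = ≤-trans 1≤t t≤m
  -- From `t ≥ 2` and `m ≥ t` the product `k * t * m` is at least 2. A positive `l` lets the
  -- additive constants in `c` be absorbed into multiples of `l`.
  1≤l : 1 ≤ l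
  1≤l = ≰⇒> λ l≤0 → contradiction (*-mono-≤ {1} {k * t} {2} (*-mono-≤ 1≤k 1≤t) (≤-trans 2≤t t≤m))
    (<⇒≱ (subst (λ l → k * t * m < 2 ^ suc l) (n≤0⇒n≡0 l≤0) upper))

theorem1p5 : (n : ℕ) (T : Tournament n) (k m t : ℕ) → k ≥ 1 → m ≥ t → t ≥ 2 →
    Strongly T -Connected (connectivityBound k t m) ⊤ →
    ∃ λ (V : Fin t → Subset n) →
    (∀ i j → i ≢ j → Empty (V i ∩ V j)) ×
    (∀ j →
    (∣ V j ∣ * m ≤ n) ×
    (∀ (R : Subset n) → R ⊆ ∁ (⋃ (tabulate V)) →
    Strongly T -Connected k (V j ∪ R)))
theorem1p5 n T k m t k≥1 m≥t t≥2 strong =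
  V ,
  (λ i j i≢j (x , x∈) → i≢j (let x∈i , x∈j = x∈p∩q⁻ (V i) (V j) x∈ in apart x∈i x∈j)) ,
  λ j → ∣V∣ j , λ R R⊆ →
    let k< , conn = robust j R λ v∈ i v∈i → x∈∁p⇒x∉p (R⊆ v∈) (∈⋃⁺ V v∈i)
    in k< , λ S _ S<k → conn S S<k
  where open Parts (tournament-parts T k m t k≥1 m≥t t≥2 strong)
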